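{- Let $Y$ be the affine curve (of genus 5) over $\mathbb{Q}$ in coordinates $(x,y,z)$ defined by \[ y^2 = -(x^2-3)(x^2+1), \qquad z^2 = -2(x^3-x^2-x-1). \] Then $Y(\mathbb{Q},2) = Y(\mathbb{Q}) = \{(\pm1,\pm2,\pm2)\}$.
   Context: For a curve $X$ defined over $\mathbb{Q}$, $X(\mathbb{Q},2)$ denotes the set of points $P \in X(\overline{\mathbb{Q}})$ with $[\mathbb{Q}(P):\mathbb{Q}] \le 2$. Sign choices are independent. -}

module Defs where

open import Data.Integer using (ℤ; +_; -[1+_])
import Data.Integer as ℤ
open import Data.Rational using (ℚ; _/_)
import Data.Rational as Q
open import Data.Product using (_×_; _,_; ∃)
open import Data.Sum using (_⊎_)
open import Relation.Binary.PropositionalEquality using (_≡_)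
open import Relation.Nullary using (¬_)

-- The quadratic extension ℚ(√d) represented as pairs (a , b) ↦ a + b√d,
-- for a fixed d ∈ ℤ (meaningful as a field when d is not a perfect square).
Q√ : ℤ → Set
Q√ d = ℚ × ℚ

NonSquare : ℤ → Set
NonSquare d = ¬ ∃ λ (m : ℤ) → m ℤ.* m ≡ d

module Arith (d : ℤ) where
  dq : ℚ
  dq = d / 1

  emb : ℚ → Q√ d
  emb a = a , Q.0ℚ

  lit : ℤ → Q√ d
  lit n = emb (n / 1)

  _⊕_ : Q√ d → Q√ d → Q√ d
  (a , b) ⊕ (c , e) = a Q.+ c , b Q.+ e

  ⊖_ : Q√ d → Q√ d
  ⊖ (a , b) = Q.- a , Q.- b

  _⊝_ : Q√ d → Q√ d → Q√ d
  u ⊝ v = u ⊕ (⊖ v)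

  _⊗_ : Q√ d → Q√ d → Q√ d
  (a , b) ⊗ (c , e) = (a Q.* c) Q.+ (dq Q.* (b Q.* e)) , (a Q.* e) Q.+ (b Q.* c)

  infixl 6 _⊕_ _⊝_
  infixl 7 _⊗_

OnY : (d : ℤ) → Q√ d → Q√ d → Q√ d → Set
OnY d x y z =
  (y ⊗ y ≡ ⊖ ((x ⊗ x ⊝ lit (+ 3)) ⊗ (x ⊗ x ⊕ lit (+ 1))))
  × (z ⊗ z ≡ lit (-[1+ 1 ]) ⊗ (x ⊗ x ⊗ x ⊝ x ⊗ x ⊝ x ⊝ lit (+ 1)))
  where open Arith d

IsListedPoint : (d : ℤ) → Q√ d → Q√ d → Q√ d → Set
IsListedPoint d x y z =
  (x ≡ lit (+ 1) ⊎ x ≡ lit (-[1+ 0 ]))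
  × (y ≡ lit (+ 2) ⊎ y ≡ lit (-[1+ 1 ]))
  × (z ≡ lit (+ 2) ⊎ z ≡ lit (-[1+ 1 ]))
  where open Arith d

{-# OPTIONS --safe #-}
-- Take x quadratic over ℚ with trace s and norm n, and restrict y and z to functions linear in x.
-- The first equation gives a rational point on the elliptic curve Y² = (p + 2)(p² + 12), which has
-- p = ±2, so that s = 0 or s² + (n - 1)² = 4. For the second, the line through the point and its
-- conjugate meets z² = -2(x³ - x² - x - 1), a model of the modular curve y² + y = x³ - x², in a
-- third rational point; this expresses s and n in terms of the slope of the line. Together the two
-- conditions make s² - 4n a square. If x is rational, then either y or z is rational and one of
-- the two elliptic curves applies, or yz is rational up to a square and x comes from the curve
-- w² = 2(x² - 3)(x² + 1)(x³ - x² - x - 1) of genus 3, whose coprime factors reduce it to the first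
-- elliptic curve or to x⁴ + x²y² + y⁴ = z².
--
-- Rational points of the first elliptic curve are found by descent through x⁴ ± x²y² + y⁴ = z².
-- Those of the second are found by 2-descent over ℤ[θ], θ³ = θ² + θ + 1, which is norm-Euclidean
-- with units ±θᵏ: if r / t² is the x-coordinate of a point, t² + r (θ² - 1) is a square, the
-- point is a double, and a half has smaller height.

module Submission where

open import Algebra.Bundles using (AbelianGroup; CommutativeRing)
open import Algebra.Properties.Group using (∙-cancelʳ)
open import Data.Empty using (⊥; ⊥-elim)
open import Data.Integer using (ℤ; +_; -[1+_]; _+_; _*_; _-_; -_; 0ℤ; 1ℤ; -1ℤ; _≤_; +≤+)
  renaming (∣_∣ to abs)
open import Data.Integer.DivMod using (a≡a%ℕn+[a/ℕn]*n; n%ℕd<d; _/ℕ_; _%ℕ_)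
open import Data.Integer.Divisibility.Signed
open import Data.Integer.Properties
open import Data.Integer.Tactic.RingSolver using (solve)
open import Data.Fin using (Fin; toℕ)
open import Data.Fin.Properties using (all?; any?)
open import Data.List using (List; []; _∷_; map)
open import Data.List.Relation.Unary.All as All using (All)
open import Data.Maybe using (just; nothing)
open import Data.Nat using (ℕ; zero; suc)
import Data.Nat as ℕ
import Data.Nat.Divisibility as ℕ
import Data.Nat.GCD as ℕ
import Data.Nat.Primality as ℕ
import Data.Nat.Properties as ℕ
open import Data.Product using (_×_; _,_; ∃-syntax; proj₁; proj₂)
open import Data.Sum using (_⊎_; inj₁; inj₂; [_,_]′)
open import Level using (0ℓ)
open import Relation.Binary.PropositionalEquality
open import Relation.Binary.PropositionalEquality.Properties using (isEquivalence)
open import Relation.Nullary using (Dec; yes; no)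
open import Relation.Nullary.Decidable using (dec⇒maybe; toWitness; _×-dec_)
import Tactic.RingSolver as Solver
open import Tactic.RingSolver.Core.AlmostCommutativeRing using (AlmostCommutativeRing; fromCommutativeRing)
open import Data.Nat.Induction using (<-wellFounded)
open import Induction.WellFounded using (Acc; acc)
open import Data.Rational using (ℚ; 0ℚ; 1ℚ; mkℚ; _/_; ↥_; ↧ₙ_)
  renaming (_+_ to _+ᵠ_; _*_ to _*ᵠ_; _-_ to _-ᵠ_; -_ to -ᵠ_)
import Data.Rational.Properties as ℚ
import Data.Rational.Unnormalised as ℚᵘ
import Data.Rational.Unnormalised.Properties as ℚᵘ
import Data.Nat.Coprimality as ℕC
open import Function.Bundles using (_⇔_; mk⇔)
open import Defs

-- When x is irrational it generates the field, so y = a + bx, and the quartic T⁴ - 2T² - 3 + (a +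
-- bT)² is divisible by the minimal polynomial of x. The number p is the sum of the constant terms
-- of its two quadratic factors, a root of the resolvent cubic, which is why it leads to an elliptic
-- curve. In the end the only possible polynomials are T² - 1 and (T ± 1)²: the listed abscissae,
-- taken in pairs. The main obstacle is the modular curve. Its five rational points form a group of
-- odd order, so there is no rational 2-torsion and a 2-descent cannot stay in ℤ. It needs unique
-- factorisation and the units modulo squares of a cubic ring of discriminant -44. Both are obtained
-- by elementary means: Euclidean division from a finite check over small boxes, and units from a
-- reduction of coordinates into the cone where they are nonnegative. The primes 2 and 11, which
-- divide the discriminant, account for the case distinctions on t and for the constants in the
-- coprimality arguments.

variable
  a b c : ℤ

-- Linear combination of hypotheses: L - R is a combination of the l - r, with
-- both sides moved so that no subtraction occurs.
module LinearCombination {A : Set} (_+_ _*_ : A → A → A)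
  (cancel : ∀ x y z → y + x ≡ z + x → y ≡ z) where

  lin1 : ∀ {l r x y} c → l ≡ r → x + (c * r) ≡ y + (c * l) → x ≡ y
  lin1 c refl = cancel _ _ _

  lin2 : ∀ {l r l′ r′ x y} c c′ → l ≡ r → l′ ≡ r′ →
    x + ((c * r) + (c′ * r′)) ≡ y + ((c * l) + (c′ * l′)) → x ≡ y
  lin2 c c′ refl refl = cancel _ _ _

  lin3 : ∀ {l r l′ r′ l″ r″ x y} c c′ c″ → l ≡ r → l′ ≡ r′ → l″ ≡ r″ →
    x + (((c * r) + (c′ * r′)) + (c″ * r″)) ≡ y + (((c * l) + (c′ * l′)) + (c″ * l″)) → x ≡ y
  lin3 c c′ c″ refl refl refl = cancel _ _ _

open LinearCombination _+_ _*_ (∙-cancelʳ (AbelianGroup.group +-0-abelianGroup))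

-- Order, parity and congruences in ℤ

either : ∀ {A B C : Set} → A ⊎ B → (A → C) → (B → C) → C
either s f g = [ f , g ]′ s

noZeroDiv : ∀ a → a * b ≡ 0ℤ → a ≡ 0ℤ ⊎ b ≡ 0ℤ
noZeroDiv a = i*j≡0⇒i≡0∨j≡0 a

sq≡0 : ∀ a → a * a ≡ 0ℤ → a ≡ 0ℤ
sq≡0 a e = either (noZeroDiv a e) (λ p → p) (λ p → p)

cancelˡ : ∀ a → a ≢ 0ℤ → a * b ≡ a * c → b ≡ c
cancelˡ {b} {c} a a≢0 e = either (noZeroDiv {b - c} a eq) (λ p → ⊥-elim (a≢0 p))
  fin
  where
  eq : a * (b - c) ≡ 0ℤ
  eq = lin1 1ℤ e (solve (a ∷ b ∷ c ∷ []))
  fin : b - c ≡ 0ℤ → b ≡ c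
  fin p = lin1 1ℤ p (solve (b ∷ c ∷ []))

0≤+ : 0ℤ ≤ a → 0ℤ ≤ b → 0ℤ ≤ a + b
0≤+ = +-mono-≤

0≤* : 0ℤ ≤ a → 0ℤ ≤ b → 0ℤ ≤ a * b
0≤* {+ m} {+ n} _ _ = subst (0ℤ ≤_) (pos-* m n) (+≤+ ℕ.z≤n)

0≤n : ∀ n → 0ℤ ≤ + n
0≤n n = +≤+ ℕ.z≤n

0≤sq : ∀ a → 0ℤ ≤ a * a
0≤sq (+ n) = 0≤* (0≤n n) (0≤n n)
0≤sq -[1+ n ] = +≤+ ℕ.z≤n

-- Strict inequalities are stored as `0ℤ ≤ - a - 1ℤ`, so that both sides of a split on signs supply
-- a nonnegative expression which can be added and multiplied.
0≤⊎0< : ∀ a → 0ℤ ≤ a ⊎ 0ℤ ≤ - a - 1ℤ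
0≤⊎0< (+ n) = inj₁ (0≤n n)
0≤⊎0< -[1+ n ] = inj₂ (0≤n n)

¬0≤-1- : 0ℤ ≤ a → 0ℤ ≤ - a - 1ℤ → ⊥
¬0≤-1- {+ zero} _ ()
¬0≤-1- {+ suc n} _ ()

infixr 0 _by_
_by_ : 0ℤ ≤ a → a ≡ b → 0ℤ ≤ b
p by refl = p

parity : ∀ n → (∃[ k ] n ≡ + 2 * k) ⊎ (∃[ k ] n ≡ + 2 * k + 1ℤ)
parity n with n %ℕ 2 | n%ℕd<d n 2 | a≡a%ℕn+[a/ℕn]*n n 2
... | 0 | _ | e = inj₁ (n /ℕ 2 , trans e (solve-with (n /ℕ 2)))
  where solve-with : ∀ q → + 0 + q * + 2 ≡ + 2 * q
        solve-with q = solve (q ∷ [])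
... | 1 | _ | e = inj₂ (n /ℕ 2 , trans e (solve-with (n /ℕ 2)))
  where solve-with : ∀ q → + 1 + q * + 2 ≡ + 2 * q + 1ℤ
        solve-with q = solve (q ∷ [])
... | suc (suc _) | ℕ.s≤s (ℕ.s≤s ()) | _

-- Contradictions modulo 2, 4, 8, 9 and 11 are brought to this form, with the quotient k written out
-- explicitly.
¬mult : ∀ m r k → r ℕ.< m → + suc m * k ≡ + suc r → ⊥
¬mult m r k r<m e = ℕ.<⇒≱ (ℕ.s≤s r<m) (ℕ.∣⇒≤ (∣⇒∣ᵤ (divides {k = + suc m} k (trans (sym e) (*-comm (+ suc m) k)))))

-- Coprimality and coprime factors of squares

-- With the Bézout coefficients as the witness, closure under products, divisors and congruence is a
-- polynomial identity for the ring solver.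
Cop : ℤ → ℤ → Set
Cop a b = ∃[ s ] ∃[ t ] s * a + t * b ≡ 1ℤ

record Bezout (a b : ℤ) : Set where
  constructor mkBezout
  field
    {g s t} : ℤ
    0≤g : 0ℤ ≤ g
    g∣a : g ∣ a
    g∣b : g ∣ b
    bez : s * a + t * b ≡ g

bezout : ∀ a b → Bezout a b
bezout a b with ℕ.Bézout.lemma (abs a) (abs b)
... | ℕ.Bézout.result d gcd i = go i
  where
  d∣a : + d ∣ a
  d∣a = ∣ᵤ⇒∣ (ℕ.GCD.gcd∣m gcd)
  d∣b : + d ∣ b
  d∣b = ∣ᵤ⇒∣ (ℕ.GCD.gcd∣n gcd)
  cast : ∀ x y m n → d ℕ.+ y ℕ.* n ≡ x ℕ.* m → + d + + y * + n ≡ + x * + m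
  cast x y m n e = trans (cong (_+_ (+ d)) (sym (pos-* y n))) (trans (sym (pos-+ d (y ℕ.* n))) (trans (cong +_ e) (pos-* x m)))
  go : ℕ.Bézout.Identity d (abs a) (abs b) → Bezout a b
  go (ℕ.Bézout.Identity.+- x y e) with m∣∣m∣ {a} | m∣∣m∣ {b}
  ... | divides p pa | divides q qb = mkBezout {s = + x * p} { - (+ y * q)} (0≤n d) d∣a d∣b
    (lin3 1ℤ (+ x) (- + y) (sym (cast x y _ _ e)) (sym pa) (sym qb) (lem (+ x) (+ y) (+ d) (+ (abs a)) (+ (abs b))))
    where lem : ∀ x y d A B → x * p * a + - (y * q) * b + (1ℤ * (d + y * B) + x * A + - y * B) ≡ d + (1ℤ * (x * A) + x * (p * a) + - y * (q * b))
          lem x y d A B = solve (x ∷ y ∷ d ∷ A ∷ B ∷ p ∷ q ∷ a ∷ b ∷ [])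
  go (ℕ.Bézout.Identity.-+ x y e) with m∣∣m∣ {a} | m∣∣m∣ {b}
  ... | divides p pa | divides q qb = mkBezout {s = - (+ x * p)} {+ y * q} (0≤n d) d∣a d∣b
    (lin3 1ℤ (- + x) (+ y) (sym (cast y x _ _ e)) (sym pa) (sym qb) (lem (+ x) (+ y) (+ d) (+ (abs a)) (+ (abs b))))
    where lem : ∀ x y d A B → - (x * p) * a + (y * q) * b + (1ℤ * (d + x * A) + - x * A + y * B) ≡ d + (1ℤ * (y * B) + - x * (p * a) + y * (q * b))
          lem x y d A B = solve (x ∷ y ∷ d ∷ A ∷ B ∷ p ∷ q ∷ a ∷ b ∷ [])

copSym : Cop a b → Cop b a
copSym {a} {b} (s , t , e) = t , s , lin1 1ℤ e (solve (a ∷ b ∷ s ∷ t ∷ []))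

copMul : Cop a b → Cop a c → Cop a (b * c)
copMul {a} {b} {c} (s , t , e) (s′ , t′ , e′) =
  s * s′ * a + s * t′ * c + t * b * s′ , t * t′ ,
  lin2 (s′ * a + t′ * c) 1ℤ e e′ (solve (a ∷ b ∷ c ∷ s ∷ t ∷ s′ ∷ t′ ∷ []))

copSq : Cop a b → Cop (a * a) (b * b)
copSq h = copMul (copSym (copMul (copSym h) (copSym h))) (copSym (copMul (copSym h) (copSym h)))

copDivˡ : ∀ d e → Cop (d * e) b → Cop d b
copDivˡ {b} d e (s , t , h) = s * e , t , lin1 1ℤ h (solve (b ∷ d ∷ e ∷ s ∷ t ∷ []))

copDivʳ : ∀ d e → Cop a (d * e) → Cop a d
copDivʳ d e h = copSym (copDivˡ d e (copSym h))

copMod : ∀ k → a + k * b ≡ c → Cop c b → Cop a b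
copMod {a} {b} {c} k e (s , t , h) = s , s * k + t ,
  lin2 1ℤ s h e (solve (a ∷ b ∷ c ∷ s ∷ t ∷ k ∷ []))

copNeg : Cop (- a) b → Cop a b
copNeg {a} {b} (s , t , h) = - s , t , lin1 1ℤ h (solve (a ∷ b ∷ s ∷ t ∷ []))

cop1 : Cop 1ℤ b
cop1 {b} = 1ℤ , 0ℤ , solve (b ∷ [])

euclid : Cop a b → a ∣ b * c → a ∣ c
euclid {a} {b} {c} (s , t , e) (divides q h) = divides (s * c + t * q)
  (lin2 (- c) t e h (solve (a ∷ b ∷ c ∷ s ∷ t ∷ q ∷ [])))

unit : ∀ a → a * b ≡ 1ℤ → a ≡ 1ℤ ⊎ a ≡ - 1ℤ
unit {b} a e with ℕ.m*n≡1⇒m≡1 (abs a) (abs b) (trans (sym (abs-* a b)) (cong abs e))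
unit (+ _) e | refl = inj₁ refl
unit -[1+ _ ] e | refl = inj₂ refl

record Reduced (a b : ℤ) : Set where
  constructor reduced
  field
    {g p q} : ℤ
    0≤g : 0ℤ ≤ g
    a≡ : a ≡ g * p
    b≡ : b ≡ g * q
    cop : Cop p q

reduce : ∀ a b → Reduced a b
reduce a b with bezout a b
... | mkBezout {+ zero} p (divides q qe) (divides r re) e =
  -- For a = b = 0 the pair (1, 0) is a default; every use has to exclude g = 0 by itself.
  reduced {g = 0ℤ} {1ℤ} {0ℤ} (0≤n 0) (trans qe (*-zeroʳ q)) (trans re (*-zeroʳ r)) cop1
... | mkBezout {g@(+ suc _)} {s} {t} p (divides q qe) (divides r re) e =
  reduced {g = g} {q} {r} p (trans qe (*-comm q g)) (trans re (*-comm r g))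
    (s , t , cancelˡ g (λ ()) (lin3 1ℤ (- s) (- t) e qe re (lem g)))
  where lem : ∀ g → g * (s * q + t * r) + (1ℤ * g + - s * (q * g) + - t * (r * g)) ≡ g * 1ℤ + (1ℤ * (s * a + t * b) + - s * a + - t * b)
        lem g = solve (g ∷ a ∷ b ∷ s ∷ t ∷ q ∷ r ∷ [])

∣-antisym± : a ∣ b → b ∣ a → a ≡ b ⊎ a ≡ - b
∣-antisym± {a} {b} (divides q e) (divides r f) =
  [ (λ a≡0 → inj₁ (trans a≡0 (sym (trans e (trans (cong (q *_) a≡0) (*-zeroʳ q)))))) , nonzero ]′
    (noZeroDiv {1ℤ - q * r} a (lin2 1ℤ r f e (solve (a ∷ b ∷ q ∷ r ∷ []))))
  where
  nonzero : 1ℤ - q * r ≡ 0ℤ → a ≡ b ⊎ a ≡ - b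
  nonzero qr with unit {q} r (lin1 (- 1ℤ) qr (solve (q ∷ r ∷ [])))
  ... | inj₁ refl = inj₁ (trans f (*-identityˡ b))
  ... | inj₂ refl = inj₂ (trans f (-1*i≡-i b))

-- With g = gcd a c one has a ∣ g² by Bézout, and g² ∣ a since g is prime to b.
coprimeSquare : Cop a b → a * b ≡ c * c → ∃[ g ] (a ≡ g * g ⊎ a ≡ - (g * g))
coprimeSquare {a} {b} {c} h e = go (bezout a c)
  where
  a∣g² : ∀ {g} s t → s * a + t * c ≡ g → a ∣ g * g
  a∣g² {g} s t bz = divides (s * s * a + + 2 * s * t * c + t * t * b)
    eq
    where
    eq : g * g ≡ (s * s * a + + 2 * s * t * c + t * t * b) * a
    eq = lin2 (- (g + s * a + t * c)) (t * t) bz (sym e) (solve (a ∷ b ∷ c ∷ s ∷ t ∷ g ∷ []))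
  g²∣a : ∀ {g p q} → a ≡ p * g → c ≡ q * g → g * g ∣ a
  g²∣a {g} {p} {q} pe qe = byCases (g ≟ 0ℤ)
    where
    fin : g ∣ p → g * g ∣ a
    fin (divides k ke) = divides k (trans pe (trans (cong (_* g) ke) (*-assoc k g g)))
    byCases : Dec (g ≡ 0ℤ) → g * g ∣ a
    byCases (yes refl) = divides 0ℤ (trans pe (*-zeroʳ p))
    byCases (no g≢0) = fin (euclid {g} {b} {p} (copDivˡ {b} g p (subst (λ n → Cop n b) (trans pe (*-comm p g)) h))
                    (divides (q * q) (cancelˡ {b * p} {q * q * g} g g≢0 eq)))
      where
      eq : g * (b * p) ≡ g * (q * q * g)
      eq = lin3 1ℤ (- b) (q * g + c) e pe qe (solve (g ∷ a ∷ b ∷ c ∷ p ∷ q ∷ []))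
  go : Bezout a c → ∃[ g ] (a ≡ g * g ⊎ a ≡ - (g * g))
  go (mkBezout {g} {s} {t} _ (divides p pe) (divides q qe) bz) = g , ∣-antisym± {a} {g * g} (a∣g² s t bz) (g²∣a {g} {p} {q} pe qe)

0≤-sq⇒≡0 : ∀ g → 0ℤ ≤ - (g * g) → g ≡ 0ℤ
0≤-sq⇒≡0 g h = sq≡0 g (≤-antisym (0≤i-j⇒j≤i {0ℤ} {g * g} (h by sym (+-identityˡ (- (g * g))))) (0≤sq g))

coprimeSquare⁺ : 0ℤ ≤ a → Cop a b → a * b ≡ c * c → ∃[ g ] a ≡ g * g
coprimeSquare⁺ {a} {b} {c} 0≤a h e = go (coprimeSquare {a} {b} {c} h e)
  where
  go : ∃[ g ] (a ≡ g * g ⊎ a ≡ - (g * g)) → ∃[ g ] a ≡ g * g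
  go (g , inj₁ p) = g , p
  go (g , inj₂ p) = g , trans p (trans (cong (λ n → - (n * n)) g≡0) (sym (cong (λ n → n * n) g≡0)))
    where g≡0 = 0≤-sq⇒≡0 g (0≤a by p)

infixl 6 _⊕_
infixl 7 _⊗_
-- Certificates of nonnegativity: a proof term built from `_⊕_` and `_⊗_` has the shape of a
-- polynomial in nonnegative quantities, and `_by_` leaves its equality with the desired expression
-- to the ring solver.
_⊕_ : 0ℤ ≤ a → 0ℤ ≤ b → 0ℤ ≤ a + b
_⊕_ = 0≤+

_⊗_ : 0ℤ ≤ a → 0ℤ ≤ b → 0ℤ ≤ a * b
_⊗_ = 0≤*

≡0⇐0≤± : 0ℤ ≤ a → 0ℤ ≤ - a → a ≡ 0ℤ
≡0⇐0≤± {+ zero} p q = refl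

0≤4+3 : ∀ a → 0ℤ ≤ + 4 * a + + 3 → 0ℤ ≤ a
0≤4+3 a h = either (0≤⊎0< a) (λ p → p) λ p → ⊥-elim (absurd (neg p))
  where
  neg : 0ℤ ≤ - a - 1ℤ → 0ℤ ≤ - 1ℤ
  neg p = 0≤n 4 ⊗ p ⊕ h by solve (a ∷ [])
  absurd : 0ℤ ≤ - 1ℤ → ⊥
  absurd ()

-- The ring ℤ[θ] and its norm

-- tri a b c stands for a + bθ + cθ², where θ³ = θ² + θ + 1.
record ℤ[θ] : Set where
  constructor tri
  field c₀ c₁ c₂ : ℤ
open ℤ[θ]

tri≡ : ∀ {a a′ b b′ c c′} → a ≡ a′ → b ≡ b′ → c ≡ c′ → tri a b c ≡ tri a′ b′ c′
tri≡ refl refl refl = refl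

-- ⊠⟨ u , v ⟩ k, cof⟨ u ⟩ k and N⟨ u ⟩ k apply k to the product of u and v, to the product of the
-- other two conjugates of u, and to the norm of u. They unfold to k applied to polynomials:
-- this makes the polynomials visible to the ring solver, which does not unfold definitions.
⊠⟨_,_⟩_ : ∀ {ℓ} {A : Set ℓ} → ℤ[θ] → ℤ[θ] → (ℤ → ℤ → ℤ → A) → A
⊠⟨ tri a b c , tri x y z ⟩ k = k
  (a * x + b * z + c * y + c * z)
  (a * y + b * x + b * z + c * y + + 2 * (c * z))
  (a * z + b * y + c * x + b * z + c * y + + 2 * (c * z))

cof⟨_⟩_ : ∀ {ℓ} {A : Set ℓ} → ℤ[θ] → (ℤ → ℤ → ℤ → A) → A
cof⟨ tri a b c ⟩ k = k
  ((a + c) * (a + b + + 2 * c) - (b + + 2 * c) * (b + c))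
  (- (b * (a + b + + 2 * c) - (b + + 2 * c) * c))
  (b * (b + c) - (a + c) * c)

N⟨_⟩_ : ∀ {ℓ} {A : Set ℓ} → ℤ[θ] → (ℤ → A) → A
N⟨ tri a b c ⟩ k = k (a * a * a + b * b * b + c * c * c + a * a * b + + 3 * (a * a * c)
  - a * b * b - a * c * c + b * b * c - b * c * c - + 4 * (a * b * c))

infixl 6 _⊞_
infixl 7 _⊠_
infix 8 ⊟_
_⊞_ _⊠_ : ℤ[θ] → ℤ[θ] → ℤ[θ]
tri a b c ⊞ tri x y z = tri (a + x) (b + y) (c + z)
u ⊠ v = ⊠⟨ u , v ⟩ tri

cof : ℤ[θ] → ℤ[θ]
cof u = cof⟨ u ⟩ tri

N : ℤ[θ] → ℤ
N u = N⟨ u ⟩ λ n → n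

⊟_ : ℤ[θ] → ℤ[θ]
⊟ tri a b c = tri (- a) (- b) (- c)

int : ℤ → ℤ[θ]
int n = tri n 0ℤ 0ℤ

𝟘 𝟙 θ : ℤ[θ]
𝟘 = int 0ℤ
𝟙 = int 1ℤ
θ = tri 0ℤ 1ℤ 0ℤ

⊠-assoc : ∀ u v w → (u ⊠ v) ⊠ w ≡ u ⊠ (v ⊠ w)
⊠-assoc (tri a b c) (tri x y z) (tri p q r) = tri≡ lem₀ lem₁ lem₂
  where
  lem₀ : ⊠⟨ tri a b c , tri x y z ⟩ λ A B C → ⊠⟨ tri x y z , tri p q r ⟩ λ X Y Z →
    A * p + B * r + C * q + C * r ≡ a * X + b * Z + c * Y + c * Z
  lem₀ = solve (a ∷ b ∷ c ∷ x ∷ y ∷ z ∷ p ∷ q ∷ r ∷ [])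
  lem₁ : ⊠⟨ tri a b c , tri x y z ⟩ λ A B C → ⊠⟨ tri x y z , tri p q r ⟩ λ X Y Z →
    A * q + B * p + B * r + C * q + + 2 * (C * r) ≡ a * Y + b * X + b * Z + c * Y + + 2 * (c * Z)
  lem₁ = solve (a ∷ b ∷ c ∷ x ∷ y ∷ z ∷ p ∷ q ∷ r ∷ [])
  lem₂ : ⊠⟨ tri a b c , tri x y z ⟩ λ A B C → ⊠⟨ tri x y z , tri p q r ⟩ λ X Y Z →
    A * r + B * q + C * p + B * r + C * q + + 2 * (C * r) ≡ a * Z + b * Y + c * X + b * Z + c * Y + + 2 * (c * Z)
  lem₂ = solve (a ∷ b ∷ c ∷ x ∷ y ∷ z ∷ p ∷ q ∷ r ∷ [])

⊠-comm : ∀ u v → u ⊠ v ≡ v ⊠ u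
⊠-comm (tri a b c) (tri x y z) = tri≡
  (solve (a ∷ b ∷ c ∷ x ∷ y ∷ z ∷ []))
  (solve (a ∷ b ∷ c ∷ x ∷ y ∷ z ∷ []))
  (solve (a ∷ b ∷ c ∷ x ∷ y ∷ z ∷ []))

⊠-distribʳ : ∀ w u v → (u ⊞ v) ⊠ w ≡ (u ⊠ w) ⊞ (v ⊠ w)
⊠-distribʳ (tri p q r) (tri a b c) (tri x y z) = tri≡ lem₀ lem₁ lem₂
  where
  lem₀ : (a + x) * p + (b + y) * r + (c + z) * q + (c + z) * r ≡
    a * p + b * r + c * q + c * r + (x * p + y * r + z * q + z * r)
  lem₀ = solve (a ∷ b ∷ c ∷ x ∷ y ∷ z ∷ p ∷ q ∷ r ∷ [])
  lem₁ : (a + x) * q + (b + y) * p + (b + y) * r + (c + z) * q + + 2 * ((c + z) * r) ≡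
    a * q + b * p + b * r + c * q + + 2 * (c * r) + (x * q + y * p + y * r + z * q + + 2 * (z * r))
  lem₁ = solve (a ∷ b ∷ c ∷ x ∷ y ∷ z ∷ p ∷ q ∷ r ∷ [])
  lem₂ : (a + x) * r + (b + y) * q + (c + z) * p + (b + y) * r + (c + z) * q + + 2 * ((c + z) * r) ≡
    a * r + b * q + c * p + b * r + c * q + + 2 * (c * r) + (x * r + y * q + z * p + y * r + z * q + + 2 * (z * r))
  lem₂ = solve (a ∷ b ∷ c ∷ x ∷ y ∷ z ∷ p ∷ q ∷ r ∷ [])

⊠-identityˡ : ∀ u → 𝟙 ⊠ u ≡ u
⊠-identityˡ (tri a b c) = tri≡ (solve (a ∷ b ∷ c ∷ [])) (solve (a ∷ b ∷ c ∷ [])) (solve (a ∷ b ∷ c ∷ []))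

ℤ[θ]-ring : CommutativeRing 0ℓ 0ℓ
ℤ[θ]-ring = record
  { Carrier = ℤ[θ] ; _≈_ = _≡_ ; _+_ = _⊞_ ; _*_ = _⊠_ ; -_ = ⊟_ ; 0# = 𝟘 ; 1# = 𝟙
  ; isCommutativeRing = record
    { isRing = record
      { +-isAbelianGroup = record
        { isGroup = record
          { isMonoid = record
            { isSemigroup = record
              { isMagma = record { isEquivalence = isEquivalence ; ∙-cong = cong₂ _⊞_ }
              ; assoc = λ { (tri a b c) (tri x y z) (tri p q r) → tri≡ (+-assoc a x p) (+-assoc b y q) (+-assoc c z r) } }
            ; identity = (λ { (tri a b c) → tri≡ (+-identityˡ a) (+-identityˡ b) (+-identityˡ c) })
                       , (λ { (tri a b c) → tri≡ (+-identityʳ a) (+-identityʳ b) (+-identityʳ c) }) }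
          ; inverse = (λ { (tri a b c) → tri≡ (+-inverseˡ a) (+-inverseˡ b) (+-inverseˡ c) })
                    , (λ { (tri a b c) → tri≡ (+-inverseʳ a) (+-inverseʳ b) (+-inverseʳ c) })
          ; ⁻¹-cong = cong ⊟_ }
        ; comm = λ { (tri a b c) (tri x y z) → tri≡ (+-comm a x) (+-comm b y) (+-comm c z) } }
      ; *-cong = cong₂ _⊠_
      ; *-assoc = ⊠-assoc
      ; *-identity = ⊠-identityˡ , λ u → trans (⊠-comm u 𝟙) (⊠-identityˡ u)
      ; distrib = (λ w u v → trans (⊠-comm w (u ⊞ v)) (trans (⊠-distribʳ w u v) (cong₂ _⊞_ (⊠-comm u w) (⊠-comm v w))))
                , ⊠-distribʳ }
    ; *-comm = ⊠-comm } }

θring : AlmostCommutativeRing 0ℓ 0ℓ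
θring = fromCommutativeRing ℤ[θ]-ring
  λ { (tri (+ 0) (+ 0) (+ 0)) → just refl ; _ → nothing }

⊠-cof : ∀ u → u ⊠ cof u ≡ int (N u)
⊠-cof (tri a b c) = tri≡ lem₀ lem₁ lem₂
  where
  lem₀ : cof⟨ tri a b c ⟩ λ x y z → N⟨ tri a b c ⟩ λ n → a * x + b * z + c * y + c * z ≡ n
  lem₀ = solve (a ∷ b ∷ c ∷ [])
  lem₁ : cof⟨ tri a b c ⟩ λ x y z → a * y + b * x + b * z + c * y + + 2 * (c * z) ≡ 0ℤ
  lem₁ = solve (a ∷ b ∷ c ∷ [])
  lem₂ : cof⟨ tri a b c ⟩ λ x y z → a * z + b * y + c * x + b * z + c * y + + 2 * (c * z) ≡ 0ℤ
  lem₂ = solve (a ∷ b ∷ c ∷ [])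

N-⊠ : ∀ u v → N (u ⊠ v) ≡ N u * N v
N-⊠ (tri a b c) (tri x y z) = lem
  where
  lem : ⊠⟨ tri a b c , tri x y z ⟩ λ A B C → N⟨ tri A B C ⟩ λ l → N⟨ tri a b c ⟩ λ m → N⟨ tri x y z ⟩ λ n → l ≡ m * n
  lem = solve (a ∷ b ∷ c ∷ x ∷ y ∷ z ∷ [])

N-cof : ∀ u → N (cof u) ≡ N u * N u
N-cof (tri a b c) = lem
  where
  lem : cof⟨ tri a b c ⟩ λ x y z → N⟨ tri x y z ⟩ λ m → N⟨ tri a b c ⟩ λ n → m ≡ n * n
  lem = solve (a ∷ b ∷ c ∷ [])

N-⊟ : ∀ v → N (⊟ v) ≡ - N v
N-⊟ (tri a b c) = lem
  where lem : N⟨ tri (- a) (- b) (- c) ⟩ λ m → N⟨ tri a b c ⟩ λ n → m ≡ - n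
        lem = solve (a ∷ b ∷ c ∷ [])

int-⊠ : ∀ m n → int (m * n) ≡ int m ⊠ int n
int-⊠ m n = tri≡ lem₀ lem₁ lem₂
  where
  lem₀ : ⊠⟨ tri m 0ℤ 0ℤ , tri n 0ℤ 0ℤ ⟩ λ a _ _ → m * n ≡ a
  lem₀ = solve (m ∷ n ∷ [])
  lem₁ : ⊠⟨ tri m 0ℤ 0ℤ , tri n 0ℤ 0ℤ ⟩ λ _ b _ → 0ℤ ≡ b
  lem₁ = solve (m ∷ n ∷ [])
  lem₂ : ⊠⟨ tri m 0ℤ 0ℤ , tri n 0ℤ 0ℤ ⟩ λ _ _ c → 0ℤ ≡ c
  lem₂ = solve (m ∷ n ∷ [])

-- Units of ℤ[θ] modulo squares

-- Of the units ±θᵏ only the θᵏ have norm 1, since N(-1) = -1. Modulo squares this leaves the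
-- classes of 1 and θ.
record SqClass (u : ℤ[θ]) : Set where
  constructor sqClass
  field
    {η} : ℤ[θ]
    u≡ : u ≡ η ⊠ η ⊎ u ≡ θ ⊠ (η ⊠ η)

record Good (u : ℤ[θ]) : Set where
  constructor good
  field
    1≤N : 0ℤ ≤ N u - 1ℤ
    sq : N u ≡ 1ℤ → SqClass u
open Good

θ⁻¹ : ℤ[θ]
θ⁻¹ = tri (- 1ℤ) (- 1ℤ) 1ℤ

SqClass-θ⁻¹ : ∀ u → SqClass (θ⁻¹ ⊠ u) → SqClass u
SqClass-θ⁻¹ u (sqClass {η} (inj₁ e)) = sqClass {η = η} (inj₂ (trans lem (cong (θ ⊠_) e)))
  where lem : u ≡ θ ⊠ (θ⁻¹ ⊠ u)
        lem = trans (sym (⊠-identityˡ u)) (⊠-assoc θ θ⁻¹ u)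
SqClass-θ⁻¹ u (sqClass {η} (inj₂ e)) = sqClass {η = θ ⊠ η} (inj₁ (trans lem (trans (cong (θ ⊠_) e) (lem′ θ η))))
  where lem : u ≡ θ ⊠ (θ⁻¹ ⊠ u)
        lem = trans (sym (⊠-identityˡ u)) (⊠-assoc θ θ⁻¹ u)
        lem′ : ∀ t η → t ⊠ (t ⊠ (η ⊠ η)) ≡ (t ⊠ η) ⊠ (t ⊠ η)
        lem′ t η = Solver.solve (t ∷ η ∷ []) θring

SqClass-θ : ∀ u → SqClass (θ ⊠ u) → SqClass u
SqClass-θ u (sqClass {η} (inj₁ e)) = sqClass {η = θ⁻¹ ⊠ η} (inj₂ (trans lem (trans (cong (θ⁻¹ ⊠_) e) lem″)))
  where lem : u ≡ θ⁻¹ ⊠ (θ ⊠ u)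
        lem = trans (sym (⊠-identityˡ u)) (⊠-assoc θ⁻¹ θ u)
        lem′ : ∀ t r η → r ⊠ ((t ⊠ r) ⊠ (η ⊠ η)) ≡ t ⊠ ((r ⊠ η) ⊠ (r ⊠ η))
        lem′ t r η = Solver.solve (t ∷ r ∷ η ∷ []) θring
        lem″ : θ⁻¹ ⊠ (η ⊠ η) ≡ θ ⊠ ((θ⁻¹ ⊠ η) ⊠ (θ⁻¹ ⊠ η))
        lem″ = trans (cong (θ⁻¹ ⊠_) (sym (⊠-identityˡ (η ⊠ η)))) (lem′ θ θ⁻¹ η)
SqClass-θ u (sqClass {η} (inj₂ e)) = sqClass {η = η} (inj₁ (trans lem (trans (cong (θ⁻¹ ⊠_) e) lem′)))
  where lem : u ≡ θ⁻¹ ⊠ (θ ⊠ u)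
        lem = trans (sym (⊠-identityˡ u)) (⊠-assoc θ⁻¹ θ u)
        lem′ : θ⁻¹ ⊠ (θ ⊠ (η ⊠ η)) ≡ η ⊠ η
        lem′ = trans (sym (⊠-assoc θ⁻¹ θ (η ⊠ η))) (⊠-identityˡ (η ⊠ η))

sum≡0 : 0ℤ ≤ a → 0ℤ ≤ b → 0ℤ ≤ - (a + b) → a ≡ 0ℤ × b ≡ 0ℤ
sum≡0 {a} {b} p q h =
  ≡0⇐0≤± p (h ⊕ q by solve (a ∷ b ∷ [])) ,
  ≡0⇐0≤± q (h ⊕ p by solve (a ∷ b ∷ []))

sum₃≡0 : ∀ a b c → 0ℤ ≤ a → 0ℤ ≤ b → 0ℤ ≤ c → 0ℤ ≤ - (a + b + c) → tri a b c ≡ 𝟘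
sum₃≡0 a b c p q r h = fin (sum≡0 {a + b} {c} (p ⊕ q) r h)
  where
  fin : a + b ≡ 0ℤ × c ≡ 0ℤ → tri a b c ≡ 𝟘
  fin (e , f) = fin′ (sum≡0 p q (0≤n 0 by cong -_ (sym e)))
    where
    fin′ : a ≡ 0ℤ × b ≡ 0ℤ → tri a b c ≡ 𝟘
    fin′ (g , h) = tri≡ g h f

Good-𝟙 : ∀ u → 0ℤ ≤ N u - 1ℤ → (N u ≡ 1ℤ → u ≡ 𝟙) → Good u
Good-𝟙 u p q = good p λ e → sqClass {η = 𝟙} (inj₁ (q e))

-- The four orderings in which θ⁻¹ ⊠ u leaves the cone: written in terms of the gaps
-- between the coordinates, N has nonnegative coefficients up to one positive
-- definite quadratic form.
region₁ : ∀ x y z → 0ℤ ≤ x → 0ℤ ≤ y → 0ℤ ≤ z → Good (tri (1ℤ + x + y + z) (y + z) z)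
region₁ x y z px py pz = Good-𝟙 _ pos-N λ e → from𝟘 (sum₃≡0 x y z px py pz (vanish e))
  where
  h : N⟨ tri (1ℤ + x + y + z) (y + z) z ⟩ λ n → 0ℤ ≤ n - 1ℤ - (x + y + z)
  h = px ⊗ px ⊗ px ⊕ 0≤n 4 ⊗ px ⊗ px ⊗ py ⊕ 0≤n 7 ⊗ px ⊗ px ⊗ pz ⊕ 0≤n 4 ⊗ px ⊗ py ⊗ py
     ⊕ 0≤n 10 ⊗ px ⊗ py ⊗ pz ⊕ 0≤n 5 ⊗ px ⊗ pz ⊗ pz ⊕ 0≤n 2 ⊗ py ⊗ py ⊗ py ⊕ 0≤n 6 ⊗ py ⊗ py ⊗ pz
     ⊕ 0≤n 4 ⊗ py ⊗ pz ⊗ pz ⊕ pz ⊗ pz ⊗ pz ⊕ 0≤n 3 ⊗ px ⊗ px ⊕ 0≤n 8 ⊗ px ⊗ py ⊕ 0≤n 14 ⊗ px ⊗ pz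
     ⊕ 0≤n 4 ⊗ py ⊗ py ⊕ 0≤n 10 ⊗ py ⊗ pz ⊕ 0≤n 5 ⊗ pz ⊗ pz ⊕ 0≤n 2 ⊗ px ⊕ 0≤n 3 ⊗ py ⊕ 0≤n 6 ⊗ pz by solve (x ∷ y ∷ z ∷ [])
  pos-N : N⟨ tri (1ℤ + x + y + z) (y + z) z ⟩ λ n → 0ℤ ≤ n - 1ℤ
  pos-N = h ⊕ px ⊕ py ⊕ pz by solve (x ∷ y ∷ z ∷ [])
  vanish : N⟨ tri (1ℤ + x + y + z) (y + z) z ⟩ λ n → n ≡ 1ℤ → 0ℤ ≤ - (x + y + z)
  vanish e = h by lin1 1ℤ e (solve (x ∷ y ∷ z ∷ []))
  from𝟘 : tri x y z ≡ 𝟘 → tri (1ℤ + x + y + z) (y + z) z ≡ 𝟙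
  from𝟘 refl = refl

region₂ : ∀ x y z → 0ℤ ≤ x → 0ℤ ≤ y → 0ℤ ≤ z → Good (tri (1ℤ + x + y + z) y (y + z))
region₂ x y z px py pz = Good-𝟙 _ pos-N λ e → from𝟘 (sum₃≡0 x y z px py pz (vanish e))
  where
  h : N⟨ tri (1ℤ + x + y + z) y (y + z) ⟩ λ n → 0ℤ ≤ n - 1ℤ - (x + y + z)
  h = px ⊗ px ⊗ px ⊕ 0≤n 7 ⊗ px ⊗ px ⊗ py ⊕ 0≤n 6 ⊗ px ⊗ px ⊗ pz ⊕ 0≤n 5 ⊗ px ⊗ py ⊗ py
     ⊕ 0≤n 14 ⊗ px ⊗ py ⊗ pz ⊕ 0≤n 8 ⊗ px ⊗ pz ⊗ pz ⊕ py ⊗ py ⊗ py ⊕ 0≤n 4 ⊗ py ⊗ py ⊗ pz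
     ⊕ 0≤n 8 ⊗ py ⊗ pz ⊗ pz ⊕ 0≤n 4 ⊗ pz ⊗ pz ⊗ pz ⊕ 0≤n 3 ⊗ px ⊗ px ⊕ 0≤n 14 ⊗ px ⊗ py
     ⊕ 0≤n 12 ⊗ px ⊗ pz ⊕ 0≤n 5 ⊗ py ⊗ py ⊕ 0≤n 14 ⊗ py ⊗ pz ⊕ 0≤n 8 ⊗ pz ⊗ pz ⊕ 0≤n 2 ⊗ px
     ⊕ 0≤n 6 ⊗ py ⊕ 0≤n 5 ⊗ pz by solve (x ∷ y ∷ z ∷ [])
  pos-N : N⟨ tri (1ℤ + x + y + z) y (y + z) ⟩ λ n → 0ℤ ≤ n - 1ℤ
  pos-N = h ⊕ px ⊕ py ⊕ pz by solve (x ∷ y ∷ z ∷ [])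
  vanish : N⟨ tri (1ℤ + x + y + z) y (y + z) ⟩ λ n → n ≡ 1ℤ → 0ℤ ≤ - (x + y + z)
  vanish e = h by lin1 1ℤ e (solve (x ∷ y ∷ z ∷ []))
  from𝟘 : tri x y z ≡ 𝟘 → tri (1ℤ + x + y + z) y (y + z) ≡ 𝟙
  from𝟘 refl = refl

Good-2≤ : ∀ u → 0ℤ ≤ N u - + 2 → Good u
Good-2≤ u h = good (h ⊕ 0≤n 1 by lem (N u)) λ e → ⊥-elim (absurd (h by cong (_- + 2) e))
  where
  lem : ∀ n → n - + 2 + + 1 ≡ n - 1ℤ
  lem n = solve (n ∷ [])
  absurd : 0ℤ ≤ 1ℤ - + 2 → ⊥
  absurd ()

region₃ : ∀ x y z → 0ℤ ≤ x → 0ℤ ≤ y → 0ℤ ≤ z → Good (tri (1ℤ + x + y) y (1ℤ + x + y + z))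
region₃ x y z px py pz = Good-2≤ _ pos-N
  where
  pos-N : N⟨ tri (1ℤ + x + y) y (1ℤ + x + y + z) ⟩ λ n → 0ℤ ≤ n - + 2
  pos-N = 0≤n 4 ⊗ px ⊗ px ⊗ px ⊕ 0≤n 8 ⊗ px ⊗ px ⊗ py ⊕ 0≤n 4 ⊗ px ⊗ px ⊗ pz ⊕ 0≤n 4 ⊗ px ⊗ py ⊗ py
     ⊕ 0≤n 2 ⊗ px ⊗ py ⊗ pz ⊕ 0≤n 2 ⊗ px ⊗ pz ⊗ pz ⊕ pz ⊗ pz ⊗ pz ⊕ 0≤n 12 ⊗ px ⊗ px
     ⊕ 0≤n 16 ⊗ px ⊗ py ⊕ 0≤n 8 ⊗ px ⊗ pz ⊕ 0≤n 4 ⊗ py ⊗ py ⊕ 0≤n 2 ⊗ py ⊗ pz ⊕ 0≤n 2 ⊗ pz ⊗ pz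
     ⊕ 0≤n 12 ⊗ px ⊕ 0≤n 8 ⊗ py ⊕ 0≤n 4 ⊗ pz ⊕ 0≤n 2
    ⊕ py ⊗ (0≤sq (y - z) ⊕ py ⊗ pz)
    by solve (x ∷ y ∷ z ∷ [])

region₄ : ∀ x y z → 0ℤ ≤ x → 0ℤ ≤ y → 0ℤ ≤ z → Good (tri (1ℤ + x + z) (1ℤ + x + z + y) z)
region₄ x y z px py pz = Good-2≤ _ pos-N
  where
  pos-N : N⟨ tri (1ℤ + x + z) (1ℤ + x + z + y) z ⟩ λ n → 0ℤ ≤ n - + 2
  pos-N = 0≤n 2 ⊗ px ⊗ px ⊗ px ⊕ 0≤n 2 ⊗ px ⊗ px ⊗ py ⊕ 0≤n 6 ⊗ px ⊗ px ⊗ pz ⊕ 0≤n 2 ⊗ px ⊗ py ⊗ py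
     ⊕ 0≤n 2 ⊗ px ⊗ py ⊗ pz ⊕ 0≤n 4 ⊗ px ⊗ pz ⊗ pz ⊕ py ⊗ py ⊗ py ⊕ 0≤n 6 ⊗ px ⊗ px ⊕ 0≤n 4 ⊗ px ⊗ py
     ⊕ 0≤n 12 ⊗ px ⊗ pz ⊕ 0≤n 2 ⊗ py ⊗ py ⊕ 0≤n 2 ⊗ py ⊗ pz ⊕ 0≤n 4 ⊗ pz ⊗ pz ⊕ 0≤n 6 ⊗ px
     ⊕ 0≤n 2 ⊗ py ⊕ 0≤n 6 ⊗ pz
    ⊕ pz ⊗ (0≤sq (z - y) ⊕ py ⊗ pz ⊕ 0≤n 2 ⊗ (py ⊗ py))
    by solve (x ∷ y ∷ z ∷ [])

record Split (a b : ℤ) : Set where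
  constructor split
  field
    {d} : ℤ
    0≤d : 0ℤ ≤ d
    which : b ≡ a + d ⊎ a ≡ 1ℤ + b + d

compare : ∀ a b → Split a b
compare a b = go (0≤⊎0< (b - a))
  where
  go : 0ℤ ≤ b - a ⊎ 0ℤ ≤ - (b - a) - 1ℤ → Split a b
  go (inj₁ p) = split p (inj₁ (solve (a ∷ b ∷ [])))
  go (inj₂ p) = split p (inj₂ (solve (a ∷ b ∷ [])))

Good-θ⁻¹ : ∀ u → Good (θ⁻¹ ⊠ u) → Good u
Good-θ⁻¹ u (good p q) = good (p by cong (_- 1ℤ) e) (λ h → SqClass-θ⁻¹ u (q (trans e h)))
  where e : N (θ⁻¹ ⊠ u) ≡ N u
        e = trans (N-⊠ θ⁻¹ u) (*-identityˡ (N u))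

-- Multiplication by θ⁻¹ decreases the weight 2a + 3b + 4c by 3a + b + c.
Good-cone : ∀ n a b c → 0ℤ ≤ a → 0ℤ ≤ b → 0ℤ ≤ c → 0ℤ ≤ + n - (+ 2 * a + + 3 * b + + 4 * c) →
  tri a b c ≢ 𝟘 → Good (tri a b c)
Good-cone n a b c pa pb pc h ≢𝟘 = go n h (compare a b) (compare c b) (compare a c)
  where
  vanish : 0ℤ ≤ - (a + b + c) → ⊥
  vanish k = ≢𝟘 (sum₃≡0 a b c pa pb pc k)
  positive : 0ℤ ≤ + 3 * a + b + c - 1ℤ
  positive = either (0≤⊎0< (+ 3 * a + b + c - 1ℤ)) (λ p → p)
    λ p → ⊥-elim (vanish (neg p))
    where
    neg : 0ℤ ≤ - (+ 3 * a + b + c - 1ℤ) - 1ℤ → 0ℤ ≤ - (a + b + c)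
    neg p = p ⊕ 0≤n 2 ⊗ pa by solve (a ∷ b ∷ c ∷ [])
  step : ∀ n → 0ℤ ≤ + suc n - (+ 2 * a + + 3 * b + + 4 * c) → 0ℤ ≤ b - a → 0ℤ ≤ c - a → Good (tri a b c)
  step n h p q = Good-θ⁻¹ (tri a b c) (subst Good back
    (Good-cone n (b - a) (c - a) a p q pa (h ⊕ positive by lem (+ n)) nonzero))
    where
    lem : ∀ m → (1ℤ + m) - (+ 2 * a + + 3 * b + + 4 * c) + (+ 3 * a + b + c - 1ℤ) ≡ m - (+ 2 * (b - a) + + 3 * (c - a) + + 4 * a)
    lem m = solve (m ∷ a ∷ b ∷ c ∷ [])
    back : tri (b - a) (c - a) a ≡ θ⁻¹ ⊠ tri a b c
    back = tri≡ (solve (a ∷ b ∷ c ∷ [])) (solve (a ∷ b ∷ c ∷ [])) (solve (a ∷ b ∷ c ∷ []))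
    nonzero : tri (b - a) (c - a) a ≢ 𝟘
    nonzero e = ≢𝟘 (trans (sym (⊠-identityˡ (tri a b c))) (trans (⊠-assoc θ θ⁻¹ (tri a b c)) (cong (θ ⊠_) (trans (sym back) e))))
  go : ∀ n → 0ℤ ≤ + n - (+ 2 * a + + 3 * b + + 4 * c) → Split a b → Split c b → Split a c → Good (tri a b c)
  go zero h _ _ _ = ⊥-elim (vanish (h ⊕ pa ⊕ 0≤n 2 ⊗ pb ⊕ 0≤n 3 ⊗ pc by solve (a ∷ b ∷ c ∷ [])))
  go (suc n) h (split {d} pd (inj₁ e)) _ (split {f} pf (inj₁ e′)) =
    step n h (pd by lin1 (- 1ℤ) e (solve (a ∷ b ∷ d ∷ []))) (pf by lin1 (- 1ℤ) e′ (solve (a ∷ c ∷ f ∷ [])))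
  go _ _ (split {y} py (inj₁ e)) _ (split {x} px (inj₂ e′)) = to (a-eq e′) (trans e (cong (_+ y) (a-eq e′)))
    where
    a-eq : a ≡ 1ℤ + c + x → a ≡ 1ℤ + x + c
    a-eq e = trans e (solve (c ∷ x ∷ []))
    to : a ≡ 1ℤ + x + c → b ≡ 1ℤ + x + c + y → Good (tri a b c)
    to refl refl = region₄ x y c px py pc
  go _ _ (split {x} px (inj₂ e)) (split {y} py (inj₁ e′)) _ =
    to (trans e′ (+-comm c y)) (lin2 1ℤ 1ℤ e e′ (solve (a ∷ b ∷ c ∷ x ∷ y ∷ [])))
    where
    to : b ≡ y + c → a ≡ 1ℤ + x + y + c → Good (tri a b c)
    to refl refl = region₁ x y c px py pc
  go _ _ (split {x} px (inj₂ e)) (split {y} py (inj₂ e′)) (split {z} pz (inj₁ e″)) =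
    to (lin1 1ℤ e (solve (a ∷ b ∷ x ∷ []))) (lin2 1ℤ 1ℤ e e″ (solve (a ∷ b ∷ c ∷ x ∷ z ∷ [])))
    where
    to : a ≡ 1ℤ + x + b → c ≡ 1ℤ + x + b + z → Good (tri a b c)
    to refl refl = region₃ x b z px pb pz
  go _ _ (split {x} px (inj₂ e)) (split {y} py (inj₂ e′)) (split {w} pw (inj₂ e″)) =
    to (lin1 1ℤ e′ (solve (c ∷ b ∷ y ∷ []))) (lin2 1ℤ 1ℤ e″ e′ (solve (a ∷ b ∷ c ∷ w ∷ y ∷ [])))
    where
    to : c ≡ b + (1ℤ + y) → a ≡ 1ℤ + w + b + (1ℤ + y) → Good (tri a b c)
    to refl refl = region₂ w b (1ℤ + y) pw pb (0≤n 1 ⊕ py)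

-- For some k the coordinates of ±θᵏu are nonnegative. The form S is the sum of
-- |σ(u)|² for the complex embedding σ and of a small multiple of the square of the
-- real embedding, up to rounding; multiplication by θ decreases it off the cone.
S⟨_,_,_⟩_ : ∀ {ℓ} {A : Set ℓ} → ℤ → ℤ → ℤ → (ℤ → A) → A
S⟨ a , b , c ⟩ k = k ((a - + 2 * b + c) * (a - + 2 * b + c) + (c - b) * (c - b) + (b + c - + 3 * a) * (b + c - + 3 * a))

D⟨_,_,_⟩_ : ∀ {ℓ} {A : Set ℓ} → ℤ → ℤ → ℤ → (ℤ → A) → A
D⟨ a , b , c ⟩ k = k (+ 4 * a * a + + 3 * b * b + + 2 * c * c - + 6 * a * b - + 2 * a * c - + 2 * b * c)

-- D does not change when all signs are reversed, so three lemmas cover the six mixed sign patterns;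
-- the letter after the bar is the coordinate of opposite sign. That two of the coordinates are not
-- both zero makes D at least 1.
D-ab|c : ∀ x y z → 0ℤ ≤ x → 0ℤ ≤ y → 0ℤ ≤ z → 0ℤ ≤ y + z - 1ℤ → D⟨ x , y , - z ⟩ λ d → 0ℤ ≤ d - 1ℤ
D-ab|c x y z px py pz h = 0≤4+3 _ quadruple
  where
  quadruple : D⟨ x , y , - z ⟩ λ d → 0ℤ ≤ + 4 * (d - 1ℤ) + + 3
  quadruple = 0≤sq (+ 4 * x - + 3 * y) ⊕ 0≤n 3 ⊗ (h ⊗ (py ⊕ pz ⊕ 0≤n 1)) ⊕ 0≤n 2 ⊗ (py ⊗ pz) ⊕ 0≤n 5 ⊗ (pz ⊗ pz)
    ⊕ 0≤n 8 ⊗ (px ⊗ pz) ⊕ 0≤n 2 by solve (x ∷ y ∷ z ∷ [])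

D-ac|b : ∀ x y z → 0ℤ ≤ x → 0ℤ ≤ y → 0ℤ ≤ z → 0ℤ ≤ y + z - 1ℤ → D⟨ x , - y , z ⟩ λ d → 0ℤ ≤ d - 1ℤ
D-ac|b x y z px py pz h =
  0≤n 3 ⊗ (px ⊗ px) ⊕ 0≤sq (x - z) ⊕ 0≤n 6 ⊗ (px ⊗ py) ⊕ 0≤n 2 ⊗ (py ⊗ py) ⊕ h ⊗ (py ⊕ pz ⊕ 0≤n 1)
    by solve (x ∷ y ∷ z ∷ [])

D-bc|a : ∀ x y z → 0ℤ ≤ x → 0ℤ ≤ y → 0ℤ ≤ z → 0ℤ ≤ x + z - 1ℤ → D⟨ - x , y , z ⟩ λ d → 0ℤ ≤ d - 1ℤ
D-bc|a x y z px py pz h =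
  0≤n 3 ⊗ (px ⊗ px) ⊕ 0≤sq (y - z) ⊕ 0≤n 6 ⊗ (px ⊗ py) ⊕ 0≤n 2 ⊗ (py ⊗ py) ⊕ h ⊗ (px ⊕ pz ⊕ 0≤n 1)
    by solve (x ∷ y ∷ z ∷ [])

record Anisotropic (u : ℤ[θ]) : Set where
  constructor anisotropic
  field
    N≢0 : N u ≢ 0ℤ
    sq′ : N u ≡ 1ℤ → SqClass u

anisotropic⁺ : ∀ u → Good u → Anisotropic u
anisotropic⁺ u (good p q) = anisotropic (λ e → absurd (p by cong (_- 1ℤ) e)) q
  where absurd : 0ℤ ≤ 0ℤ - 1ℤ → ⊥
        absurd ()

anisotropic⁻ : ∀ u → Good (⊟ u) → Anisotropic u
anisotropic⁻ u@(tri a b c) (good p _) = anisotropic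
  (λ e → absurd₀ (p by lem e)) (λ e → ⊥-elim (absurd₁ (p by lem e)))
  where
  lem : ∀ {n} → N u ≡ n → N (⊟ u) - 1ℤ ≡ - n - 1ℤ
  lem e = cong (_- 1ℤ) (trans (N-⊟ u) (cong -_ e))
  absurd₀ : 0ℤ ≤ - 0ℤ - 1ℤ → ⊥
  absurd₀ ()
  absurd₁ : 0ℤ ≤ - 1ℤ - 1ℤ → ⊥
  absurd₁ ()

Anisotropic-θ : ∀ u → Anisotropic (θ ⊠ u) → Anisotropic u
Anisotropic-θ u (anisotropic p q) = anisotropic (λ h → p (trans e h)) (λ h → SqClass-θ u (q (trans e h)))
  where e : N (θ ⊠ u) ≡ N u
        e = trans (N-⊠ θ u) (*-identityˡ (N u))

-- Descent on S. While the signs of the coordinates are mixed, multiplication by θ lowers S by at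
-- least 1 and preserves the norm; once they agree, `Good-cone` applies to u or to -u. Nonvanishing
-- of the norm and the classes of the units of norm 1 come out of the same descent.
≢𝟘⇒Anisotropic : ∀ u → u ≢ 𝟘 → Anisotropic u
≢𝟘⇒Anisotropic (tri a b c) = rec (S⟨ a , b , c ⟩ abs) a b c (0≤-abs (S-nonneg a b c))
  where
  0≤-abs : ∀ {m} → 0ℤ ≤ m → 0ℤ ≤ + abs m - m
  0≤-abs {+ n} _ = 0≤n 0 by sym (+-inverseʳ (+ n))
  S-nonneg : ∀ a b c → S⟨ a , b , c ⟩ λ s → 0ℤ ≤ s
  S-nonneg a b c = 0≤sq (a - + 2 * b + c) ⊕ 0≤sq (c - b) ⊕ 0≤sq (b + c - + 3 * a)
  rec : ∀ n a b c → (S⟨ a , b , c ⟩ λ s → 0ℤ ≤ + n - s) → tri a b c ≢ 𝟘 → Anisotropic (tri a b c)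
  rec n a b c h ≢𝟘 = go (0≤⊎0< a) (0≤⊎0< b) (0≤⊎0< c)
    where
    weaken : ∀ x → 0ℤ ≤ - x - 1ℤ → 0ℤ ≤ - x
    weaken x p = p ⊕ 0≤n 1 by solve (x ∷ [])
    step : ∀ n → (S⟨ a , b , c ⟩ λ s → 0ℤ ≤ + n - s) → (D⟨ a , b , c ⟩ λ d → 0ℤ ≤ d - 1ℤ) → Anisotropic (tri a b c)
    step zero h d = ⊥-elim (absurd (h ⊕ d ⊕ S-nonneg c (a + c) (b + c) by decrease))
      where
      absurd : 0ℤ ≤ - 1ℤ → ⊥
      absurd ()
      decrease : S⟨ a , b , c ⟩ λ s → D⟨ a , b , c ⟩ λ d → S⟨ c , a + c , b + c ⟩ λ s′ → 0ℤ - s + (d - 1ℤ) + s′ ≡ - 1ℤ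
      decrease = solve (a ∷ b ∷ c ∷ [])
    step (suc n) h d = Anisotropic-θ (tri a b c) (subst Anisotropic back
      (rec n c (a + c) (b + c) (h ⊕ d by lem (+ n)) nonzero))
      where
      lem : ∀ m → S⟨ a , b , c ⟩ λ s → D⟨ a , b , c ⟩ λ d → S⟨ c , a + c , b + c ⟩ λ s′ → (1ℤ + m) - s + (d - 1ℤ) ≡ m - s′
      lem m = solve (m ∷ a ∷ b ∷ c ∷ [])
      back : tri c (a + c) (b + c) ≡ θ ⊠ tri a b c
      back = tri≡ (solve (a ∷ b ∷ c ∷ [])) (solve (a ∷ b ∷ c ∷ [])) (solve (a ∷ b ∷ c ∷ []))
      nonzero : tri c (a + c) (b + c) ≢ 𝟘
      nonzero e = ≢𝟘 (trans (sym (⊠-identityˡ (tri a b c))) (trans (⊠-assoc θ⁻¹ θ (tri a b c)) (cong (θ⁻¹ ⊠_) (trans (sym back) e))))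
    go : 0ℤ ≤ a ⊎ 0ℤ ≤ - a - 1ℤ → 0ℤ ≤ b ⊎ 0ℤ ≤ - b - 1ℤ → 0ℤ ≤ c ⊎ 0ℤ ≤ - c - 1ℤ → Anisotropic (tri a b c)
    go (inj₁ pa) (inj₁ pb) (inj₁ pc) = anisotropic⁺ _ (Good-cone _ a b c pa pb pc
      (0≤-abs (0≤n 2 ⊗ pa ⊕ 0≤n 3 ⊗ pb ⊕ 0≤n 4 ⊗ pc)) ≢𝟘)
    go (inj₂ pa) (inj₂ pb) (inj₂ pc) = anisotropic⁻ _ (Good-cone _ (- a) (- b) (- c) (weaken a pa) (weaken b pb) (weaken c pc)
      (0≤-abs (0≤n 2 ⊗ weaken a pa ⊕ 0≤n 3 ⊗ weaken b pb ⊕ 0≤n 4 ⊗ weaken c pc)) (λ e → ≢𝟘 (flip e)))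
      where
      flip : tri (- a) (- b) (- c) ≡ 𝟘 → tri a b c ≡ 𝟘
      flip e = tri≡ (neg-injective (cong c₀ e)) (neg-injective (cong c₁ e)) (neg-injective (cong c₂ e))
    go (inj₁ pa) (inj₁ pb) (inj₂ pc) = step n h (D-ab|c a b (- c) pa pb (weaken c pc) (pc ⊕ pb by solve (b ∷ c ∷ [])) by solve (a ∷ b ∷ c ∷ []))
    go (inj₂ pa) (inj₂ pb) (inj₁ pc) = step n h (D-ab|c (- a) (- b) c (weaken a pa) (weaken b pb) pc (pb ⊕ pc by solve (b ∷ c ∷ [])) by solve (a ∷ b ∷ c ∷ []))
    go (inj₁ pa) (inj₂ pb) (inj₁ pc) = step n h (D-ac|b a (- b) c pa (weaken b pb) pc (pb ⊕ pc by solve (b ∷ c ∷ [])) by solve (a ∷ b ∷ c ∷ []))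
    go (inj₂ pa) (inj₁ pb) (inj₂ pc) = step n h (D-ac|b (- a) b (- c) (weaken a pa) pb (weaken c pc) (pb ⊕ pc by solve (b ∷ c ∷ [])) by solve (a ∷ b ∷ c ∷ []))
    go (inj₂ pa) (inj₁ pb) (inj₁ pc) = step n h (D-bc|a (- a) b c (weaken a pa) pb pc (pa ⊕ pc by solve (a ∷ c ∷ [])) by solve (a ∷ b ∷ c ∷ []))
    go (inj₁ pa) (inj₂ pb) (inj₂ pc) = step n h (D-bc|a a (- b) (- c) pa (weaken b pb) (weaken c pc) (pa ⊕ pc by solve (a ∷ c ∷ [])) by solve (a ∷ b ∷ c ∷ []))

-- Euclidean division in ℤ[θ]

pos : ℤ → ℤ
pos (+ n) = + n
pos -[1+ n ] = 0ℤ

0≤pos : ∀ t → 0ℤ ≤ pos t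
0≤pos (+ n) = 0≤n n
0≤pos -[1+ n ] = 0≤n 0

0≤pos-t : ∀ t → 0ℤ ≤ pos t - t
0≤pos-t (+ n) = 0≤n 0 by sym (+-inverseʳ (+ n))
0≤pos-t -[1+ n ] = 0≤n (suc n)

sumPos : List ℤ → ℤ
sumPos [] = 0ℤ
sumPos (t ∷ ts) = pos t + sumPos ts

dot : List ℤ → List ℤ → ℤ
dot (t ∷ ts) (m ∷ ms) = t * m + dot ts ms
dot _ _ = 0ℤ

dot⟨_,_⟩_ : List ℤ → List ℤ → (ℤ → Set) → Set
dot⟨ t ∷ ts , m ∷ ms ⟩ k = dot⟨ ts , ms ⟩ λ d → k (t * m + d)
dot⟨ _ , _ ⟩ k = k 0ℤ

record Bounded (M m : ℤ) : Set where
  constructor bounded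
  field
    0≤m : 0ℤ ≤ m
    m≤M : 0ℤ ≤ M - m

0≤sumPos : ∀ ts → 0ℤ ≤ sumPos ts
0≤sumPos [] = 0≤n 0
0≤sumPos (t ∷ ts) = 0≤pos t ⊕ 0≤sumPos ts

-- A linear form in quantities between 0 and M is at most the value obtained by setting those with
-- positive coefficients to M and the others to 0. Applied to the negated coefficients it also
-- yields the lower bound.
dot-upper : ∀ {M} → 0ℤ ≤ M → ∀ ts {ms} → All (Bounded M) ms → 0ℤ ≤ sumPos ts * M - dot ts ms
dot-upper {M} 0≤M [] _ = 0≤n 0
dot-upper {M} 0≤M ts@(_ ∷ _) All.[] = subst (0ℤ ≤_) (sym (+-identityʳ (sumPos ts * M))) (0≤sumPos ts ⊗ 0≤M)
dot-upper {M} 0≤M (t ∷ ts) {m ∷ ms} (bounded p q All.∷ ps) =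
  subst (0ℤ ≤_) (lem t (pos t) (sumPos ts) (dot ts ms) M m)
    (0≤+ {pos t * (M - m) + (pos t - t) * m} {sumPos ts * M - dot ts ms}
      (0≤+ {pos t * (M - m)} {(pos t - t) * m} (0≤pos t ⊗ q) (0≤pos-t t ⊗ p)) (dot-upper 0≤M ts ps))
  where
  lem : ∀ t x s e M m → x * (M - m) + (x - t) * m + (s * M - e) ≡ (x + s) * M - (t * m + e)
  lem t x s e M m = solve (x ∷ s ∷ e ∷ t ∷ m ∷ M ∷ [])

dot-neg : ∀ ts ms → dot (map -_ ts) ms ≡ - dot ts ms
dot-neg [] ms = refl
dot-neg (t ∷ ts) [] = refl
dot-neg (t ∷ ts) (m ∷ ms) = trans (cong (λ e → - t * m + e) (dot-neg ts ms)) (lem (dot ts ms))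
  where lem : ∀ e → - t * m + - e ≡ - (t * m + e)
        lem e = solve (e ∷ t ∷ m ∷ [])

-- Taylor coefficients and monomials of N (c n + δ) - N (c) n³.
coefficients : ℤ → ℤ → ℤ → List ℤ
coefficients a b c = (+ 3 * (a * a) + + 2 * (a * b) + + 6 * (a * c) - b * b - + 4 * (b * c) - c * c) ∷ (a * a - + 2 * (a * b) - + 4 * (a * c) + + 3 * (b * b) + + 2 * (b * c) - c * c) ∷ 
  (+ 3 * (a * a) - + 4 * (a * b) - + 2 * (a * c) + b * b - + 2 * (b * c) + + 3 * (c * c)) ∷ (+ 3 * a + b + + 3 * c) ∷ 
  (+ 2 * a - + 2 * b - + 4 * c) ∷ (+ 6 * a - + 4 * b - + 2 * c) ∷ (- (a) + + 3 * b + c) ∷ (- (+ 4 * a) + + 2 * b - + 2 * c) ∷ 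
  (- (a) - b + + 3 * c) ∷ + 1 ∷ + 1 ∷ + 3 ∷ - 1ℤ ∷ - (+ 4) ∷ - 1ℤ ∷ + 1 ∷ + 1 ∷ - 1ℤ ∷ 
  + 1 ∷ []

monomials : ℤ → ℤ → ℤ → ℤ → List ℤ
monomials n u v w = n * n * u ∷ n * n * v ∷ n * n * w ∷ n * u * u ∷ n * u * v ∷ n * u * w ∷ n * v * v ∷ n * v * w ∷ 
  n * w * w ∷ u * u * u ∷ u * u * v ∷ u * u * w ∷ u * v * v ∷ u * v * w ∷ u * w * w ∷ v * v * v ∷ 
  v * v * w ∷ v * w * w ∷ w * w * w ∷ []

taylor : ∀ a b c n u v w → N (tri (a * n + u) (b * n + v) (c * n + w))
  ≡ N (tri a b c) * (n * n * n) + dot (coefficients a b c) (monomials n u v w)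
taylor a b c n u v w = lem
  where
  lem : N⟨ tri (a * n + u) (b * n + v) (c * n + w) ⟩ λ l → N⟨ tri a b c ⟩ λ m →
    dot⟨ coefficients a b c , monomials n u v w ⟩ λ d → l ≡ m * (n * n * n) + d
  lem = solve (a ∷ b ∷ c ∷ n ∷ u ∷ v ∷ w ∷ [])

bounded-* : ∀ {n x y z} → 0ℤ ≤ n → Bounded n x → Bounded n y → Bounded n z → Bounded (n * n * n) (x * y * z)
bounded-* {n} {x} {y} {z} pn (bounded px qx) (bounded py qy) (bounded pz qz) = bounded (px ⊗ py ⊗ pz)
  (qx ⊗ (pn ⊗ pn) ⊕ px ⊗ (qy ⊗ pn ⊕ py ⊗ qz) by solve (n ∷ x ∷ y ∷ z ∷ []))

-- Coordinates are scaled by 5, so |N| < 1 becomes |N| < 125. The bound 124 leaves the slack that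
-- makes the inequality strict after multiplication by n³.
Small : ℤ → ℤ → ℤ → Set
Small a b c = 0ℤ ≤ + 124 - (N (tri a b c) + sumPos (coefficients a b c))
  × 0ℤ ≤ + 124 + (N (tri a b c) - sumPos (map -_ (coefficients a b c)))

-- ℤ[θ] is norm-Euclidean: cut the unit cube of ℝ³ into 125 cubes of side 1/5. On each
-- of them |N| < 1 after translation by one of the vertices of the unit cube.
boxes : ∀ (i j k : Fin 5) → ∃[ x ] ∃[ y ] ∃[ z ] Small
  (+ toℕ i - + 5 * + toℕ {2} x) (+ toℕ j - + 5 * + toℕ {2} y) (+ toℕ k - + 5 * + toℕ {2} z)
boxes = toWitness {a? = all? λ i → all? λ j → all? λ k → any? λ x → any? λ y → any? λ z →
  (0ℤ ≤? _) ×-dec (0ℤ ≤? _)} _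

record Box (k : ℕ) (n x : ℤ) : Set where
  constructor box
  field
    index : Fin k
    {δ} : ℤ
    0≤δ≤n : Bounded n δ
    x≡ : x ≡ + toℕ index * n + δ

findBox : ∀ k n x → 0ℤ ≤ x → 0ℤ ≤ + k * n - x - 1ℤ → Box k n x
findBox zero n x p q = ⊥-elim (absurd (p ⊕ q by solve (x ∷ n ∷ [])))
  where absurd : 0ℤ ≤ - 1ℤ → ⊥
        absurd ()
findBox (suc k) n x p q = go (0≤⊎0< (x - n))
  where
  shift : ∀ k → (1ℤ + k) * n - x - 1ℤ ≡ k * n - (x - n) - 1ℤ
  shift k = solve (k ∷ n ∷ x ∷ [])
  next : Box k n (x - n) → Box (suc k) n x
  next (box i {δ} b e) = box (Fin.suc i) b (lem (+ toℕ i) e)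
    where lem : ∀ i → x - n ≡ i * n + δ → x ≡ (1ℤ + i) * n + δ
          lem i e = lin1 1ℤ e (solve (i ∷ n ∷ x ∷ δ ∷ []))
  go : 0ℤ ≤ x - n ⊎ 0ℤ ≤ - (x - n) - 1ℤ → Box (suc k) n x
  go (inj₁ h) = next (findBox k n (x - n) h (q by shift (+ k)))
  go (inj₂ h) = box Fin.zero (bounded p (h ⊕ 0≤n 1 by solve (x ∷ n ∷ []))) (solve (x ∷ n ∷ []))

cancelPos : ∀ n x → 0ℤ ≤ n → 0ℤ ≤ n * x - 1ℤ → 0ℤ ≤ x - 1ℤ
cancelPos n x p q = either (0≤⊎0< (x - 1ℤ)) (λ h → h) λ h → ⊥-elim (absurd (neg h))
  where
  neg : 0ℤ ≤ - (x - 1ℤ) - 1ℤ → 0ℤ ≤ - 1ℤ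
  neg h = p ⊗ h ⊕ q by solve (n ∷ x ∷ [])
  absurd : 0ℤ ≤ - 1ℤ → ⊥
  absurd ()

record Rounding (n x y z : ℤ) : Set where
  constructor rounding
  field
    α β γ : ℤ
    upper : 0ℤ ≤ n * n * n - N (tri (x - α * n) (y - β * n) (z - γ * n)) - 1ℤ
    lower : 0ℤ ≤ n * n * n + N (tri (x - α * n) (y - β * n) (z - γ * n)) - 1ℤ

round : ∀ n x y z → 0ℤ ≤ n - 1ℤ → Bounded (n - 1ℤ) x → Bounded (n - 1ℤ) y → Bounded (n - 1ℤ) z → Rounding n x y z
round n x y z hn bx by′ bz = go (boxOf bx) (boxOf by′) (boxOf bz)
  where
  pn : 0ℤ ≤ n
  pn = hn ⊕ 0≤n 1 by solve (n ∷ [])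
  hn³ : 0ℤ ≤ n * n * n - 1ℤ
  hn³ = hn ⊗ (pn ⊗ pn ⊕ pn ⊕ 0≤n 1) by solve (n ∷ [])
  boxOf : ∀ {x} → Bounded (n - 1ℤ) x → Box 5 n (+ 5 * x)
  boxOf {x} (bounded p q) = findBox 5 n (+ 5 * x) (0≤n 5 ⊗ p) (0≤n 5 ⊗ q ⊕ 0≤n 4 by solve (n ∷ x ∷ []))
  go : Box 5 n (+ 5 * x) → Box 5 n (+ 5 * y) → Box 5 n (+ 5 * z) → Rounding n x y z
  go (box i {u} bu eu) (box j {v} bv ev) (box k {w} bw ew) = go′ (boxes i j k)
    where
    go′ : ∃[ α ] ∃[ β ] ∃[ γ ] Small
      (+ toℕ i - + 5 * + toℕ {2} α) (+ toℕ j - + 5 * + toℕ {2} β) (+ toℕ k - + 5 * + toℕ {2} γ) → Rounding n x y z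
    go′ (α , β , γ , hi , lo) = result (+ toℕ i) (+ toℕ j) (+ toℕ k) (+ toℕ α) (+ toℕ β) (+ toℕ γ) eu ev ew hi lo
      where
      result : ∀ i j k α β γ → + 5 * x ≡ i * n + u → + 5 * y ≡ j * n + v → + 5 * z ≡ k * n + w →
        0ℤ ≤ + 124 - (N (tri (i - + 5 * α) (j - + 5 * β) (k - + 5 * γ)) + sumPos (coefficients (i - + 5 * α) (j - + 5 * β) (k - + 5 * γ))) →
        0ℤ ≤ + 124 + (N (tri (i - + 5 * α) (j - + 5 * β) (k - + 5 * γ)) - sumPos (map -_ (coefficients (i - + 5 * α) (j - + 5 * β) (k - + 5 * γ)))) →
        Rounding n x y z
      result i j k α β γ eu ev ew hi lo = rounding α β γ
        (cancelPos (+ 125) (n³ - X) (0≤n 125) (hi ⊗ pn³ ⊕ dot-upper pn³ ts bs ⊕ hn³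
          by upperLem NC (sumPos ts) (dot ts ms) n³ X eq))
        (cancelPos (+ 125) (n³ + X) (0≤n 125) (lo ⊗ pn³ ⊕ dot-upper pn³ (map -_ ts) bs ⊕ hn³
          by lowerLem NC (sumPos (map -_ ts)) (dot ts ms) (dot (map -_ ts) ms) n³ X eq (dot-neg ts ms)))
        where
        n³ = n * n * n
        pn³ = pn ⊗ pn ⊗ pn
        c₁′ = i - + 5 * α
        c₂′ = j - + 5 * β
        c₃′ = k - + 5 * γ
        ts = coefficients c₁′ c₂′ c₃′
        ms = monomials n u v w
        NC = N (tri c₁′ c₂′ c₃′)
        X = N (tri (x - α * n) (y - β * n) (z - γ * n))
        bn : Bounded n n
        bn = bounded pn (0≤n 0 by solve (n ∷ []))
        bs : All (Bounded n³) ms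
        bs = bounded-* pn bn bn bu All.∷ bounded-* pn bn bn bv All.∷ bounded-* pn bn bn bw All.∷ bounded-* pn bn bu bu All.∷ 
          bounded-* pn bn bu bv All.∷ bounded-* pn bn bu bw All.∷ bounded-* pn bn bv bv All.∷ bounded-* pn bn bv bw All.∷ 
          bounded-* pn bn bw bw All.∷ bounded-* pn bu bu bu All.∷ bounded-* pn bu bu bv All.∷ bounded-* pn bu bu bw All.∷ 
          bounded-* pn bu bv bv All.∷ bounded-* pn bu bv bw All.∷ bounded-* pn bu bw bw All.∷ bounded-* pn bv bv bv All.∷ 
          bounded-* pn bv bv bw All.∷ bounded-* pn bv bw bw All.∷ bounded-* pn bw bw bw All.∷ All.[]
        homogeneous : ∀ p q r → + 125 * N (tri p q r) ≡ N (tri (+ 5 * p) (+ 5 * q) (+ 5 * r))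
        homogeneous p q r = lem
          where lem : N⟨ tri p q r ⟩ λ m → N⟨ tri (+ 5 * p) (+ 5 * q) (+ 5 * r) ⟩ λ n → + 125 * m ≡ n
                lem = solve (p ∷ q ∷ r ∷ [])
        scale : ∀ x i α u → + 5 * x ≡ i * n + u → + 5 * (x - α * n) ≡ (i - + 5 * α) * n + u
        scale x i α u e = lin1 1ℤ e (solve (x ∷ i ∷ α ∷ u ∷ n ∷ []))
        eq : + 125 * X ≡ NC * n³ + dot ts ms
        eq = trans (homogeneous (x - α * n) (y - β * n) (z - γ * n))
          (trans (cong N (tri≡ (scale x i α u eu) (scale y j β v ev) (scale z k γ w ew)))
            (taylor c₁′ c₂′ c₃′ n u v w))
        upperLem : ∀ C s d m X → + 125 * X ≡ C * m + d →
          (+ 124 - (C + s)) * m + (s * m - d) + (m - 1ℤ) ≡ + 125 * (m - X) - 1ℤ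
        upperLem C s d m X e = lin1 1ℤ e (solve (C ∷ s ∷ d ∷ m ∷ X ∷ []))
        lowerLem : ∀ C s d d′ m X → + 125 * X ≡ C * m + d → d′ ≡ - d →
          (+ 124 + (C - s)) * m + (s * m - d′) + (m - 1ℤ) ≡ + 125 * (m + X) - 1ℤ
        lowerLem C s d d′ m X e e′ = lin2 (- 1ℤ) (- 1ℤ) e e′ (solve (C ∷ s ∷ d ∷ d′ ∷ m ∷ X ∷ []))

record QuotRem (n x : ℤ) : Set where
  constructor quotRem
  field
    q : ℤ
    {ρ} : ℤ
    ρ-bounded : Bounded (n - 1ℤ) ρ
    x≡ : x ≡ q * n + ρ

divMod : ∀ n x → 0ℤ ≤ n - 1ℤ → QuotRem n x
divMod (+ suc k) x h = quotRem (x /ℕ suc k) {+ (x %ℕ suc k)}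
  (bounded (0≤n _) (i≤j⇒0≤j-i (+≤+ (ℕ.s≤s⁻¹ (n%ℕd<d x (suc k))))))
  (trans (a≡a%ℕn+[a/ℕn]*n x (suc k)) (+-comm (+ (x %ℕ suc k)) (x /ℕ suc k * + suc k)))

-- The remainder r and the quotient q, both ways round so that no subtraction is needed.
record Division (u v : ℤ[θ]) : Set where
  constructor division
  field
    q k r : ℤ[θ]
    u≡ : u ≡ q ⊠ v ⊞ r
    r≡ : r ≡ u ⊞ k ⊠ v
    N-decreases : abs (N r) ℕ.< abs (N v)

abs-< : ∀ x n → 0ℤ ≤ n - x - 1ℤ → 0ℤ ≤ n + x - 1ℤ → abs x ℕ.< abs n
abs-< x n p q = go x n p q
  where
  nonneg : ∀ x n → 0ℤ ≤ n - x - 1ℤ → 0ℤ ≤ n + x - 1ℤ → 0ℤ ≤ n - 1ℤ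
  nonneg x n p q = cancelPos (+ 2) n (0≤n 2) (p ⊕ q ⊕ 0≤n 1 by solve (x ∷ n ∷ []))
  below : ∀ m n → 0ℤ ≤ + n - + m - 1ℤ → m ℕ.< n
  below m n h = drop‿+≤+ (0≤i-j⇒j≤i {+ n} {1ℤ + + m} (h by lem (+ m) (+ n)))
    where lem : ∀ m n → n - m - 1ℤ ≡ n - (1ℤ + m)
          lem m n = solve (m ∷ n ∷ [])
  go : ∀ x n → 0ℤ ≤ n - x - 1ℤ → 0ℤ ≤ n + x - 1ℤ → abs x ℕ.< abs n
  go (+ m) (+ n) p q = below m n p
  go -[1+ m ] (+ n) p q = below (suc m) n q
  go x -[1+ n ] p q = ⊥-elim (absurd (nonneg x -[1+ n ] p q))
    where absurd : 0ℤ ≤ -[1+ n ] - 1ℤ → ⊥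
          absurd ()

-- The exact quotient is u cof(v) / N(v). `divMod` takes the integer parts of its coordinates and
-- `round` corrects them by a vertex of the unit cube. The remainder is measured through N(r) N(v)²
-- = N(r cof(v)).
divide⁺ : ∀ u v → 0ℤ ≤ N v - 1ℤ → Division u v
divide⁺ u v hn = go (divMod n (c₀ w) hn) (divMod n (c₁ w) hn) (divMod n (c₂ w) hn)
  where
  n = N v
  w = u ⊠ cof v
  go : QuotRem n (c₀ w) → QuotRem n (c₁ w) → QuotRem n (c₂ w) → Division u v
  go (quotRem q₀ {x} bx e₀) (quotRem q₁ {y} by′ e₁) (quotRem q₂ {z} bz e₂) = go′ (round n x y z hn bx by′ bz)
    where
    go′ : Rounding n x y z → Division u v
    go′ (rounding α β γ hi lo) = division q (⊟ q) r (lem₁ q u v) (lem₂ q u v)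
      (abs-< (N r) n (cancel (n - N r) (hi by lem₃ (N r) n _ Nr)) (cancel (n + N r) (lo by lem₄ (N r) n _ Nr)))
      where
      q r : ℤ[θ]
      q = tri (q₀ + α) (q₁ + β) (q₂ + γ)
      r = u ⊞ ⊟ q ⊠ v
      lem₁ : ∀ q u v → u ≡ q ⊠ v ⊞ (u ⊞ (⊟ q) ⊠ v)
      lem₁ q u v = Solver.solve (q ∷ u ∷ v ∷ []) θring
      lem₂ : ∀ q u v → u ⊞ (⊟ q) ⊠ v ≡ u ⊞ (⊟ q) ⊠ v
      lem₂ q u v = refl
      component : ∀ w q α ρ → w ≡ q * n + ρ → ρ - α * n ≡ w - (q + α) * n
      component w q α ρ e = lin1 (- 1ℤ) e (expand n)
        where expand : ∀ n → ρ - α * n + - 1ℤ * (q * n + ρ) ≡ w - (q + α) * n + - 1ℤ * w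
              expand n = solve (w ∷ q ∷ α ∷ ρ ∷ n ∷ [])
      r⊠cof : r ⊠ cof v ≡ tri (x - α * n) (y - β * n) (z - γ * n)
      r⊠cof = trans (expand q u v (cof v)) (trans (cong (λ e → u ⊠ cof v ⊞ (⊟ q) ⊠ e) (⊠-cof v)) (trans (scalar w q n)
        (sym (tri≡ (component (c₀ w) q₀ α x e₀) (component (c₁ w) q₁ β y e₁) (component (c₂ w) q₂ γ z e₂)))))
        where
        expand : ∀ q u v c → (u ⊞ (⊟ q) ⊠ v) ⊠ c ≡ u ⊠ c ⊞ (⊟ q) ⊠ (v ⊠ c)
        expand q u v c = Solver.solve (q ∷ u ∷ v ∷ c ∷ []) θring
        scalar : ∀ w q n → w ⊞ (⊟ q) ⊠ int n ≡ tri (c₀ w - c₀ q * n) (c₁ w - c₁ q * n) (c₂ w - c₂ q * n)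
        scalar (tri a b c) (tri x y z) n = tri≡ s₀ s₁ s₂
          where
          s₀ : ⊠⟨ tri (- x) (- y) (- z) , tri n 0ℤ 0ℤ ⟩ λ X _ _ → a + X ≡ a - x * n
          s₀ = solve (a ∷ x ∷ y ∷ z ∷ n ∷ [])
          s₁ : ⊠⟨ tri (- x) (- y) (- z) , tri n 0ℤ 0ℤ ⟩ λ _ Y _ → b + Y ≡ b - y * n
          s₁ = solve (b ∷ x ∷ y ∷ z ∷ n ∷ [])
          s₂ : ⊠⟨ tri (- x) (- y) (- z) , tri n 0ℤ 0ℤ ⟩ λ _ _ Z → c + Z ≡ c - z * n
          s₂ = solve (c ∷ x ∷ y ∷ z ∷ n ∷ [])
      Nr : N r * (n * n) ≡ N (tri (x - α * n) (y - β * n) (z - γ * n))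
      Nr = trans (cong (N r *_) (sym (N-cof v))) (trans (sym (N-⊠ r (cof v))) (cong N r⊠cof))
      lem₃ : ∀ s n t → s * (n * n) ≡ t → n * n * n - t - 1ℤ ≡ n * n * (n - s) - 1ℤ
      lem₃ s n t e = lin1 1ℤ e (solve (s ∷ n ∷ t ∷ []))
      lem₄ : ∀ s n t → s * (n * n) ≡ t → n * n * n + t - 1ℤ ≡ n * n * (n + s) - 1ℤ
      lem₄ s n t e = lin1 (- 1ℤ) e (solve (s ∷ n ∷ t ∷ []))
      cancel : ∀ y → 0ℤ ≤ n * n * y - 1ℤ → 0ℤ ≤ y - 1ℤ
      cancel y = cancelPos (n * n) y (0≤sq n)

divide : ∀ u v → v ≡ 𝟘 ⊎ Division u v
divide u v@(tri a b c) = go (a ≟ 0ℤ) (b ≟ 0ℤ) (c ≟ 0ℤ)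
  where
  lem : ∀ q u v r → u ≡ q ⊠ (⊟ v) ⊞ r → u ≡ (⊟ q) ⊠ v ⊞ r
  lem q u v r e = trans e (Solver.solve (q ∷ v ∷ r ∷ []) θring)
  lem′ : ∀ k u v r → r ≡ u ⊞ k ⊠ (⊟ v) → r ≡ u ⊞ (⊟ k) ⊠ v
  lem′ k u v r e = trans e (Solver.solve (k ∷ u ∷ v ∷ []) θring)
  negate : Division u (⊟ v) → Division u v
  negate (division q k r e e′ d) = division (⊟ q) (⊟ k) r (lem q u v r e) (lem′ k u v r e′)
    (subst (abs (N r) ℕ.<_) (trans (cong abs (N-⊟ v)) (∣-i∣≡∣i∣ (N v))) d)
  nonzero : v ≢ 𝟘 → v ≡ 𝟘 ⊎ Division u v
  nonzero ≢𝟘 = fin (0≤⊎0< (N v - 1ℤ)) (0≤⊎0< (- N v - 1ℤ))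
    where
    lem″ : ∀ n → - (n - 1ℤ) - 1ℤ ≡ - n
    lem″ n = solve (n ∷ [])
    lem‴ : ∀ n → - (- n - 1ℤ) - 1ℤ ≡ n
    lem‴ n = solve (n ∷ [])
    fin : 0ℤ ≤ N v - 1ℤ ⊎ 0ℤ ≤ - (N v - 1ℤ) - 1ℤ → 0ℤ ≤ - N v - 1ℤ ⊎ 0ℤ ≤ - (- N v - 1ℤ) - 1ℤ → v ≡ 𝟘 ⊎ Division u v
    fin (inj₁ h) _ = inj₂ (divide⁺ u v h)
    fin (inj₂ _) (inj₁ h) = inj₂ (negate (divide⁺ u (⊟ v) (h by cong (_- 1ℤ) (sym (N-⊟ v)))))
    fin (inj₂ h) (inj₂ h′) = ⊥-elim (Anisotropic.N≢0 (≢𝟘⇒Anisotropic v ≢𝟘)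
      (≡0⇐0≤± (h′ by lem‴ (N v)) (h by lem″ (N v))))
  go : Dec (a ≡ 0ℤ) → Dec (b ≡ 0ℤ) → Dec (c ≡ 0ℤ) → v ≡ 𝟘 ⊎ Division u v
  go (yes p) (yes q) (yes r) = inj₁ (tri≡ p q r)
  go (no p) _ _ = nonzero λ e → p (cong c₀ e)
  go (yes _) (no p) _ = nonzero λ e → p (cong c₁ e)
  go (yes _) (yes _) (no p) = nonzero λ e → p (cong c₂ e)

-- Elements of square norm up to units

record Bezoutθ (u v : ℤ[θ]) : Set where
  constructor mkBezoutθ
  field
    g p q s t : ℤ[θ]
    u≡gp : u ≡ g ⊠ p
    v≡gq : v ≡ g ⊠ q
    bez : g ≡ s ⊠ u ⊞ t ⊠ v

bezoutθ : ∀ u v → Bezoutθ u v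
bezoutθ u v = rec u v (<-wellFounded (abs (N v)))
  where
  rec : ∀ u v → Acc ℕ._<_ (abs (N v)) → Bezoutθ u v
  rec u v (acc smaller) = go (divide u v)
    where
    zeroCase : ∀ u v → v ≡ 𝟘 → Bezoutθ u v
    zeroCase u v e = mkBezoutθ u 𝟙 𝟘 𝟙 𝟘 (Solver.solve (u ∷ []) θring)
      (trans e (lem u)) (Solver.solve (u ∷ v ∷ []) θring)
      where lem : ∀ u → 𝟘 ≡ u ⊠ 𝟘
            lem u = Solver.solve (u ∷ []) θring
    step : ∀ q k r → u ≡ q ⊠ v ⊞ r → r ≡ u ⊞ k ⊠ v → Bezoutθ v r → Bezoutθ u v
    step q k r e e′ (mkBezoutθ g a b s t v≡ r≡ bz) = mkBezoutθ g (q ⊠ a ⊞ b) a t (s ⊞ t ⊠ k)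
      (trans e (trans (cong₂ (λ v r → q ⊠ v ⊞ r) v≡ r≡) (lem q g a b))) v≡
      (trans bz (trans (cong (λ r → s ⊠ v ⊞ t ⊠ r) e′) (lem′ s v t u k)))
      where
      lem : ∀ q g a b → q ⊠ (g ⊠ a) ⊞ g ⊠ b ≡ g ⊠ (q ⊠ a ⊞ b)
      lem q g a b = Solver.solve (q ∷ g ∷ a ∷ b ∷ []) θring
      lem′ : ∀ s v t u k → s ⊠ v ⊞ t ⊠ (u ⊞ k ⊠ v) ≡ t ⊠ u ⊞ (s ⊞ t ⊠ k) ⊠ v
      lem′ s v t u k = Solver.solve (s ∷ v ∷ t ∷ u ∷ k ∷ []) θring
    go : v ≡ 𝟘 ⊎ Division u v → Bezoutθ u v
    go (inj₁ e) = zeroCase u v e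
    go (inj₂ (division q k r e e′ lt)) = step q k r e e′ (rec v r (smaller lt))

record Comaximal (u v w : ℤ[θ]) : Set where
  constructor comaximal
  field
    {x y z} : ℤ[θ]
    1≡ : 𝟙 ≡ x ⊠ u ⊞ y ⊠ v ⊞ z ⊠ w

-- The ideal I = (α , w) is principal, I = (g), and I² = (α) by comaximality: hence α is g²
-- up to a unit, whose norm is positive.
squareClass : ∀ α w → N α ≡ w * w → w ≢ 0ℤ → Comaximal α (int w) (cof α) → SqClass α
squareClass α w Nα w≢0 (comaximal {x} {y} {z} one) = go (bezoutθ α (int w))
  where
  α⊠cof : α ⊠ cof α ≡ int w ⊠ int w
  α⊠cof = trans (⊠-cof α) (trans (cong int Nα) (int-⊠ w w))
  go : Bezoutθ α (int w) → SqClass α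
  go (mkBezoutθ g p q s t α≡ w≡ bz) = fin (SqClass-of-unit Nν)
    where
    μ ν : ℤ[θ]
    -- Here μ is g² = (sα + tw)² with one factor α removed, by w² = α cof(α). Multiplying 1 = xα +
    -- yw + z cof(α) by α leaves α², αw and w², all multiples of g²; the sum of the quotients is ν.
    μ = s ⊠ s ⊠ α ⊞ (s ⊠ t ⊠ int w ⊞ s ⊠ t ⊠ int w) ⊞ t ⊠ t ⊠ cof α
    ν = x ⊠ (p ⊠ p) ⊞ y ⊠ (p ⊠ q) ⊞ z ⊠ (q ⊠ q)
    g²≡αμ : g ⊠ g ≡ α ⊠ μ
    g²≡αμ = trans (cong₂ _⊠_ bz bz) (trans (lem s t α (int w)) (trans (cong (λ e → s ⊠ s ⊠ (α ⊠ α) ⊞ (s ⊠ t ⊠ (int w ⊠ α) ⊞ s ⊠ t ⊠ (int w ⊠ α)) ⊞ t ⊠ t ⊠ e) (sym α⊠cof)) (lem′ (s ⊠ s) (s ⊠ t) (t ⊠ t) α (int w) (cof α))))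
      where
      lem : ∀ s t a w → (s ⊠ a ⊞ t ⊠ w) ⊠ (s ⊠ a ⊞ t ⊠ w) ≡ s ⊠ s ⊠ (a ⊠ a) ⊞ (s ⊠ t ⊠ (w ⊠ a) ⊞ s ⊠ t ⊠ (w ⊠ a)) ⊞ t ⊠ t ⊠ (w ⊠ w)
      lem s t a w = Solver.solve (s ∷ t ∷ a ∷ w ∷ []) θring
      lem′ : ∀ p q r a w c → p ⊠ (a ⊠ a) ⊞ (q ⊠ (w ⊠ a) ⊞ q ⊠ (w ⊠ a)) ⊞ r ⊠ (a ⊠ c) ≡ a ⊠ (p ⊠ a ⊞ (q ⊠ w ⊞ q ⊠ w) ⊞ r ⊠ c)
      lem′ p q r a w c = Solver.solve (p ∷ q ∷ r ∷ a ∷ w ∷ c ∷ []) θring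
    α≡g²ν : α ≡ ν ⊠ (g ⊠ g)
    α≡g²ν = trans (sym (⊠-identityˡ α)) (trans (cong (_⊠ α) one) (trans (lem x y z α (int w) (cof α))
      (trans (cong (λ e → x ⊠ (α ⊠ α) ⊞ y ⊠ (α ⊠ int w) ⊞ z ⊠ e) α⊠cof)
      (trans (cong₂ (λ a w → x ⊠ (a ⊠ a) ⊞ y ⊠ (a ⊠ w) ⊞ z ⊠ (w ⊠ w)) α≡ w≡)
      (trans (cong₂ (λ e f → x ⊠ e ⊞ y ⊠ f ⊞ z ⊠ ((g ⊠ q) ⊠ (g ⊠ q))) (square g p p) (square g p q))
      (trans (cong (λ e → x ⊠ (p ⊠ p ⊠ (g ⊠ g)) ⊞ y ⊠ (p ⊠ q ⊠ (g ⊠ g)) ⊞ z ⊠ e) (square g q q))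
        (collect x y z (p ⊠ p) (p ⊠ q) (q ⊠ q) (g ⊠ g))))))))
      where
      lem : ∀ x y z a w c → (x ⊠ a ⊞ y ⊠ w ⊞ z ⊠ c) ⊠ a ≡ x ⊠ (a ⊠ a) ⊞ y ⊠ (a ⊠ w) ⊞ z ⊠ (a ⊠ c)
      lem x y z a w c = Solver.solve (x ∷ y ∷ z ∷ a ∷ w ∷ c ∷ []) θring
      square : ∀ g p q → (g ⊠ p) ⊠ (g ⊠ q) ≡ p ⊠ q ⊠ (g ⊠ g)
      square g p q = Solver.solve (g ∷ p ∷ q ∷ []) θring
      collect : ∀ x y z a b c g → x ⊠ (a ⊠ g) ⊞ y ⊠ (b ⊠ g) ⊞ z ⊠ (c ⊠ g) ≡ (x ⊠ a ⊞ y ⊠ b ⊞ z ⊠ c) ⊠ g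
      collect x y z a b c g = Solver.solve (x ∷ y ∷ z ∷ a ∷ b ∷ c ∷ g ∷ []) θring
    N-product : ∀ u v → N (u ⊠ (v ⊠ v)) ≡ N u * (N v * N v)
    N-product u v = trans (N-⊠ u (v ⊠ v)) (cong (N u *_) (N-⊠ v v))
    Nαν : w * w ≡ N ν * (N g * N g)
    Nαν = trans (sym Nα) (trans (cong N α≡g²ν) (N-product ν g))
    Ng² : N g * N g ≡ w * w * N μ
    Ng² = trans (sym (N-⊠ g g)) (trans (cong N g²≡αμ) (trans (N-⊠ α μ) (cong (_* N μ) Nα)))
    Nν : N ν ≡ 1ℤ
    Nν = unitNorm (N ν) (N g) (N μ) Nαν Ng²
      where
      unitNorm : ∀ n g m → w * w ≡ n * (g * g) → g * g ≡ w * w * m → n ≡ 1ℤ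
      unitNorm n g m e e′ = either (unit {m} n nm) (λ h → h) λ h → ⊥-elim (w≢0 (0≤-sq⇒≡0 w (0≤sq g by neg h)))
        where
        nm : n * m ≡ 1ℤ
        nm = cancelˡ {n * m} {1ℤ} w w≢0 (cancelˡ {w * (n * m)} {w * 1ℤ} w w≢0 (lin2 (- 1ℤ) (- n) e e′ (solve (w ∷ n ∷ g ∷ m ∷ []))))
        neg : n ≡ - 1ℤ → g * g ≡ - (w * w)
        neg h = lin2 1ℤ (g * g) e h (solve (w ∷ n ∷ g ∷ []))
    SqClass-of-unit : N ν ≡ 1ℤ → SqClass ν
    SqClass-of-unit e = Anisotropic.sq′ (≢𝟘⇒Anisotropic ν λ h → absurd (trans (sym e) (cong N h))) e
      where absurd : 1ℤ ≡ 0ℤ → ⊥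
            absurd ()
    fin : SqClass ν → SqClass α
    fin (sqClass {η} (inj₁ e)) = sqClass {η = η ⊠ g} (inj₁ (trans α≡g²ν (trans (cong (_⊠ (g ⊠ g)) e) (lem η g))))
      where lem : ∀ η g → η ⊠ η ⊠ (g ⊠ g) ≡ (η ⊠ g) ⊠ (η ⊠ g)
            lem η g = Solver.solve (η ∷ g ∷ []) θring
    fin (sqClass {η} (inj₂ e)) = sqClass {η = η ⊠ g} (inj₂ (trans α≡g²ν (trans (cong (_⊠ (g ⊠ g)) e) (lem θ η g))))
      where lem : ∀ t η g → t ⊠ (η ⊠ η) ⊠ (g ⊠ g) ≡ t ⊠ ((η ⊠ g) ⊠ (η ⊠ g))
            lem t η g = Solver.solve (t ∷ η ∷ g ∷ []) θring

tr : ℤ[θ] → ℤ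
tr (tri a b c) = + 3 * a + b + + 3 * c

e₂⟨_⟩_ : ∀ {ℓ} {A : Set ℓ} → ℤ[θ] → (ℤ → A) → A
e₂⟨ tri a b c ⟩ k = k (+ 3 * (a * a) + + 2 * (a * b) + + 6 * (a * c) - b * b - + 4 * (b * c) - c * c)

e₂ : ℤ[θ] → ℤ
e₂ u = e₂⟨ u ⟩ λ e → e

-- Cayley-Hamilton: u² - tr(u) u + e₂(u) is the cofactor, where e₂ is the linear coefficient of the
-- characteristic polynomial. So whatever divides both u and its cofactor divides the integer e₂(u),
-- and a coprimality in ℤ can replace comaximality in ℤ[θ].
cof-e₂ : ∀ u → int (e₂ u) ≡ cof u ⊞ u ⊠ (int (tr u) ⊞ ⊟ u)
cof-e₂ (tri a b c) = tri≡ lem₀ lem₁ lem₂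
  where
  lem₀ : e₂⟨ tri a b c ⟩ λ e → cof⟨ tri a b c ⟩ λ x y z → ⊠⟨ tri a b c , tri (+ 3 * a + b + + 3 * c + - a) (0ℤ + - b) (0ℤ + - c) ⟩ λ X Y Z → e ≡ x + X
  lem₀ = solve (a ∷ b ∷ c ∷ [])
  lem₁ : cof⟨ tri a b c ⟩ λ x y z → ⊠⟨ tri a b c , tri (+ 3 * a + b + + 3 * c + - a) (0ℤ + - b) (0ℤ + - c) ⟩ λ X Y Z → 0ℤ ≡ y + Y
  lem₁ = solve (a ∷ b ∷ c ∷ [])
  lem₂ : cof⟨ tri a b c ⟩ λ x y z → ⊠⟨ tri a b c , tri (+ 3 * a + b + + 3 * c + - a) (0ℤ + - b) (0ℤ + - c) ⟩ λ X Y Z → 0ℤ ≡ z + Z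
  lem₂ = solve (a ∷ b ∷ c ∷ [])

squareClass′ : ∀ α w → N α ≡ w * w → w ≢ 0ℤ → Cop (e₂ α) w → SqClass α
squareClass′ α w Nα w≢0 (s , t , e) = squareClass α w Nα w≢0
  (comaximal {x = int s ⊠ m} {int t} {int s} (trans (cong int (sym e)) (trans (split-int (e₂ α))
    (trans (cong (λ e → int s ⊠ e ⊞ int t ⊠ int w) (cof-e₂ α)) (lem (int s) (int t) α (int w) (cof α) m)))))
  where
  m : ℤ[θ]
  m = int (tr α) ⊞ ⊟ α
  split-int : ∀ d → int (s * d + t * w) ≡ int s ⊠ int d ⊞ int t ⊠ int w
  split-int d = cong₂ _⊞_ (int-⊠ s d) (int-⊠ t w)
  lem : ∀ s t α w c m → s ⊠ (c ⊞ α ⊠ m) ⊞ t ⊠ w ≡ s ⊠ m ⊠ α ⊞ t ⊠ w ⊞ s ⊠ c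
  lem s t α w c m = Solver.solve (s ∷ t ∷ α ∷ w ∷ c ∷ m ∷ []) θring

∣⇒∣g : a ∣ b → Cop c b → Cop c a
∣⇒∣g {a} {b} {c} (divides q e) h = copDivʳ a q (subst (Cop c) (trans e (*-comm q a)) h)

-- The discriminant -44 of ℤ[θ] enters here: X³ - 16 X r² + 32 r³ and its derivative at
-- X = 3r are 11 r³ and 11 r², so 11 divides the value at X = 3r - 11j exactly once.
coprime-to-derivative : ∀ K g r j v → 0ℤ ≤ g → Cop g r →
  K * (g * v * (g * v)) ≡ (+ 3 * r - g * j) * (+ 3 * r - g * j) * (+ 3 * r - g * j)
    - + 16 * ((+ 3 * r - g * j) * (r * r)) + + 32 * (r * r * r) → g ≡ 1ℤ
coprime-to-derivative K g r j v 0≤g h e = conclude (ℕ.prime⇒irreducible (toWitness {a? = ℕ.prime? 11} _) (∣⇒∣ᵤ g∣11))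
  where
  g∣11r³ : g ∣ r * (r * (r * + 11))
  g∣11r³ = divides (K * (v * (g * v)) + (+ 11 * (r * r) * j - + 9 * (r * g * j * j) + g * g * j * j * j)) eq
    where
    eq : r * (r * (r * + 11)) ≡ (K * (v * (g * v)) + (+ 11 * (r * r) * j - + 9 * (r * g * j * j) + g * g * j * j * j)) * g
    eq = lin1 -1ℤ e (solve (K ∷ g ∷ r ∷ j ∷ v ∷ []))
  g∣11 : g ∣ + 11
  g∣11 = euclid {g} {r} {+ 11} h (euclid {g} {r} {r * + 11} h (euclid {g} {r} {r * (r * + 11)} h g∣11r³))
  eleven : g ≡ + 11 → g ≡ 1ℤ
  eleven refl = ⊥-elim (not1 (euclid {+ 11} {r} {1ℤ} h (euclid {+ 11} {r} {r * 1ℤ} h (euclid {+ 11} {r} {r * (r * 1ℤ)} h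
    (divides (K * (v * v) + (r * r * j - + 9 * (r * j * j) + + 11 * (j * j * j)))
      (cancelˡ {r * (r * (r * 1ℤ))} (+ 11) (λ ()) eq))))))
    where
    not1 : + 11 ∣ 1ℤ → ⊥
    not1 (divides q q≡) = ¬mult 10 0 q (ℕ.s≤s ℕ.z≤n) (trans (*-comm (+ 11) q) (sym q≡))
    eq : + 11 * (r * (r * (r * 1ℤ))) ≡ + 11 * ((K * (v * v) + (r * r * j - + 9 * (r * j * j) + + 11 * (j * j * j))) * + 11)
    eq = lin1 -1ℤ e (solve (K ∷ r ∷ j ∷ v ∷ []))
  conclude : abs g ≡ 1 ⊎ abs g ≡ 11 → g ≡ 1ℤ
  conclude (inj₁ p) = trans (sym (0≤i⇒+∣i∣≡i 0≤g)) (cong +_ p)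
  conclude (inj₂ p) = eleven (trans (sym (0≤i⇒+∣i∣≡i 0≤g)) (cong +_ p))

cop-by-gcd : ∀ a b → (∀ g → 0ℤ ≤ g → g ∣ a → g ∣ b → g ≡ 1ℤ) → Cop a b
cop-by-gcd a b f = go (bezout a b)
  where
  go : Bezout a b → Cop a b
  go (mkBezout {g} {s} {t} p q r e) = s , t , trans e (f g p q r)

-- 2-descent on the modular curve: the square class

-- This is y² + y = x³ - x² with x = r / t² and 2y + 1 = w / t³. The right side is the norm of t² +
-- r(θ² - 1).
Curve : ℤ → ℤ → ℤ → Set
Curve r t w = w * w ≡ t * t * (t * t) * (t * t) - + 4 * (r * r * (t * t)) + + 4 * (r * r * r)

odd⇒cop2 : ∀ k → a ≡ + 2 * k + 1ℤ → Cop a (+ 2)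
odd⇒cop2 {a} k e = 1ℤ , - k , lin1 1ℤ e (solve (a ∷ k ∷ []))

even⇒¬cop2 : ∀ k l → a ≡ + 2 * k → b ≡ + 2 * l → Cop a b → ⊥
even⇒¬cop2 {a} {b} k l e f (s , t , h) = ¬mult 1 0 (s * k + t * l) (ℕ.s≤s ℕ.z≤n)
  (lin3 1ℤ (- s) (- t) h e f (solve (a ∷ b ∷ k ∷ l ∷ s ∷ t ∷ [])))

copCube : Cop a b → Cop (a * a * a) b
copCube h = copSym (copMul (copMul (copSym h) (copSym h)) (copSym h))

N≢0 : ∀ α w → α ≢ 𝟘 → N α ≡ w * w → w ≢ 0ℤ
N≢0 α w ≢𝟘 e refl = Anisotropic.N≢0 (≢𝟘⇒Anisotropic α ≢𝟘) e

-- For t odd, w is prime to 2r, so a common divisor of w and `e₂ α` can only come from the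
-- discriminant.
module OddCase (r t w k : ℤ) (h : Cop r t) (curve : Curve r t w) (odd : t ≡ + 2 * k + 1ℤ) where
  α : ℤ[θ]
  α = tri (t * t - r) 0ℤ r

  Nα : N α ≡ w * w
  Nα = lem
    where lem : N⟨ tri (t * t - r) 0ℤ r ⟩ λ n → n ≡ w * w
          lem = lin1 -1ℤ curve (solve (r ∷ t ∷ w ∷ []))

  α≢𝟘 : α ≢ 𝟘
  α≢𝟘 e = ℕ.1+n≢0 (sym (abs-pos (noUnit h (cong c₂ e) (t≡0 (cong c₀ e) (cong c₂ e)))))
    where
    t≡0 : t * t - r ≡ 0ℤ → r ≡ 0ℤ → t ≡ 0ℤ
    t≡0 p q = sq≡0 t (lin2 1ℤ 1ℤ p q (solve (r ∷ t ∷ [])))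
    noUnit : Cop r t → r ≡ 0ℤ → t ≡ 0ℤ → 0ℤ ≡ 1ℤ
    noUnit (s , u , e) p q = lin3 1ℤ (- s) (- u) e p q (solve (r ∷ t ∷ s ∷ u ∷ []))
    abs-pos : 0ℤ ≡ 1ℤ → 0 ≡ 1
    abs-pos = cong abs

  copWr : Cop w r
  copWr = copDivˡ {r} w w (copMod {w * w} {r} {t * t * t * (t * t * t)} (+ 4 * (r * (t * t)) - + 4 * (r * r)) eq
      (copSym (copMul (copSym (copCube (copSym h))) (copSym (copCube (copSym h))))))
    where eq : w * w + (+ 4 * (r * (t * t)) - + 4 * (r * r)) * r ≡ t * t * t * (t * t * t)
          eq = lin1 1ℤ curve (solve (r ∷ t ∷ w ∷ []))

  copW2 : Cop w (+ 2)
  copW2 = copDivˡ {+ 2} w w (copMod {w * w} {+ 2} {t * t * t * (t * t * t)} (+ 2 * (r * r * (t * t)) - + 2 * (r * r * r)) eq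
      (copSym (copMul (copSym (copCube t2)) (copSym (copCube t2)))))
    where t2 : Cop t (+ 2)
          t2 = odd⇒cop2 k odd
          eq : w * w + (+ 2 * (r * r * (t * t)) - + 2 * (r * r * r)) * + 2 ≡ t * t * t * (t * t * t)
          eq = lin1 1ℤ curve (solve (r ∷ t ∷ w ∷ []))

  e₂α : e₂ α ≡ + 3 * (t * t * (t * t)) - + 4 * (r * r)
  e₂α = lem
    where lem : e₂⟨ tri (t * t - r) 0ℤ r ⟩ λ e → e ≡ + 3 * (t * t * (t * t)) - + 4 * (r * r)
          lem = solve (r ∷ t ∷ [])

  copDerivative : ∀ g → 0ℤ ≤ g → g ∣ e₂ α → g ∣ w → g ≡ 1ℤ
  -- Eliminating t⁶ gives 4r²(3r - 2t²) = 3w² - t² e₂(α), so g divides 3r - 2t². With X = 2t² the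
  -- curve reads 8w² = X³ - 16Xr² + 32r³, the cubic of `coprime-to-derivative`.
  copDerivative g 0≤g (divides p p≡) g∣w@(divides v v≡) = go (euclid {g} {r} {+ 3 * r - + 2 * (t * t)} gr
      (euclid {g} {r} {r * (+ 3 * r - + 2 * (t * t))} gr (euclid {g} {+ 2} {r * (r * (+ 3 * r - + 2 * (t * t)))} g2
      (euclid {g} {+ 2} {+ 2 * (r * (r * (+ 3 * r - + 2 * (t * t))))} g2
      (divides (+ 3 * (v * g * v) - p * (t * t)) (step p≡ v≡))))))
    where
    gr : Cop g r
    gr = copSym (∣⇒∣g g∣w (copSym copWr))
    g2 : Cop g (+ 2)
    g2 = copSym (∣⇒∣g g∣w (copSym copW2))
    step : e₂ α ≡ p * g → w ≡ v * g → + 2 * (+ 2 * (r * (r * (+ 3 * r - + 2 * (t * t))))) ≡ (+ 3 * (v * g * v) - p * (t * t)) * g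
    step p≡ v≡ = lem (trans (sym e₂α) p≡)
      where
      lem : + 3 * (t * t * (t * t)) - + 4 * (r * r) ≡ p * g →
        + 2 * (+ 2 * (r * (r * (+ 3 * r - + 2 * (t * t))))) ≡ (+ 3 * (v * g * v) - p * (t * t)) * g
      lem p≡ = lin3 (- + 3) (- (t * t)) (+ 3 * (w + v * g)) curve p≡ v≡ (solve (r ∷ t ∷ w ∷ p ∷ v ∷ g ∷ []))
    go : g ∣ + 3 * r - + 2 * (t * t) → g ≡ 1ℤ
    go (divides j j≡) = coprime-to-derivative (+ 8) g r j v 0≤g gr (fin (lem j≡) v≡)
      where
      lem : + 3 * r - + 2 * (t * t) ≡ j * g → + 3 * r - g * j ≡ + 2 * (t * t)
      lem e = lin1 1ℤ e (solve (r ∷ t ∷ g ∷ j ∷ []))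
      fin : + 3 * r - g * j ≡ + 2 * (t * t) → w ≡ v * g → + 8 * (g * v * (g * v)) ≡
        (+ 3 * r - g * j) * (+ 3 * r - g * j) * (+ 3 * r - g * j) - + 16 * ((+ 3 * r - g * j) * (r * r)) + + 32 * (r * r * r)
      fin e f = trans (lem′ f) (cong (λ x → x * x * x - + 16 * (x * (r * r)) + + 32 * (r * r * r)) (sym e))
        where
        lem′ : w ≡ v * g → + 8 * (g * v * (g * v)) ≡ + 2 * (t * t) * (+ 2 * (t * t)) * (+ 2 * (t * t)) - + 16 * (+ 2 * (t * t) * (r * r)) + + 32 * (r * r * r)
        lem′ f = lin2 (+ 8) (- (+ 8 * (w + v * g))) curve f (solve (r ∷ t ∷ w ∷ v ∷ g ∷ []))

  result : SqClass α
  result = squareClass′ α w Nα (N≢0 α w α≢𝟘 Nα) (cop-by-gcd (e₂ α) w copDerivative)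

-- The prime 2 is totally ramified, and θ² - θ has norm 2 and generates the prime above it. For t =
-- 2k and w = 2ω this prime divides t² + r(θ² - 1) twice; with its square removed, the α left over
-- has the odd norm ω².
module EvenCase (r k v ω : ℤ) (h : Cop r (+ 2 * k)) (odd : r ≡ + 2 * v + 1ℤ)
  (curve : ω * ω ≡ + 16 * (k * k * k * (k * k * k)) - + 4 * (r * r * (k * k)) + r * r * r) where
  α : ℤ[θ]
  α = tri (r - + 2 * (k * k)) (+ 2 * (k * k)) 0ℤ

  Nα : N α ≡ ω * ω
  Nα = lem
    where lem : N⟨ tri (r - + 2 * (k * k)) (+ 2 * (k * k)) 0ℤ ⟩ λ n → n ≡ ω * ω
          lem = lin1 -1ℤ curve (solve (r ∷ k ∷ ω ∷ []))

  ω-odd : Cop ω (+ 2)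
  ω-odd = copDivˡ {+ 2} ω ω (copMod {ω * ω} {+ 2} {r * r * r}
      (- (+ 8 * (k * k * k * (k * k * k)) - + 2 * (r * r * (k * k)))) eq (copCube (odd⇒cop2 v odd)))
    where eq : ω * ω + (- (+ 8 * (k * k * k * (k * k * k)) - + 2 * (r * r * (k * k)))) * + 2 ≡ r * r * r
          eq = lin1 1ℤ curve (solve (r ∷ k ∷ ω ∷ []))

  ω≢0 : ω ≢ 0ℤ
  ω≢0 e = even⇒¬cop2 {ω} {+ 2} 0ℤ 1ℤ e refl ω-odd

  copωr : Cop ω r
  copωr = copDivˡ {r} ω ω (copMod {ω * ω} {r} {+ 2 * (+ 2 * (+ 2 * (+ 2 * (k * k * k * (k * k * k)))))}
      (+ 4 * (r * (k * k)) - r * r) eq (copSym (copMul r2 (copMul r2 (copMul r2 (copMul r2 (copMul rk³ rk³)))))))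
    where
    r2 : Cop r (+ 2)
    r2 = copDivʳ (+ 2) k h
    rk : Cop r k
    rk = copDivʳ k (+ 2) (subst (Cop r) (*-comm (+ 2) k) h)
    rk³ : Cop r (k * k * k)
    rk³ = copSym (copCube (copSym rk))
    eq : ω * ω + (+ 4 * (r * (k * k)) - r * r) * r ≡ + 2 * (+ 2 * (+ 2 * (+ 2 * (k * k * k * (k * k * k)))))
    eq = lin1 1ℤ curve (solve (r ∷ k ∷ ω ∷ []))

  e₂α : e₂ α ≡ r * (+ 3 * r - + 8 * (k * k))
  e₂α = lem
    where lem : e₂⟨ tri (r - + 2 * (k * k)) (+ 2 * (k * k)) 0ℤ ⟩ λ e → e ≡ r * (+ 3 * r - + 8 * (k * k))
          lem = solve (r ∷ k ∷ [])

  copDerivative : ∀ g → 0ℤ ≤ g → g ∣ e₂ α → g ∣ ω → g ≡ 1ℤ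
  copDerivative g 0≤g g∣e₂ g∣ω@(divides v v≡) =
    go (euclid {g} {r} {+ 3 * r - + 8 * (k * k)} gr (subst (g ∣_) e₂α g∣e₂))
    where
    gr : Cop g r
    gr = copSym (∣⇒∣g g∣ω (copSym copωr))
    go : g ∣ + 3 * r - + 8 * (k * k) → g ≡ 1ℤ
    -- Now X = 8k², and 32ω² = X³ - 16Xr² + 32r³.
    go (divides j j≡) = coprime-to-derivative (+ 32) g r j v 0≤g gr (fin (lem j≡) v≡)
      where
      lem : + 3 * r - + 8 * (k * k) ≡ j * g → + 3 * r - g * j ≡ + 8 * (k * k)
      lem e = lin1 1ℤ e (solve (r ∷ k ∷ g ∷ j ∷ []))
      fin : + 3 * r - g * j ≡ + 8 * (k * k) → ω ≡ v * g → + 32 * (g * v * (g * v)) ≡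
        (+ 3 * r - g * j) * (+ 3 * r - g * j) * (+ 3 * r - g * j) - + 16 * ((+ 3 * r - g * j) * (r * r)) + + 32 * (r * r * r)
      fin e f = trans (lem′ f) (cong (λ x → x * x * x - + 16 * (x * (r * r)) + + 32 * (r * r * r)) (sym e))
        where
        lem′ : ω ≡ v * g → + 32 * (g * v * (g * v)) ≡ + 8 * (k * k) * (+ 8 * (k * k)) * (+ 8 * (k * k)) - + 16 * (+ 8 * (k * k) * (r * r)) + + 32 * (r * r * r)
        lem′ f = lin2 (+ 32) (- (+ 32 * (ω + v * g))) curve f (solve (r ∷ k ∷ ω ∷ v ∷ g ∷ []))

  -- t² + r (θ² - 1) = (θ² - θ)² (r + 2 (θ - 1) k²) for t = 2k.
  result : SqClass (tri (+ 2 * k * (+ 2 * k) - r) 0ℤ r)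
  result = go (squareClass′ α ω Nα ω≢0 (cop-by-gcd (e₂ α) ω copDerivative))
    where
    π : ℤ[θ]
    π = tri 0ℤ -1ℤ 1ℤ
    factor : ∀ k r → tri (+ 2 * k * (+ 2 * k) - r) 0ℤ r ≡ (tri 0ℤ -1ℤ 1ℤ ⊠ tri 0ℤ -1ℤ 1ℤ) ⊠ tri (r - + 2 * (k * k)) (+ 2 * (k * k)) 0ℤ
    factor k r = tri≡ lem₀ lem₁ lem₂
      where
      lem₀ : ⊠⟨ tri 0ℤ -1ℤ 1ℤ , tri 0ℤ -1ℤ 1ℤ ⟩ λ a b c → ⊠⟨ tri a b c , tri (r - + 2 * (k * k)) (+ 2 * (k * k)) 0ℤ ⟩ λ X Y Z →
        + 2 * k * (+ 2 * k) - r ≡ X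
      lem₀ = solve (k ∷ r ∷ [])
      lem₁ : ⊠⟨ tri 0ℤ -1ℤ 1ℤ , tri 0ℤ -1ℤ 1ℤ ⟩ λ a b c → ⊠⟨ tri a b c , tri (r - + 2 * (k * k)) (+ 2 * (k * k)) 0ℤ ⟩ λ X Y Z → 0ℤ ≡ Y
      lem₁ = solve (k ∷ r ∷ [])
      lem₂ : ⊠⟨ tri 0ℤ -1ℤ 1ℤ , tri 0ℤ -1ℤ 1ℤ ⟩ λ a b c → ⊠⟨ tri a b c , tri (r - + 2 * (k * k)) (+ 2 * (k * k)) 0ℤ ⟩ λ X Y Z → r ≡ Z
      lem₂ = solve (k ∷ r ∷ [])
    go : SqClass α → SqClass (tri (+ 2 * k * (+ 2 * k) - r) 0ℤ r)
    go (sqClass {η} (inj₁ e)) = sqClass {η = π ⊠ η} (inj₁ (trans (factor k r) (trans (cong (π ⊠ π ⊠_) e) (lem π η))))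
      where lem : ∀ p η → p ⊠ p ⊠ (η ⊠ η) ≡ (p ⊠ η) ⊠ (p ⊠ η)
            lem p η = Solver.solve (p ∷ η ∷ []) θring
    go (sqClass {η} (inj₂ e)) = sqClass {η = π ⊠ η} (inj₂ (trans (factor k r) (trans (cong (π ⊠ π ⊠_) e) (lem θ π η))))
      where lem : ∀ t p η → p ⊠ p ⊠ (t ⊠ (η ⊠ η)) ≡ t ⊠ ((p ⊠ η) ⊠ (p ⊠ η))
            lem t p η = Solver.solve (t ∷ p ∷ η ∷ []) θring

curve⇒SqClass : ∀ r t w → Cop r t → Curve r t w → SqClass (tri (t * t - r) 0ℤ r)
curve⇒SqClass r t w h curve = go (parity t)
  where
  go : (∃[ k ] t ≡ + 2 * k) ⊎ (∃[ k ] t ≡ + 2 * k + 1ℤ) → SqClass (tri (t * t - r) 0ℤ r)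
  go (inj₂ (k , e)) = OddCase.result r t w k h curve e
  go (inj₁ (k , refl)) = even (parity r) (parity w)
    where
    even : (∃[ v ] r ≡ + 2 * v) ⊎ (∃[ v ] r ≡ + 2 * v + 1ℤ) → (∃[ ω ] w ≡ + 2 * ω) ⊎ (∃[ ω ] w ≡ + 2 * ω + 1ℤ) →
      SqClass (tri (+ 2 * k * (+ 2 * k) - r) 0ℤ r)
    even (inj₁ (v , e)) _ = ⊥-elim (even⇒¬cop2 {r} {+ 2 * k} v k e refl h)
    even (inj₂ _) (inj₂ (ω , e)) = ⊥-elim (¬mult 1 0 (+ 32 * (k * k * k * (k * k * k)) - + 8 * (r * r * (k * k)) + + 2 * (r * r * r) - + 2 * (ω * ω) - + 2 * ω)
      (ℕ.s≤s ℕ.z≤n) (lin2 -1ℤ (w + + 2 * ω + 1ℤ) curve e (solve (r ∷ k ∷ w ∷ ω ∷ []))))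
    even (inj₂ (v , e)) (inj₁ (ω , f)) = EvenCase.result r k v ω h e (cancelˡ (+ 4) (λ ())
      (lin2 1ℤ (- (w + + 2 * ω)) curve f (solve (r ∷ k ∷ w ∷ ω ∷ []))))

-- Halving: coordinates of the square root

-- The equation for t² is the 2-covering of the curve that belongs to the trivial square class. It
-- arises from the conic be = c² of `Quadrics` by b = m², c = mn, e = n².
record Parameters (r t : ℤ) : Set where
  constructor parameters
  field
    m n : ℤ
    cop : Cop m n
    r≡ : r ≡ m * m * m * m + + 2 * (m * m * m * n) - + 2 * (m * n * n * n)
    t²≡ : t * t ≡ (m * m + n * n) * (m * m + n * n) + + 4 * (m * m * m * n)

-- The squares of the coordinates of η = -(e + c) + bθ + cθ², when b e = c².
record Quadrics (r t b c e : ℤ) : Set where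
  constructor quadrics
  field
    r≡ : r ≡ b * b - + 2 * (c * e) + + 2 * (b * c)
    t²-r≡ : t * t - r ≡ (e + c) * (e + c) + + 2 * (b * c) + c * c
    be≡ : b * e ≡ c * c

module _ {r t : ℤ} (h : Cop r t) where
  quadrics-cop : ∀ {b c e} → Quadrics r t b c e → Cop b e
  quadrics-cop {b} {c} {e} (quadrics r≡ t²-r≡ be) = fin (copMul h h)
    where
    fin : Cop r (t * t) → Cop b e
    fin (x , y , one) = x * (b + + 2 * c) + y * (b + + 2 * c + + 2 * c + e + e) , - (+ 2 * (x * c)) + y * e , trans (lem t²≡) one
      where
      t²≡ : t * t ≡ (e + c) * (e + c) + + 2 * (b * c) + c * c + (b * b - + 2 * (c * e) + + 2 * (b * c))
      t²≡ = lin2 1ℤ 1ℤ t²-r≡ r≡ (solve (r ∷ t ∷ b ∷ c ∷ e ∷ []))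
      lem : t * t ≡ (e + c) * (e + c) + + 2 * (b * c) + c * c + (b * b - + 2 * (c * e) + + 2 * (b * c)) →
        (x * (b + + 2 * c) + y * (b + + 2 * c + + 2 * c + e + e)) * b + (- (+ 2 * (x * c)) + y * e) * e ≡ x * r + y * (t * t)
      lem p = lin3 (- x) (- y) (+ 2 * y) r≡ p be (solve (r ∷ t ∷ b ∷ c ∷ e ∷ x ∷ y ∷ []))

  quadrics-neg : ∀ {b c e} → Quadrics r t b c e → Quadrics r t (- b) (- c) (- e)
  quadrics-neg {b} {c} {e} (quadrics p q s) = quadrics
    (trans p (solve (b ∷ c ∷ e ∷ []))) (trans q (solve (b ∷ c ∷ e ∷ []))) (lin1 1ℤ s (solve (b ∷ c ∷ e ∷ [])))

  fromProduct : ∀ m n → Cop m n → Quadrics r t (m * m) (m * n) (n * n) → Parameters r t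
  fromProduct m n c (quadrics r≡ t²-r≡ _) = parameters m n c
    (lin1 1ℤ r≡ (solve (r ∷ m ∷ n ∷ [])))
    (lin2 1ℤ 1ℤ r≡ t²-r≡ (solve (r ∷ t ∷ m ∷ n ∷ [])))

  fromSquares : ∀ m n c → Quadrics r t (m * m) c (n * n) → Parameters r t
  fromSquares m n c Q@(quadrics _ _ be) = either (noZeroDiv {c - m * n} (c + m * n) eq) minus plus
    where
    cop-mn : Cop m n
    cop-mn = copDivˡ m m (copDivʳ n n (quadrics-cop Q))
    eq : (c + m * n) * (c - m * n) ≡ 0ℤ
    eq = lin1 -1ℤ be (solve (c ∷ m ∷ n ∷ []))
    plus : c - m * n ≡ 0ℤ → Parameters r t
    plus p = fromProduct m n cop-mn (subst (λ c → Quadrics r t (m * m) c (n * n)) (lem p) Q)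
      where lem : c - m * n ≡ 0ℤ → c ≡ m * n
            lem p = lin1 1ℤ p (solve (c ∷ m ∷ n ∷ []))
    minus : c + m * n ≡ 0ℤ → Parameters r t
    minus p = fromProduct m (- n) (copSym (copNeg (subst (λ k → Cop k m) (lem″ n) (copSym cop-mn))))
      (subst₂ (λ c e → Quadrics r t (m * m) c e) (lem p) lem′ Q)
      where lem : c + m * n ≡ 0ℤ → c ≡ m * (- n)
            lem p = lin1 1ℤ p (solve (c ∷ m ∷ n ∷ []))
            lem′ : n * n ≡ (- n) * (- n)
            lem′ = solve (n ∷ [])
            lem″ : ∀ n → n ≡ - (- n)
            lem″ n = solve (n ∷ [])

  fromQuadrics : ∀ b c e → Quadrics r t b c e → Parameters r t
  fromQuadrics b c e Q@(quadrics _ _ be) = go (coprimeSquare {b} {e} {c} cop be)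
    (coprimeSquare {e} {b} {c} (copSym cop) (trans (*-comm e b) be))
    where
    cop : Cop b e
    cop = quadrics-cop Q
    flip : ∀ {b m} → b ≡ - (m * m) → - b ≡ m * m
    flip {m = m} refl = neg-involutive (m * m)
    -- If b = m² and e = -n² then m²n² = -c², so one of them vanishes.
    mixed : ∀ m n → m * m * (- (n * n)) ≡ c * c → m ≡ 0ℤ ⊎ n ≡ 0ℤ
    mixed m n p = noZeroDiv m (0≤-sq⇒≡0 (m * n) (0≤sq c by trans (sym p) (solve (m ∷ n ∷ []))))
    product : ∀ {b e x y} → b * e ≡ c * c → b ≡ x → e ≡ y → x * y ≡ c * c
    product p refl refl = p
    both : ∀ m n → b ≡ m * m → e ≡ n * n → Parameters r t
    both m n p q = fromSquares m n c (subst₂ (λ b e → Quadrics r t b c e) p q Q)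
    neither : ∀ m n → b ≡ - (m * m) → e ≡ - (n * n) → Parameters r t
    neither m n p q = fromSquares m n (- c) (subst₂ (λ b e → Quadrics r t b (- c) e) (flip {m = m} p) (flip {m = n} q) (quadrics-neg Q))
    go : ∃[ m ] (b ≡ m * m ⊎ b ≡ - (m * m)) → ∃[ n ] (e ≡ n * n ⊎ e ≡ - (n * n)) → Parameters r t
    go (m , inj₁ p) (n , inj₁ q) = both m n p q
    go (m , inj₂ p) (n , inj₂ q) = neither m n p q
    go (m , inj₁ p) (n , inj₂ q) = either (mixed m n (product be p q))
      (λ z → neither 0ℤ n (trans p (cong (λ m → m * m) z)) q) (λ z → both m 0ℤ p (trans q (cong (λ n → - (n * n)) z)))
    go (m , inj₂ p) (n , inj₁ q) = either (mixed n m (product (trans (*-comm e b) be) q p))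
      (λ z → neither m 0ℤ p (trans q (cong (λ n → n * n) z))) (λ z → both 0ℤ n (trans p (cong (λ m → - (m * m)) z)) q)

  -- t² + r (θ² - 1) = θ η² is impossible modulo 4.
  notθ : ∀ a b c → t * t - r ≡ b * b + + 2 * (a * c) + + 2 * (b * c) + + 2 * (c * c) →
    a * a + + 2 * (b * c) + c * c + (b * b + + 2 * (a * c) + + 2 * (b * c) + + 2 * (c * c)) ≡ 0ℤ →
    r ≡ + 2 * (a * b) + + 2 * (b * c) + + 2 * (c * c) + (b * b + + 2 * (a * c) + + 2 * (b * c) + + 2 * (c * c)) → ⊥
  -- Let S = t² - r. Then t² = 2S + 2(ab + bc + c²) is even, so r is odd by coprimality, and
  -- therefore b and S are odd. If a is even, then t² ≡ 2 modulo 4; if a is odd, E₁ fails modulo 2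
  -- or 4 according to the parity of c.
  notθ a b c E₀ E₁ E₂ = go (parity t) (parity r) (parity a) (parity b) (parity c)
    where
    Even Odd : ℤ → Set
    Even n = ∃[ k ] n ≡ + 2 * k
    Odd n = ∃[ k ] n ≡ + 2 * k + 1ℤ
    one : ∀ k → + 2 * k ≡ + 1 → ⊥
    one k = ¬mult 1 0 k (ℕ.s≤s ℕ.z≤n)
    two : ∀ k → + 4 * k ≡ + 2 → ⊥
    two k = ¬mult 3 1 k (ℕ.s≤s (ℕ.s≤s ℕ.z≤n))
    go : Even t ⊎ Odd t → Even r ⊎ Odd r → Even a ⊎ Odd a → Even b ⊎ Odd b → Even c ⊎ Odd c → ⊥
    go (inj₁ (k , refl)) (inj₁ (v , refl)) _ _ _ = even⇒¬cop2 {+ 2 * v} {+ 2 * k} v k refl refl h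
    go (inj₂ (k , refl)) _ _ _ _ = one (a * b + b * c + c * c + (b * b + + 2 * (a * c) + + 2 * (b * c) + + 2 * (c * c)) - + 2 * (k * k) - + 2 * k)
      (lin2 -1ℤ -1ℤ E₀ E₂ (solve (r ∷ k ∷ a ∷ b ∷ c ∷ [])))
    go _ (inj₂ (v , refl)) _ (inj₁ (y , refl)) _ =
      one (+ 2 * (a * y) + + 2 * (y * c) + c * c + (+ 2 * (y * y) + a * c + + 2 * (y * c) + c * c) - v) (lin1 -1ℤ E₂ (solve (v ∷ a ∷ y ∷ c ∷ [])))
    go (inj₁ (k , refl)) _ (inj₁ (x , refl)) (inj₂ (y , refl)) (inj₁ (z , refl)) =
      two (k * k - (x * (+ 2 * y + 1ℤ) + + 3 * (z * (+ 2 * y + 1ℤ)) + + 6 * (z * z) + + 2 * (y * y) + + 2 * y + + 4 * (x * z)))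
      (lin2 1ℤ 1ℤ E₀ E₂ (solve (r ∷ k ∷ x ∷ y ∷ z ∷ [])))
    go (inj₁ (k , refl)) _ (inj₁ (x , refl)) (inj₂ (y , refl)) (inj₂ (z , refl)) =
      two (k * k - (x * (+ 2 * y + 1ℤ) + + 6 * (y * z) + + 3 * y + + 3 * z + + 6 * (z * z) + + 6 * z + + 2 * (y * y) + + 2 * y
        + + 2 * (x * (+ 2 * z + 1ℤ)) + + 3))
      (lin2 1ℤ 1ℤ E₀ E₂ (solve (r ∷ k ∷ x ∷ y ∷ z ∷ [])))
    go _ _ (inj₂ (x , refl)) (inj₂ (y , refl)) (inj₂ (z , refl)) =
      one (- (+ 2 * (x * x) + + 2 * x + + 2 * (y * y) + + 2 * y + + 6 * (z * z) + + 6 * z + + 2 * ((+ 2 * y + 1ℤ) * (+ 2 * z + 1ℤ))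
        + (+ 2 * x + 1ℤ) * (+ 2 * z + 1ℤ) + + 2))
      (lin1 -1ℤ E₁ (solve (x ∷ y ∷ z ∷ [])))
    go _ _ (inj₂ (x , refl)) (inj₂ (y , refl)) (inj₁ (z , refl)) =
      two (- (x * x + x + y * y + y + + 3 * (z * z) + + 2 * ((+ 2 * y + 1ℤ) * z) + (+ 2 * x + 1ℤ) * z))
      (lin1 -1ℤ E₁ (solve (x ∷ y ∷ z ∷ [])))

  fromSqClass : SqClass (tri (t * t - r) 0ℤ r) → Parameters r t
  fromSqClass (sqClass {tri a b c} (inj₁ e)) = fromQuadrics b c (- (a + c)) (square (cong c₀ e) (cong c₁ e) (cong c₂ e))
    where
    square : ⊠⟨ tri a b c , tri a b c ⟩ λ A B C → t * t - r ≡ A → 0ℤ ≡ B → r ≡ C → Quadrics r t b c (- (a + c))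
    square p q s = quadrics (lin1 1ℤ s (solve (r ∷ a ∷ b ∷ c ∷ []))) (lin1 1ℤ p (solve (r ∷ t ∷ a ∷ b ∷ c ∷ [])))
      (cancelˡ (+ 2) (λ ()) (lin1 1ℤ q (solve (a ∷ b ∷ c ∷ []))))
  fromSqClass (sqClass {tri a b c} (inj₂ e)) = ⊥-elim (θ-square (cong c₀ e) (cong c₁ e) (cong c₂ e))
    where
    θ-square : ⊠⟨ tri a b c , tri a b c ⟩ λ A B C → ⊠⟨ tri 0ℤ 1ℤ 0ℤ , tri A B C ⟩ λ A′ B′ C′ →
      t * t - r ≡ A′ → 0ℤ ≡ B′ → r ≡ C′ → ⊥
    θ-square p q s = notθ a b c (lin1 1ℤ p (solve (r ∷ t ∷ a ∷ b ∷ c ∷ []))) (lin1 -1ℤ q (solve (a ∷ b ∷ c ∷ [])))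
      (lin1 1ℤ s (solve (r ∷ a ∷ b ∷ c ∷ [])))

-- Denominators of rational points on the modular curve

record Lowest (X D : ℤ) : Set where
  constructor lowest
  field
    g r t w : ℤ
    X≡ : X ≡ g * r
    D≡ : D ≡ g * (t * t)
    cop : Cop r t
    curve : Curve r t w

record SignedSquare (σ E : ℤ) : Set where
  constructor signedSquare
  field
    k : ℤ
    E≡ : E ≡ σ * (k * k)

±1-sq : ∀ d → d ≡ 1ℤ ⊎ d ≡ - 1ℤ → d * d ≡ 1ℤ
±1-sq _ (inj₁ refl) = refl
±1-sq _ (inj₂ refl) = refl

-- The square of Q / E is σE, so Q / E is a rational root of an integer and hence an integer.
cube≡±square : ∀ E Q σ → E ≢ 0ℤ → σ * σ ≡ 1ℤ → E * E * E ≡ σ * (Q * Q) → SignedSquare σ E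
cube≡±square E Q σ E≢0 σσ e = go (reduce Q E)
  where
  go : Reduced Q E → SignedSquare σ E
  go (reduced {g} {q} {d} 0≤g Q≡ E≡ cop) = finish (d∣1 q²)
    where
    g≢0 : g ≢ 0ℤ
    g≢0 refl = E≢0 E≡
    eq : g * (g * (g * (d * d * d))) ≡ g * (g * (σ * (q * q)))
    eq = lem Q≡ E≡
      where lem : Q ≡ g * q → E ≡ g * d → g * (g * (g * (d * d * d))) ≡ g * (g * (σ * (q * q)))
            lem refl refl = lin1 1ℤ e (solve (g ∷ d ∷ σ ∷ q ∷ []))
    gd³ : g * (d * d * d) ≡ σ * (q * q)
    gd³ = cancelˡ g g≢0 (cancelˡ g g≢0 eq)
    q² : q * (q * 1ℤ) ≡ σ * g * d * d * d
    q² = lin2 (- σ) (- (q * q)) gd³ σσ (solve (g ∷ d ∷ σ ∷ q ∷ []))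
    d∣1 : q * (q * 1ℤ) ≡ σ * g * d * d * d → d ∣ 1ℤ
    d∣1 p = euclid {d} {q} {1ℤ} (copSym cop) (euclid {d} {q} {q * 1ℤ} (copSym cop) (divides (σ * g * d * d) p))
    finish : d ∣ 1ℤ → SignedSquare σ E
    finish (divides x p) = signedSquare q (lin3 1ℤ 1ℤ (- (g * d)) E≡ gd³ dd (solve (E ∷ g ∷ d ∷ σ ∷ q ∷ [])))
      where dd : d * d ≡ 1ℤ
            dd = ±1-sq d (unit {x} d (trans (*-comm d x) (sym p)))

-- Denominators on a Weierstrass equation are t² and t³: with x = R / E and y = P / Q reduced, E³
-- and Q² divide each other. Reduced denominators may be negative here, and the resulting sign σ is
-- moved into g and r.
lowestTerms : ∀ X D A B → D ≢ 0ℤ → B ≢ 0ℤ → A * (A + B) * (D * D * D) ≡ B * B * (X * X * (X - D)) → Lowest X D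
lowestTerms X D A B D≢0 B≢0 e = go (reduce X D) (reduce A B)
  where
  go : Reduced X D → Reduced A B → Lowest X D
  go (reduced {h} {R} {E} _ X≡ D≡ copRE) (reduced {k} {P} {Q} _ A≡ B≡ copPQ) =
    signs (∣-antisym± E³∣Q² Q²∣E³)
    where
    h≢0 : h ≢ 0ℤ
    h≢0 refl = D≢0 D≡
    k≢0 : k ≢ 0ℤ
    k≢0 refl = B≢0 B≡
    E≢0 : E ≢ 0ℤ
    E≢0 refl = D≢0 (trans D≡ (*-zeroʳ h))
    eq : P * (P + Q) * (E * E * E) ≡ Q * Q * (R * R * (R - E))
    eq = cancelˡ h h≢0 (cancelˡ h h≢0 (cancelˡ h h≢0 (cancelˡ k k≢0 (cancelˡ k k≢0 (lem X≡ D≡ A≡ B≡)))))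
      where
      lem : X ≡ h * R → D ≡ h * E → A ≡ k * P → B ≡ k * Q →
        k * (k * (h * (h * (h * (P * (P + Q) * (E * E * E)))))) ≡ k * (k * (h * (h * (h * (Q * Q * (R * R * (R - E)))))))
      lem refl refl refl refl = lin1 1ℤ e (solve (h ∷ k ∷ R ∷ E ∷ P ∷ Q ∷ []))
    copE : Cop E (R * R * (R - E))
    copE = copMul (copMul (copSym copRE) (copSym copRE)) (copSym (copMod {R - E} {E} {R} 1ℤ (solve (R ∷ E ∷ [])) copRE))
    copQ : Cop Q (P * (P + Q))
    copQ = copMul (copSym copPQ) (copSym (copMod {P + Q} {Q} {P} -1ℤ (solve (P ∷ Q ∷ [])) copPQ))
    E³∣Q² : E * E * E ∣ Q * Q
    E³∣Q² = euclid {E * E * E} {R * R * (R - E)} {Q * Q} (copCube copE)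
      (divides (P * (P + Q)) (trans (*-comm (R * R * (R - E)) (Q * Q)) (sym eq)))
    Q²∣E³ : Q * Q ∣ E * E * E
    Q²∣E³ = euclid {Q * Q} {P * (P + Q)} {E * E * E} (copSym (copMul (copSym copQ) (copSym copQ)))
      (divides (R * R * (R - E)) (trans eq (*-comm (Q * Q) (R * R * (R - E)))))
    Q≢0 : Q ≢ 0ℤ
    Q≢0 refl = B≢0 (trans B≡ (*-zeroʳ k))
    build : ∀ σ → σ * σ ≡ 1ℤ → E * E * E ≡ σ * (Q * Q) → SignedSquare σ E → Lowest X D
    build σ σσ E³ (signedSquare t E≡) = lowest (σ * h) (σ * R) t (+ 2 * P + Q)
      (lin2 1ℤ (- (h * R)) X≡ σσ (solve (X ∷ h ∷ R ∷ σ ∷ [])))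
      (lin2 1ℤ h D≡ E≡ (solve (D ∷ h ∷ E ∷ σ ∷ t ∷ [])))
      (copSym (copMul {t} {σ} {R} (copSym cop-σt) (copSym copRt)))
      (curve E≡)
      where
      cop-σt : Cop σ t
      cop-σt = σ , 0ℤ , lin1 1ℤ σσ (solve (σ ∷ t ∷ []))
      copRt : Cop R t
      copRt = copDivʳ t (σ * t) (subst (Cop R) (lem E≡) copRE)
        where lem : E ≡ σ * (t * t) → E ≡ t * (σ * t)
              lem p = lin1 1ℤ p (solve (E ∷ σ ∷ t ∷ []))
      PP : σ * (P * (P + Q)) ≡ R * R * (R - E)
      PP = cancelˡ Q Q≢0 (cancelˡ Q Q≢0 (lin2 1ℤ (- (P * (P + Q))) eq E³ (solve (σ ∷ P ∷ Q ∷ R ∷ E ∷ []))))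
      curve : E ≡ σ * (t * t) → Curve (σ * R) t (+ 2 * P + Q)
      curve refl = trans (lem P Q R σ t) (trans (cong₂ (λ x y → + 4 * x + y) PP′ QQ) (lem″ σσ))
        where
        PP′ : P * (P + Q) ≡ σ * (R * R * (R - σ * (t * t)))
        PP′ = lin2 σ (- (P * (P + Q))) PP σσ (solve (σ ∷ P ∷ Q ∷ R ∷ t ∷ []))
        QQ : Q * Q ≡ σ * (σ * (t * t) * (σ * (t * t)) * (σ * (t * t)))
        QQ = lin2 (- σ) (- (Q * Q)) E³ σσ (solve (σ ∷ Q ∷ t ∷ []))
        lem : ∀ P Q R σ t → (+ 2 * P + Q) * (+ 2 * P + Q) ≡ + 4 * (P * (P + Q)) + Q * Q
        lem P Q R σ t = solve (P ∷ Q ∷ [])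
        lem″ : σ * σ ≡ 1ℤ → + 4 * (σ * (R * R * (R - σ * (t * t)))) + σ * (σ * (t * t) * (σ * (t * t)) * (σ * (t * t)))
          ≡ t * t * (t * t) * (t * t) - + 4 * (σ * R * (σ * R) * (t * t)) + + 4 * (σ * R * (σ * R) * (σ * R))
        lem″ p = lin1 (t * t * (t * t) * (t * t) * (σ * σ + 1ℤ) - + 4 * (σ * (R * R * R))) p (solve (σ ∷ R ∷ t ∷ []))
    signs : E * E * E ≡ Q * Q ⊎ E * E * E ≡ - (Q * Q) → Lowest X D
    signs (inj₁ p) = build 1ℤ refl q (cube≡±square E Q 1ℤ E≢0 refl q)
      where q : E * E * E ≡ 1ℤ * (Q * Q)
            q = trans p (sym (*-identityˡ (Q * Q)))
    signs (inj₂ p) = build -1ℤ refl q (cube≡±square E Q -1ℤ E≢0 refl q)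
      where q : E * E * E ≡ -1ℤ * (Q * Q)
            q = trans p (sym (-1*i≡-i (Q * Q)))

-- Heights and infinite descent

1≤sq : ∀ n → n ≢ 0ℤ → 0ℤ ≤ n * n - 1ℤ
1≤sq n n≢0 = either (0≤⊎0< (n * n - 1ℤ)) (λ p → p) λ p → ⊥-elim (n≢0 (0≤-sq⇒≡0 n (p by solve (n ∷ []))))

0≤cancel : ∀ g x → 0ℤ ≤ g - 1ℤ → 0ℤ ≤ g * x → 0ℤ ≤ x
0≤cancel g x p q = either (0≤⊎0< x) (λ h → h) λ h → ⊥-elim (absurd (neg h))
  where
  neg : 0ℤ ≤ - x - 1ℤ → 0ℤ ≤ - 1ℤ
  neg h = p ⊗ (h ⊕ 0≤n 1) ⊕ q ⊕ h by solve (g ∷ x ∷ [])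
  absurd : 0ℤ ≤ - 1ℤ → ⊥
  absurd ()

0≤2+1 : ∀ x → 0ℤ ≤ + 2 * x + 1ℤ → 0ℤ ≤ x
0≤2+1 x p = 0≤4+3 x (p ⊕ p ⊕ 0≤n 1 by solve (x ∷ []))

-- These are r and t² for m and n of opposite signs, x = |m| and y = |n|. The gain is chosen so that
-- 2(r + t² - 1 - m² + U) + 1 = gain + 2t² + (2U + m² + n²), where the last two terms are
-- nonnegative.
rₓ⟨_,_⟩_ Tₓ⟨_,_⟩_ gain⟨_,_⟩_ : ∀ {ℓ} {A : Set ℓ} → ℤ → ℤ → (ℤ → A) → A
rₓ⟨ x , y ⟩ k = k (x * x * x * x - + 2 * (x * x * x * y) + + 2 * (x * y * y * y))
Tₓ⟨ x , y ⟩ k = k ((x * x + y * y) * (x * x + y * y) - + 4 * (x * x * x * y))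
gain⟨ x , y ⟩ k = rₓ⟨ x , y ⟩ λ r → k (+ 2 * r - + 3 * (x * x) - y * y - 1ℤ)

rₓ Tₓ : ℤ → ℤ → ℤ
rₓ x y = rₓ⟨ x , y ⟩ λ r → r
Tₓ x y = Tₓ⟨ x , y ⟩ λ t → t

0≤gain⟨_,_⟩ : ℤ → ℤ → Set
0≤gain⟨ x , y ⟩ = gain⟨ x , y ⟩ λ g → 0ℤ ≤ g

gain-below : ∀ a k → 0ℤ ≤ a → 0ℤ ≤ k → 0≤gain⟨ 1ℤ + a , 1ℤ + a + (1ℤ + k) ⟩
gain-below a k pa pk = 0≤n 2 ⊗ pa ⊗ pa ⊗ pa ⊗ pa ⊕ 0≤n 8 ⊗ pa ⊗ pa ⊗ pa ⊗ pk ⊕ 0≤n 12 ⊗ pa ⊗ pa ⊗ pk ⊗ pk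
   ⊕ 0≤n 4 ⊗ pa ⊗ pk ⊗ pk ⊗ pk ⊕ 0≤n 16 ⊗ pa ⊗ pa ⊗ pa ⊕ 0≤n 48 ⊗ pa ⊗ pa ⊗ pk
   ⊕ 0≤n 36 ⊗ pa ⊗ pk ⊗ pk ⊕ 0≤n 4 ⊗ pk ⊗ pk ⊗ pk ⊕ 0≤n 44 ⊗ pa ⊗ pa ⊕ 0≤n 82 ⊗ pa ⊗ pk
   ⊕ 0≤n 23 ⊗ pk ⊗ pk ⊕ 0≤n 50 ⊗ pa ⊕ 0≤n 40 ⊗ pk ⊕ 0≤n 18 by solve (a ∷ k ∷ [])

gain-above : ∀ a k → 0ℤ ≤ a → 0ℤ ≤ k → 0≤gain⟨ 1ℤ + + 3 * (1ℤ + a) + k , 1ℤ + a ⟩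
gain-above a k pa pk = 0≤n 66 ⊗ pa ⊗ pa ⊗ pa ⊗ pa ⊕ 0≤n 112 ⊗ pa ⊗ pa ⊗ pa ⊗ pk ⊕ 0≤n 72 ⊗ pa ⊗ pa ⊗ pk ⊗ pk
   ⊕ 0≤n 20 ⊗ pa ⊗ pk ⊗ pk ⊗ pk ⊕ 0≤n 2 ⊗ pk ⊗ pk ⊗ pk ⊗ pk ⊕ 0≤n 376 ⊗ pa ⊗ pa ⊗ pa
   ⊕ 0≤n 480 ⊗ pa ⊗ pa ⊗ pk ⊕ 0≤n 204 ⊗ pa ⊗ pk ⊗ pk ⊕ 0≤n 28 ⊗ pk ⊗ pk ⊗ pk ⊕ 0≤n 776 ⊗ pa ⊗ pa
   ⊕ 0≤n 666 ⊗ pa ⊗ pk ⊕ 0≤n 141 ⊗ pk ⊗ pk ⊕ 0≤n 690 ⊗ pa ⊕ 0≤n 300 ⊗ pk ⊕ 0≤n 222 by solve (a ∷ k ∷ [])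

-- T = (x - y)(x²(x - 3y) - xy² - y³) is negative for y < x ≤ 3y. This is the range in which the
-- gain may be negative, and there T cannot be the square t².
T-between : ∀ a b j → 0ℤ ≤ a → 0ℤ ≤ b → 0ℤ ≤ j → + 2 * (1ℤ + a) ≡ 1ℤ + b + j →
  Tₓ⟨ 1ℤ + (1ℤ + a) + b , 1ℤ + a ⟩ λ t → 0ℤ ≤ - t - 1ℤ
T-between a b j pa pb pj e = (0≤n 1 ⊕ pb) ⊗ (0≤n 1 ⊕ pb) ⊗ pj ⊗ (0≤n 3 ⊕ 0≤n 2 ⊗ pa ⊕ pb)
  ⊕ (0≤n 4 ⊗ pa ⊗ pa ⊗ pa ⊗ pb ⊕ 0≤n 4 ⊗ pa ⊗ pa ⊗ pa ⊕ 0≤n 12 ⊗ pa ⊗ pa ⊗ pb ⊕ 0≤n 12 ⊗ pa ⊗ pa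
   ⊕ 0≤n 12 ⊗ pa ⊗ pb ⊕ 0≤n 12 ⊗ pa ⊕ 0≤n 4 ⊗ pb ⊕ 0≤n 3)
  by lin1 (- ((1ℤ + b) * (1ℤ + b) * (+ 3 + + 2 * a + b))) e (solve (a ∷ b ∷ j ∷ []))

-- x and y stand for the absolute values of m and n, which have opposite signs.
0≤gain : ∀ x y → 0ℤ ≤ x - 1ℤ → 0ℤ ≤ y - 1ℤ → x ≢ y → 0ℤ ≤ Tₓ x y → 0≤gain⟨ x , y ⟩
0≤gain x y px py x≢y 0≤T = go (compare x y) (compare x (+ 3 * y))
  where
  pred : ∀ z → z ≡ 1ℤ + (z - 1ℤ)
  pred z = solve (z ∷ [])
  below : ∀ d → 0ℤ ≤ d → y ≡ x + d → 0≤gain⟨ x , y ⟩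
  below d pd e = either (0≤⊎0< (d - 1ℤ))
    (λ q → subst₂ (λ x y → 0≤gain⟨ x , y ⟩) (sym (pred x)) (sym (trans e (cong₂ _+_ (pred x) (pred d)))) (gain-below (x - 1ℤ) (d - 1ℤ) px q))
    λ q → ⊥-elim (x≢y (sym (trans e (trans (cong (λ d → x + d) (≡0⇐0≤± pd (vanish q))) (+-identityʳ x)))))
    where vanish : 0ℤ ≤ - (d - 1ℤ) - 1ℤ → 0ℤ ≤ - d
          vanish q = q by solve (d ∷ [])
  above : ∀ k → 0ℤ ≤ k → x ≡ 1ℤ + + 3 * y + k → 0≤gain⟨ x , y ⟩
  above k pk e = subst₂ (λ x y → 0≤gain⟨ x , y ⟩) (sym (trans e (cong (λ y → 1ℤ + + 3 * y + k) (pred y)))) (sym (pred y))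
    (gain-above (y - 1ℤ) k py pk)
  between : ∀ b j → 0ℤ ≤ b → 0ℤ ≤ j → x ≡ 1ℤ + y + b → + 3 * y ≡ x + j → ⊥
  between b j pb pj e f = ¬0≤-1- 0≤T (subst₂ (λ x y → 0ℤ ≤ - Tₓ x y - 1ℤ)
    (sym (trans e (cong (λ y → 1ℤ + y + b) (pred y)))) (sym (pred y)) (T-between (y - 1ℤ) b j py pb pj (eq e f)))
    where eq : x ≡ 1ℤ + y + b → + 3 * y ≡ x + j → + 2 * (1ℤ + (y - 1ℤ)) ≡ 1ℤ + b + j
          eq e f = lin2 1ℤ 1ℤ e f (solve (x ∷ y ∷ b ∷ j ∷ []))
  go : Split x y → Split x (+ 3 * y) → 0≤gain⟨ x , y ⟩
  go (split {d} pd (inj₁ e)) _ = below d pd e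
  go (split {b} pb (inj₂ e)) (split {j} pj (inj₁ f)) = ⊥-elim (between b j pb pj e f)
  go _ (split {k} pk (inj₂ f)) = above k pk f

-- The height of r / t² is |r| + t². Both candidates for ρ are at most this height, and the two
-- drops together say |U| + m² < ρ.
record HeightDrop (r T m U : ℤ) : Set where
  constructor heightDrop
  field
    {ρ} : ℤ
    which : ρ ≡ T ⊎ ρ ≡ r + T
    drop⁺ : 0ℤ ≤ ρ - 1ℤ - m * m + U
    drop⁻ : 0ℤ ≤ ρ - 1ℤ - m * m - U

-- Put τ = 2U + m² + n² ≥ 0. For U ≥ 0 the square T = τ² alone exceeds |U| + m². For U < 0 the
-- relation U(τ - U) = m³n forces m and n to have opposite signs, and r + T is compared instead.
dropHeight : ∀ r T m n U → m ≢ 0ℤ → n ≢ 0ℤ → m + n ≢ 0ℤ → 0ℤ ≤ + 2 * U + (m * m + n * n) →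
  r ≡ m * m * m * m + + 2 * (m * m * m * n) - + 2 * (m * n * n * n) →
  T ≡ (m * m + n * n) * (m * m + n * n) + + 4 * (m * m * m * n) →
  T ≡ (+ 2 * U + (m * m + n * n)) * (+ 2 * U + (m * m + n * n)) → HeightDrop r T m U
dropHeight r T m n U m≢0 n≢0 m+n≢0 0≤τ r≡ T≡ T≡τ² = go (0≤⊎0< U)
  where
  m²≥1 : 0ℤ ≤ m * m - 1ℤ
  m²≥1 = 1≤sq m m≢0
  n²≥1 : 0ℤ ≤ n * n - 1ℤ
  n²≥1 = 1≤sq n n≢0
  0≤T : 0ℤ ≤ T
  0≤T = 0≤sq (+ 2 * U + (m * m + n * n)) by sym T≡τ²
  nonneg : 0ℤ ≤ U → HeightDrop r T m U
  nonneg pU = heightDrop {ρ = T} (inj₁ refl)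
    (base ⊕ pU ⊕ pU by lem″ (T - 1ℤ - m * m) U) base
    where
    lem″ : ∀ x u → x - u + u + u ≡ x + u
    lem″ x u = solve (x ∷ u ∷ [])
    base : 0ℤ ≤ T - 1ℤ - m * m - U
    base = (m²≥1 ⊕ n²≥1 ⊕ 0≤n 2) ⊗ (m²≥1 ⊕ n²≥1 ⊕ 0≤n 1) ⊕ n²≥1 ⊕ 0≤n 4 ⊗ (pU ⊗ pU) ⊕ (0≤n 4 ⊗ (m²≥1 ⊕ n²≥1) ⊕ 0≤n 7) ⊗ pU
      by lin1 -1ℤ T≡τ² (solve (T ∷ m ∷ n ∷ U ∷ []))
  opposite : 0ℤ ≤ - U - 1ℤ → ∀ x y → 0ℤ ≤ x - 1ℤ → 0ℤ ≤ y - 1ℤ → x ≢ y → m * m ≡ x * x → n * n ≡ y * y →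
    r ≡ rₓ x y → T ≡ Tₓ x y → HeightDrop r T m U
  opposite pU x y px py x≢y m² n² r≡ T≡ = heightDrop {ρ = r + T} (inj₂ refl) base (base ⊕ 0≤n 2 ⊗ (pU ⊕ 0≤n 1) by lem″ (r + T - 1ℤ - m * m) U)
    where
    lem″ : ∀ x u → x + u + + 2 * (- u - 1ℤ + + 1) ≡ x - u
    lem″ x u = solve (x ∷ u ∷ [])
    lem : m * m ≡ x * x → n * n ≡ y * y → rₓ⟨ x , y ⟩ λ r′ → r ≡ r′ →
      gain⟨ x , y ⟩ λ g → g + + 2 * T + (+ 2 * U + (m * m + n * n)) ≡ + 2 * (r + T - 1ℤ - m * m + U) + 1ℤ
    lem p q s = lin3 (+ 3) 1ℤ (- + 2) p q s (solve (r ∷ T ∷ m ∷ n ∷ U ∷ x ∷ y ∷ []))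
    base : 0ℤ ≤ r + T - 1ℤ - m * m + U
    base = 0≤2+1 (r + T - 1ℤ - m * m + U) (0≤gain x y px py x≢y (0≤T by T≡) ⊕ 0≤n 2 ⊗ 0≤T ⊕ 0≤τ by lem m² n² r≡)
  same : 0ℤ ≤ - U - 1ℤ → 0ℤ ≤ m * m * m * n → ⊥
  same pU p = ¬0≤-1- p ((pU ⊗ (0≤τ ⊕ pU ⊕ 0≤n 1)) ⊕ 0≤τ ⊕ pU by lem T≡ T≡τ²)
    where
    lem : T ≡ (m * m + n * n) * (m * m + n * n) + + 4 * (m * m * m * n) →
      T ≡ (+ 2 * U + (m * m + n * n)) * (+ 2 * U + (m * m + n * n)) →
      (- U - 1ℤ) * (+ 2 * U + (m * m + n * n) + (- U - 1ℤ) + + 1) + (+ 2 * U + (m * m + n * n)) + (- U - 1ℤ) ≡ - (m * m * m * n) - 1ℤ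
    lem p q = cancelˡ (+ 4) (λ ()) (lin2 -1ℤ 1ℤ p q (solve (T ∷ m ∷ n ∷ U ∷ [])))
  ≥1 : ∀ x → x ≢ 0ℤ → 0ℤ ≤ x → 0ℤ ≤ x - 1ℤ
  ≥1 x x≢0 p = either (0≤⊎0< (x - 1ℤ)) (λ q → q) λ q → ⊥-elim (x≢0 (≡0⇐0≤± p (lem q)))
    where lem : 0ℤ ≤ - (x - 1ℤ) - 1ℤ → 0ℤ ≤ - x
          lem q = q by solve (x ∷ [])
  weaken : ∀ x → 0ℤ ≤ - x - 1ℤ → 0ℤ ≤ - x
  weaken x p = p ⊕ 0≤n 1 by solve (x ∷ [])
  negative : 0ℤ ≤ - U - 1ℤ → 0ℤ ≤ m ⊎ 0ℤ ≤ - m - 1ℤ → 0ℤ ≤ n ⊎ 0ℤ ≤ - n - 1ℤ → HeightDrop r T m U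
  negative pU (inj₁ p) (inj₁ q) = ⊥-elim (same pU (p ⊗ p ⊗ p ⊗ q))
  negative pU (inj₂ p) (inj₂ q) = ⊥-elim (same pU (weaken m p ⊗ weaken m p ⊗ weaken m p ⊗ weaken n q by solve (m ∷ n ∷ [])))
  negative pU (inj₁ p) (inj₂ q) = opposite pU m (- n) (≥1 m m≢0 p) q
    (λ e → m+n≢0 (lin1 1ℤ e (solve (m ∷ n ∷ [])))) refl (solve (n ∷ []))
    (trans r≡ r-lem) (trans T≡ T-lem)
    where
    r-lem : rₓ⟨ m , - n ⟩ λ r → m * m * m * m + + 2 * (m * m * m * n) - + 2 * (m * n * n * n) ≡ r
    r-lem = solve (m ∷ n ∷ [])
    T-lem : Tₓ⟨ m , - n ⟩ λ t → (m * m + n * n) * (m * m + n * n) + + 4 * (m * m * m * n) ≡ t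
    T-lem = solve (m ∷ n ∷ [])
  negative pU (inj₂ p) (inj₁ q) = opposite pU (- m) n p (≥1 n n≢0 q)
    (λ e → m+n≢0 (lin1 -1ℤ e (solve (m ∷ n ∷ [])))) (solve (m ∷ [])) refl
    (trans r≡ r-lem) (trans T≡ T-lem)
    where
    r-lem : rₓ⟨ - m , n ⟩ λ r → m * m * m * m + + 2 * (m * m * m * n) - + 2 * (m * n * n * n) ≡ r
    r-lem = solve (m ∷ n ∷ [])
    T-lem : Tₓ⟨ - m , n ⟩ λ t → (m * m + n * n) * (m * m + n * n) + + 4 * (m * m * m * n) ≡ t
    T-lem = solve (m ∷ n ∷ [])
  go : 0ℤ ≤ U ⊎ 0ℤ ≤ - U - 1ℤ → HeightDrop r T m U
  go (inj₁ p) = nonneg p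
  go (inj₂ p) = negative p (0≤⊎0< m) (0≤⊎0< n)

-- The rational points form a cyclic group of order 5: the point at infinity, two points with x = 0
-- and two with x = 1.
data Torsion (r t : ℤ) : Set where
  at-∞ : t ≡ 0ℤ → Torsion r t
  at-0 : r ≡ 0ℤ → Torsion r t
  at-1 : r ≡ t * t → Torsion r t

-- From t² = (m² + n²)² + 4 m³ n one gets U² + U (m² + n²) = m³ n with t = 2U + m² + n², and
-- the point with x-coordinate -U/m² is a half of the point with x-coordinate r/t².
halfPoint : ∀ r t → Parameters r t → Torsion r t ⊎
  (∃[ m ] ∃[ n ] ∃[ U ] (m ≢ 0ℤ × n ≢ 0ℤ × m + n ≢ 0ℤ × HeightDrop r (t * t) m U × U * U + U * (m * m + n * n) ≡ m * m * m * n))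
halfPoint r t (parameters m n c r≡ T≡) = go (m ≟ 0ℤ) (n ≟ 0ℤ) (m + n ≟ 0ℤ)
  where
  Goal : Set
  Goal = Torsion r t ⊎ (∃[ m ] ∃[ n ] ∃[ U ] (m ≢ 0ℤ × n ≢ 0ℤ × m + n ≢ 0ℤ × HeightDrop r (t * t) m U × U * U + U * (m * m + n * n) ≡ m * m * m * n))
  τ : ℤ
  τ = + abs t
  0≤τ : 0ℤ ≤ τ
  0≤τ = 0≤n (abs t)
  abs² : ∀ t → t * t ≡ + abs t * + abs t
  abs² (+ n) = refl
  abs² -[1+ n ] = refl
  halve : ∀ τ → 0ℤ ≤ τ → t * t ≡ τ * τ → m ≢ 0ℤ → n ≢ 0ℤ → m + n ≢ 0ℤ → Goal
  halve τ 0≤τ T≡τ² m≢0 n≢0 m+n≢0 = split-parity (parity (τ - (m * m + n * n)))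
    where
    split-parity : (∃[ U ] τ - (m * m + n * n) ≡ + 2 * U) ⊎ (∃[ U ] τ - (m * m + n * n) ≡ + 2 * U + 1ℤ) → Goal
    split-parity (inj₁ (U , e)) = inj₂ (m , n , U , m≢0 , n≢0 , m+n≢0 ,
      dropHeight r (t * t) m n U m≢0 n≢0 m+n≢0 (0≤τ by τ≡ e) r≡ T≡ (trans T≡τ² (cong (λ x → x * x) (τ≡ e))) ,
      cancelˡ (+ 4) (λ ()) (lin3 1ℤ -1ℤ (- (τ + + 2 * U + (m * m + n * n))) T≡ T≡τ² e (solve (t ∷ τ ∷ m ∷ n ∷ U ∷ []))))
      where
      τ≡ : τ - (m * m + n * n) ≡ + 2 * U → τ ≡ + 2 * U + (m * m + n * n)
      τ≡ e = lin1 1ℤ e (solve (τ ∷ m ∷ n ∷ U ∷ []))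
    -- τ² and (m² + n²)² differ by 4m³n, so τ and m² + n² have the same parity.
    split-parity (inj₂ (U , e)) = ⊥-elim (¬mult 1 0
      (+ 2 * (m * m * m * n) - (+ 2 * U * U + + 2 * U + (+ 2 * U + 1ℤ) * (m * m + n * n))) (ℕ.s≤s ℕ.z≤n)
      (lin3 -1ℤ 1ℤ (τ + + 2 * U + 1ℤ + (m * m + n * n)) T≡ T≡τ² e (solve (t ∷ τ ∷ m ∷ n ∷ U ∷ []))))
  go : Dec (m ≡ 0ℤ) → Dec (n ≡ 0ℤ) → Dec (m + n ≡ 0ℤ) → Goal
  go (yes refl) _ _ = inj₁ (at-0 r≡)
  go (no _) (yes refl) _ = inj₁ (at-1 (lin2 1ℤ -1ℤ r≡ T≡ (solve (r ∷ t ∷ m ∷ []))))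
  go (no _) (no _) (yes e) = inj₁ (at-∞ (sq≡0 t (lin2 1ℤ (m * m * m + + 3 * (m * m * n) - m * n * n + n * n * n) T≡ e (solve (t ∷ m ∷ n ∷ [])))))
  go (no p) (no q) (no s) = halve τ 0≤τ (abs² t) p q s

-- A point outside the list would have a half of smaller height, which is in the list by induction;
-- `impossible` refutes this because m, n, m + n and U do not vanish. The height bound is carried as
-- separate bounds for r + t² and -r + t², which avoids absolute values.
torsion : ∀ r t w → Cop r t → Curve r t w → Torsion r t
torsion r t w h c = descend (abs (r + t * t) ℕ.+ abs (- r + t * t)) r t w h c
  (bound (abs (r + t * t)) (abs (- r + t * t)) (r + t * t) (below-abs (r + t * t)))
  (subst (λ k → 0ℤ ≤ + k - (- r + t * t)) (ℕ.+-comm (abs (- r + t * t)) (abs (r + t * t)))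
    (bound (abs (- r + t * t)) (abs (r + t * t)) (- r + t * t) (below-abs (- r + t * t))))
  where
  below-abs : ∀ x → 0ℤ ≤ + abs x - x
  below-abs (+ n) = 0≤n 0 by sym (+-inverseʳ (+ n))
  below-abs -[1+ n ] = 0≤n (suc n ℕ.+ suc n)
  bound : ∀ m n x → 0ℤ ≤ + m - x → 0ℤ ≤ + (m ℕ.+ n) - x
  bound m n x p = p ⊕ 0≤n n by lem (+ m) (+ n)
    where lem : ∀ m n → m - x + n ≡ (m + n) - x
          lem m n = solve (m ∷ n ∷ x ∷ [])
  descend : ∀ f r t w → Cop r t → Curve r t w → 0ℤ ≤ + f - (r + t * t) → 0ℤ ≤ + f - (- r + t * t) → Torsion r t
  descend zero r t w h c b₁ b₂ = at-∞ (0≤-sq⇒≡0 t (0≤cancel (+ 2) (- (t * t)) (0≤n 1) (b₁ ⊕ b₂ by solve (r ∷ t ∷ []))))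
  descend (suc f) r t w h c b₁ b₂ = either (halfPoint r t (fromSqClass h (curve⇒SqClass r t w h c))) (λ p → p)
    λ (m , n , U , m≢0 , n≢0 , m+n≢0 , drop , e) → next m n U m≢0 n≢0 m+n≢0 drop e
    where
    next : ∀ m n U → m ≢ 0ℤ → n ≢ 0ℤ → m + n ≢ 0ℤ → HeightDrop r (t * t) m U → U * U + U * (m * m + n * n) ≡ m * m * m * n → Torsion r t
    -- The half is the point x = -U / m², y = (nU - m³) / m³ of y² + y = x³ - x².
    next m n U m≢0 n≢0 m+n≢0 drop e = finish (lowestTerms (- U) (m * m) (n * U - m * m * m) (m * m * m) m²≢0 m³≢0
        (lin1 (m * m * m * (m * m * m) * U) e (solve (m ∷ n ∷ U ∷ []))))
      where
      m²≢0 : m * m ≢ 0ℤ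
      m²≢0 p = m≢0 (sq≡0 m p)
      m³≢0 : m * m * m ≢ 0ℤ
      m³≢0 p = either (noZeroDiv (m * m) p) m²≢0 m≢0
      smaller : ∀ {ρ} → ρ ≡ t * t ⊎ ρ ≡ r + t * t → 0ℤ ≤ + suc f - ρ
      smaller (inj₁ refl) = 0≤cancel (+ 2) (+ suc f - t * t) (0≤n 1) (b₁ ⊕ b₂ by lem (+ suc f))
        where lem : ∀ f → f - (r + t * t) + (f - (- r + t * t)) ≡ + 2 * (f - t * t)
              lem f = solve (f ∷ r ∷ t ∷ [])
      smaller (inj₂ refl) = b₁
      bound⁺ : HeightDrop r (t * t) m U → 0ℤ ≤ + f - (- U + m * m)
      bound⁺ (heightDrop {ρ} s d⁺ d⁻) = smaller s ⊕ d⁺ by lem (+ f)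
        where lem : ∀ f → 1ℤ + f - ρ + (ρ - 1ℤ - m * m + U) ≡ f - (- U + m * m)
              lem f = solve (f ∷ ρ ∷ m ∷ U ∷ [])
      bound⁻ : HeightDrop r (t * t) m U → 0ℤ ≤ + f - (U + m * m)
      bound⁻ (heightDrop {ρ} s d⁺ d⁻) = smaller s ⊕ d⁻ by lem (+ f)
        where lem : ∀ f → 1ℤ + f - ρ + (ρ - 1ℤ - m * m - U) ≡ f - (U + m * m)
              lem f = solve (f ∷ ρ ∷ m ∷ U ∷ [])
      finish : Lowest (- U) (m * m) → Torsion r t
      finish (lowest g r′ t′ w′ U≡ m²≡ h′ c′) = ⊥-elim (impossible (descend f r′ t′ w′ h′ c′
          (0≤cancel g (+ f - (r′ + t′ * t′)) g≥1 ((g≥1 ⊗ 0≤n f) ⊕ bound⁺ drop by lem⁺ (+ f) U≡ m²≡))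
          (0≤cancel g (+ f - (- r′ + t′ * t′)) g≥1 ((g≥1 ⊗ 0≤n f) ⊕ bound⁻ drop by lem⁻ (+ f) U≡ m²≡))))
        where
        lem⁺ : ∀ f → - U ≡ g * r′ → m * m ≡ g * (t′ * t′) → (g - 1ℤ) * f + (f - (- U + m * m)) ≡ g * (f - (r′ + t′ * t′))
        lem⁺ f p q = lin2 -1ℤ -1ℤ p q (solve (f ∷ g ∷ r′ ∷ t′ ∷ U ∷ m ∷ []))
        lem⁻ : ∀ f → - U ≡ g * r′ → m * m ≡ g * (t′ * t′) → (g - 1ℤ) * f + (f - (U + m * m)) ≡ g * (f - (- r′ + t′ * t′))
        lem⁻ f p q = lin2 1ℤ -1ℤ p q (solve (f ∷ g ∷ r′ ∷ t′ ∷ U ∷ m ∷ []))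
        g≥1 : 0ℤ ≤ g - 1ℤ
        g≥1 = either (0≤⊎0< (g - 1ℤ)) (λ p → p) λ p → ⊥-elim (¬0≤-1- (0≤sq t′ ⊗ lem p) (1≤sq m m≢0 by lem′ m²≡))
          where
          lem : 0ℤ ≤ - (g - 1ℤ) - 1ℤ → 0ℤ ≤ - g
          lem p = p by solve (g ∷ [])
          lem′ : m * m ≡ g * (t′ * t′) → m * m - 1ℤ ≡ - (t′ * t′ * - g) - 1ℤ
          lem′ p = lin1 1ℤ p (solve (g ∷ t′ ∷ m ∷ []))
        U≢0 : U ≢ 0ℤ
        U≢0 refl = either (noZeroDiv (m * m * m) (sym e)) m³≢0 n≢0
        impossible : Torsion r′ t′ → ⊥
        impossible (at-∞ refl) = m²≢0 (trans m²≡ (*-zeroʳ g))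
        impossible (at-0 refl) = U≢0 (neg-injective (trans U≡ (*-zeroʳ g)))
        impossible (at-1 refl) = either (noZeroDiv n (cancelˡ (m * m) m²≢0 (lem (trans U≡ (sym m²≡))))) n≢0 m+n≢0
          where
          lem : - U ≡ m * m → m * m * (n * (m + n)) ≡ m * m * 0ℤ
          lem p = lin2 -1ℤ (- (n * n + U)) e p (solve (m ∷ n ∷ U ∷ []))

-- The quartics x⁴ ± x²y² + y⁴ = z²

Odd Even : ℤ → Set
Odd n = ∃[ k ] n ≡ + 2 * k + 1ℤ
Even n = ∃[ k ] n ≡ + 2 * k

2∤1 : ∀ k → + 2 * k ≡ + 1 → ⊥
2∤1 k = ¬mult 1 0 k (ℕ.s≤s ℕ.z≤n)

4∤2 : ∀ k → + 4 * k ≡ + 2 → ⊥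
4∤2 k = ¬mult 3 1 k (ℕ.s≤s (ℕ.s≤s ℕ.z≤n))

8∤4 : ∀ k → + 8 * k ≡ + 4 → ⊥
8∤4 k = ¬mult 7 3 k (ℕ.s≤s (ℕ.s≤s (ℕ.s≤s (ℕ.s≤s ℕ.z≤n))))

sq-≡ : ∀ x y → 0ℤ ≤ x → 0ℤ ≤ y → x * x ≡ y * y → x ≡ y
sq-≡ x y px py e = either (noZeroDiv {x - y} (x + y) eq) (λ p → trans (x≡0 p) (sym (y≡0 p))) fin
  where
  eq : (x + y) * (x - y) ≡ 0ℤ
  eq = lin1 1ℤ e (solve (x ∷ y ∷ []))
  x≡0 : x + y ≡ 0ℤ → x ≡ 0ℤ
  x≡0 p = proj₁ (sum≡0 px py (0≤n 0 by cong -_ (sym p)))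
  y≡0 : x + y ≡ 0ℤ → y ≡ 0ℤ
  y≡0 p = proj₂ (sum≡0 px py (0≤n 0 by cong -_ (sym p)))
  fin : x - y ≡ 0ℤ → x ≡ y
  fin p = lin1 1ℤ p (solve (x ∷ y ∷ []))

record FourthPowers (a b t : ℤ) : Set where
  constructor fourthPowers
  field
    e f : ℤ
    a≡ : a ≡ e * e * (e * e)
    b≡ : b ≡ f * f * (f * f)
    ef≡ : e * e * (f * f) ≡ t * t
    cop : Cop e f

coprimeFourth : ∀ a b t → 0ℤ ≤ a → 0ℤ ≤ b → Cop a b → a * b ≡ t * t * (t * t) → FourthPowers a b t
coprimeFourth a b t pa pb h e = go (coprimeSquare⁺ {a} {b} {t * t} pa h e) (coprimeSquare⁺ {b} {a} {t * t} pb (copSym h) (trans (*-comm b a) e))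
  where
  go : ∃[ p ] a ≡ p * p → ∃[ q ] b ≡ q * q → FourthPowers a b t
  go (p , a≡) (q , b≡) = either (noZeroDiv {p * q - t * t} (p * q + t * t) (eq a≡ b≡))
      (λ z → roots (coprimeSquare {p} { - q} {t} (copSym (copNeg (subst (λ x → Cop x p) (sym (neg-involutive q)) (copSym cop-pq)))) (minus z))
                   (coprimeSquare {q} { - p} {t} (copSym (copNeg (subst (λ x → Cop x q) (sym (neg-involutive p)) cop-pq))) (minus′ z)))
      (λ z → roots (coprimeSquare {p} {q} {t} cop-pq (plus z)) (coprimeSquare {q} {p} {t} (copSym cop-pq) (trans (*-comm q p) (plus z))))
    where
    cop-pq : Cop p q
    cop-pq = copDivˡ p p (copDivʳ q q (subst₂ Cop a≡ b≡ h))
    eq : a ≡ p * p → b ≡ q * q → (p * q + t * t) * (p * q - t * t) ≡ 0ℤ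
    eq a≡ b≡ = lin3 1ℤ (- b) (- (p * p)) e a≡ b≡ (solve (a ∷ b ∷ p ∷ q ∷ t ∷ []))
    plus : p * q - t * t ≡ 0ℤ → p * q ≡ t * t
    plus z = lin1 1ℤ z (solve (p ∷ q ∷ t ∷ []))
    minus : p * q + t * t ≡ 0ℤ → p * (- q) ≡ t * t
    minus z = lin1 -1ℤ z (solve (p ∷ q ∷ t ∷ []))
    minus′ : p * q + t * t ≡ 0ℤ → q * (- p) ≡ t * t
    minus′ z = lin1 -1ℤ z (solve (p ∷ q ∷ t ∷ []))
    square± : ∀ {p} e → p ≡ e * e ⊎ p ≡ - (e * e) → p * p ≡ e * e * (e * e)
    square± e (inj₁ refl) = refl
    square± e (inj₂ refl) = solve (e ∷ [])
    roots : ∃[ e ] (p ≡ e * e ⊎ p ≡ - (e * e)) → ∃[ f ] (q ≡ f * f ⊎ q ≡ - (f * f)) → FourthPowers a b t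
    roots (r , r≡) (s , s≡) = fourthPowers r s ar bs
      (sq-≡ (r * r * (s * s)) (t * t) (0≤sq r ⊗ 0≤sq s) (0≤sq t) (lem ar bs))
      (copDivˡ r r (copDivʳ s s (copDivˡ (r * r) (r * r) (copDivʳ (s * s) (s * s) (subst₂ Cop ar bs h)))))
      where
      ar : a ≡ r * r * (r * r)
      ar = trans a≡ (square± r r≡)
      bs : b ≡ s * s * (s * s)
      bs = trans b≡ (square± s s≡)
      lem : a ≡ r * r * (r * r) → b ≡ s * s * (s * s) → r * r * (s * s) * (r * r * (s * s)) ≡ t * t * (t * t)
      lem x y = lin3 1ℤ (- b) (- (r * r * (r * r))) e x y (solve (a ∷ b ∷ r ∷ s ∷ t ∷ []))

nonnegˡ : ∀ a b → 0ℤ ≤ a + b → 0ℤ ≤ a * b → 0ℤ ≤ a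
nonnegˡ a b p q = either (0≤⊎0< a) (λ h → h) λ h → ⊥-elim (absurd h)
  where
  absurd : 0ℤ ≤ - a - 1ℤ → ⊥
  absurd h = ¬0≤-1- (0≤n 0) (q ⊕ h ⊗ (p ⊕ (h ⊕ 0≤n 1)) ⊕ p ⊕ h by solve (a ∷ b ∷ []))

-- Descent for v² = x⁴ - σx²y² + y⁴, σ = ±1, with x odd and y = 2t. A round leads from a
-- factorisation of 3t⁴ through x² = (f² - σe²)(f² + 3σe²) back to f² = A⁴ - σA²B² + B⁴, with the
-- same σ and with AB = ±e even.
module Quartic (σ : ℤ) (σσ : σ * σ ≡ 1ℤ) where
  cop-σ : ∀ {a} → Cop a σ
  cop-σ {a} = 0ℤ , σ , lin1 1ℤ σσ (solve (σ ∷ a ∷ []))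

  record Factors (x t : ℤ) : Set where
    constructor factors
    field
      lo hi : ℤ
      0≤lo : 0ℤ ≤ lo
      0≤hi : 0ℤ ≤ hi
      product : lo * hi ≡ + 3 * (t * t * (t * t))
      difference : hi - lo ≡ x * x - + 2 * σ * (t * t)

  -- v² - (x² - 2σt²)² = 12t⁴, as σ² = 1. The factors lo and hi are the halves of |v| ∓ (x² - 2σt²);
  -- the absolute value makes both nonnegative.
  factorise : ∀ x t v → Odd x → v * v ≡ x * x * (x * x) - + 4 * σ * (x * x * (t * t)) + + 16 * (t * t * (t * t)) → Factors x t
  factorise x t v (k , refl) e = go (+ abs v) (0≤n (abs v)) (trans (sym (abs² v)) e) (parity (+ abs v))
    where
    abs² : ∀ t → t * t ≡ + abs t * + abs t
    abs² (+ n) = refl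
    abs² -[1+ n ] = refl
    go : ∀ v → 0ℤ ≤ v → v * v ≡ x * x * (x * x) - + 4 * σ * (x * x * (t * t)) + + 16 * (t * t * (t * t)) → Even v ⊎ Odd v → Factors x t
    go v pv e (inj₁ (w , refl)) = ⊥-elim (2∤1 (+ 2 * (w * w) + + 2 * σ * (x * x * (t * t)) - + 8 * (t * t * (t * t)) - (+ 8 * (k * k * (k * k)) + + 16 * (k * k * k) + + 12 * (k * k) + + 4 * k))
      (lin1 1ℤ e (solve (σ ∷ k ∷ t ∷ w ∷ []))))
    go v pv e (inj₂ (w , refl)) = factors A B (nonnegˡ A B sum prod) (nonnegˡ B A (sum by +-comm A B) (prod by *-comm A B)) product difference
      where
      A B : ℤ
      A = w - + 2 * (k * k) - + 2 * k + σ * (t * t)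
      B = w + + 2 * (k * k) + + 2 * k + 1ℤ - σ * (t * t)
      product : (w - + 2 * (k * k) - + 2 * k + σ * (t * t)) * (w + + 2 * (k * k) + + 2 * k + 1ℤ - σ * (t * t)) ≡ + 3 * (t * t * (t * t))
      product = cancelˡ (+ 4) (λ ()) (lin2 1ℤ (- (+ 4 * (t * t * (t * t)))) e σσ (solve (σ ∷ k ∷ t ∷ w ∷ [])))
      sum : 0ℤ ≤ A + B
      sum = pv by lem w k (σ * (t * t))
        where lem : ∀ w k s → + 2 * w + 1ℤ ≡ w - + 2 * (k * k) - + 2 * k + s + (w + + 2 * (k * k) + + 2 * k + 1ℤ - s)
              lem w k s = solve (w ∷ k ∷ s ∷ [])
      prod : 0ℤ ≤ A * B
      prod = 0≤n 3 ⊗ (0≤sq t ⊗ 0≤sq t) by sym product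
      difference : w + + 2 * (k * k) + + 2 * k + 1ℤ - σ * (t * t) - (w - + 2 * (k * k) - + 2 * k + σ * (t * t)) ≡ x * x - + 2 * σ * (t * t)
      difference = solve (σ ∷ k ∷ t ∷ w ∷ [])

  -- A common divisor g divides x² - 2σt², which is prime to t. As lo · hi = 3t⁴, g² then divides 3.
  factors-cop : ∀ x t → Cop x t → (F : Factors x t) → Cop (Factors.lo F) (Factors.hi F)
  factors-cop x t h (factors a b _ _ prod diff) = cop-by-gcd a b unitary
    where
    unitary : ∀ g → 0ℤ ≤ g → g ∣ a → g ∣ b → g ≡ 1ℤ
    unitary g 0≤g (divides p p≡) (divides q q≡) = go (ℕ.prime⇒irreducible (toWitness {a? = ℕ.prime? 3} _) (∣⇒∣ᵤ g∣3))
      where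
      g∣diff : g ∣ x * x - + 2 * σ * (t * t)
      g∣diff = divides (q - p) (lem p≡ q≡)
        where lem : a ≡ p * g → b ≡ q * g → x * x - + 2 * σ * (t * t) ≡ (q - p) * g
              lem p≡ q≡ = lin3 -1ℤ -1ℤ 1ℤ diff p≡ q≡ (solve (σ ∷ x ∷ t ∷ a ∷ b ∷ p ∷ q ∷ g ∷ []))
      gt : Cop g t
      gt = copSym (∣⇒∣g g∣diff (copSym (copMod {x * x - + 2 * σ * (t * t)} {t} {x * x} (+ 2 * σ * t) (solve (σ ∷ x ∷ t ∷ []))
        (copSym (copMul (copSym h) (copSym h))))))
      g²∣3 : g * g ∣ + 3
      g²∣3 = euclid {g * g} {t} {+ 3} ggt (euclid {g * g} {t} {t * + 3} ggt (euclid {g * g} {t} {t * (t * + 3)} ggt (euclid {g * g} {t} {t * (t * (t * + 3))} ggt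
        (divides (p * q) (lem p≡ q≡)))))
        where
        ggt : Cop (g * g) t
        ggt = copSym (copMul (copSym gt) (copSym gt))
        lem : a ≡ p * g → b ≡ q * g → t * (t * (t * (t * + 3))) ≡ p * q * (g * g)
        lem p≡ q≡ = lin3 -1ℤ b (p * g) prod p≡ q≡ (solve (t ∷ a ∷ b ∷ p ∷ q ∷ g ∷ []))
      g∣3 : g ∣ + 3
      g∣3 = ∣-trans (divides g refl) g²∣3
      three : g ≡ + 3 → g * g ∣ + 3 → g ≡ 1ℤ
      three refl (divides k e) = ⊥-elim (¬mult 8 2 k (ℕ.s≤s (ℕ.s≤s (ℕ.s≤s ℕ.z≤n))) (trans (*-comm (+ 9) k) (sym e)))
      go : abs g ≡ 1 ⊎ abs g ≡ 3 → g ≡ 1ℤ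
      go (inj₁ p) = trans (sym (0≤i⇒+∣i∣≡i 0≤g)) (cong +_ p)
      go (inj₂ p) = three (trans (sym (0≤i⇒+∣i∣≡i 0≤g)) (cong +_ p)) g²∣3

  record Reduction (x t : ℤ) : Set where
    constructor reduction
    field
      e f : ℤ
      cop : Cop e f
      ef≡ : e * e * (f * f) ≡ t * t
      quartic : (x * x ≡ + 3 * (f * f * (f * f)) - e * e * (e * e) + + 2 * σ * (e * e * (f * f)))
              ⊎ (x * x ≡ f * f * (f * f) - + 3 * (e * e * (e * e)) + + 2 * σ * (e * e * (f * f)))

  reduceFactors : ∀ x t → (F : Factors x t) → Cop (Factors.lo F) (Factors.hi F) → Reduction x t
  reduceFactors x t (factors lo hi 0≤lo 0≤hi prod diff) h =
    go (ℕ.euclidsLemma (abs lo) (abs hi) (toWitness {a? = ℕ.prime? 3} _)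
      (subst (3 ℕ.∣_) (abs-* lo hi) (∣⇒∣ᵤ (divides {+ 3} (t * t * (t * t)) (trans prod (*-comm (+ 3) (t * t * (t * t))))))))
    where
    third : ∀ c l → 0ℤ ≤ l → l ≡ c * + 3 → 0ℤ ≤ c
    third c l p e = 0≤cancel (+ 3) c (0≤n 2) (p by trans e (*-comm c (+ 3)))
    low : + 3 ∣ lo → Reduction x t
    low (divides c e) = fin (coprimeFourth c hi t (third c lo 0≤lo e) 0≤hi (copDivˡ c (+ 3) (subst (λ l → Cop l hi) e h))
        (cancelˡ (+ 3) (λ ()) (eq e)))
      where
      eq : lo ≡ c * + 3 → + 3 * (c * hi) ≡ + 3 * (t * t * (t * t))
      eq e = lin2 1ℤ (- hi) prod e (solve (lo ∷ hi ∷ c ∷ t ∷ []))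
      fin : FourthPowers c hi t → Reduction x t
      fin (fourthPowers r s c≡ hi≡ rs cop) = reduction r s cop rs (inj₂ (lem e c≡ hi≡ rs))
        where
        lem : lo ≡ c * + 3 → c ≡ r * r * (r * r) → hi ≡ s * s * (s * s) → r * r * (s * s) ≡ t * t →
          x * x ≡ s * s * (s * s) - + 3 * (r * r * (r * r)) + + 2 * σ * (r * r * (s * s))
        lem refl refl refl rs = lin2 -1ℤ (- (+ 2 * σ)) diff rs (solve (σ ∷ x ∷ t ∷ r ∷ s ∷ []))
    high : + 3 ∣ hi → Reduction x t
    high (divides c e) = fin (coprimeFourth lo c t 0≤lo (third c hi 0≤hi e) (copDivʳ c (+ 3) (subst (Cop lo) e h))
        (cancelˡ (+ 3) (λ ()) (eq e)))
      where
      eq : hi ≡ c * + 3 → + 3 * (lo * c) ≡ + 3 * (t * t * (t * t))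
      eq e = lin2 1ℤ (- lo) prod e (solve (lo ∷ hi ∷ c ∷ t ∷ []))
      fin : FourthPowers lo c t → Reduction x t
      fin (fourthPowers r s lo≡ c≡ rs cop) = reduction r s cop rs (inj₁ (lem e lo≡ c≡ rs))
        where
        lem : hi ≡ c * + 3 → lo ≡ r * r * (r * r) → c ≡ s * s * (s * s) → r * r * (s * s) ≡ t * t →
          x * x ≡ + 3 * (s * s * (s * s)) - r * r * (r * r) + + 2 * σ * (r * r * (s * s))
        lem refl refl refl rs = lin2 -1ℤ (- (+ 2 * σ)) diff rs (solve (σ ∷ x ∷ t ∷ r ∷ s ∷ []))
    go : 3 ℕ.∣ abs lo ⊎ 3 ℕ.∣ abs hi → Reduction x t
    go (inj₁ p) = low (∣ᵤ⇒∣ p)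
    go (inj₂ p) = high (∣ᵤ⇒∣ p)

  odd-sq : ∀ x → Odd x → ∃[ m ] x * x ≡ + 8 * m + 1ℤ
  odd-sq x (k , refl) = go (parity k)
    where
    go : Even k ⊎ Odd k → ∃[ m ] (+ 2 * k + 1ℤ) * (+ 2 * k + 1ℤ) ≡ + 8 * m + 1ℤ
    go (inj₁ (l , refl)) = + 2 * (l * l) + l , solve (l ∷ [])
    go (inj₂ (l , refl)) = + 2 * (l * l) + + 3 * l + 1ℤ , solve (l ∷ [])

  -- An odd square is 1 modulo 8. The first equation and the remaining parities give x² even, x² ≡ 3
  -- modulo 4 or x² ≡ 5 modulo 8.
  parities : ∀ x e f → Odd x → (x * x ≡ + 3 * (f * f * (f * f)) - e * e * (e * e) + + 2 * σ * (e * e * (f * f)))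
              ⊎ (x * x ≡ f * f * (f * f) - + 3 * (e * e * (e * e)) + + 2 * σ * (e * e * (f * f))) →
    Even e × Odd f × x * x ≡ f * f * (f * f) - + 3 * (e * e * (e * e)) + + 2 * σ * (e * e * (f * f))
  parities x e f ox q = go (proj₁ (odd-sq x ox)) (proj₂ (odd-sq x ox)) q (parity e) (parity f)
    where
    go : ∀ m → x * x ≡ + 8 * m + 1ℤ → (x * x ≡ + 3 * (f * f * (f * f)) - e * e * (e * e) + + 2 * σ * (e * e * (f * f)))
              ⊎ (x * x ≡ f * f * (f * f) - + 3 * (e * e * (e * e)) + + 2 * σ * (e * e * (f * f))) → Even e ⊎ Odd e → Even f ⊎ Odd f →
      Even e × Odd f × x * x ≡ f * f * (f * f) - + 3 * (e * e * (e * e)) + + 2 * σ * (e * e * (f * f))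
    go m sq (inj₂ q) (inj₁ p) (inj₂ p′) = p , p′ , q
    go m sq (inj₁ q) (inj₁ (i , refl)) (inj₁ (j , refl)) = ⊥-elim (2∤1 (+ 24 * (j * j * j * j) - + 8 * (i * i * i * i) + + 16 * σ * (i * i * (j * j)) - + 4 * m)
      (lin2 -1ℤ 1ℤ q sq (solve (σ ∷ x ∷ i ∷ j ∷ m ∷ []))))
    go m sq (inj₂ q) (inj₁ (i , refl)) (inj₁ (j , refl)) = ⊥-elim (2∤1 (+ 8 * (j * j * j * j) - + 24 * (i * i * i * i) + + 16 * σ * (i * i * (j * j)) - + 4 * m)
      (lin2 -1ℤ 1ℤ q sq (solve (σ ∷ x ∷ i ∷ j ∷ m ∷ []))))
    go m sq (inj₁ q) (inj₂ (i , refl)) (inj₂ (j , refl)) = ⊥-elim (2∤1 (1ℤ + + 4 * (+ 3 * (j + + 3 * (j * j) + + 4 * (j * j * j) + + 2 * (j * j * j * j)) - (i + + 3 * (i * i) + + 4 * (i * i * i) + + 2 * (i * i * i * i)))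
        + σ * ((+ 2 * i + 1ℤ) * (+ 2 * i + 1ℤ) * ((+ 2 * j + 1ℤ) * (+ 2 * j + 1ℤ))) - + 4 * m)
      (lin2 -1ℤ 1ℤ q sq (solve (σ ∷ x ∷ i ∷ j ∷ m ∷ []))))
    go m sq (inj₂ q) (inj₂ (i , refl)) (inj₂ (j , refl)) = ⊥-elim (2∤1 (-1ℤ + + 4 * ((j + + 3 * (j * j) + + 4 * (j * j * j) + + 2 * (j * j * j * j)) - + 3 * (i + + 3 * (i * i) + + 4 * (i * i * i) + + 2 * (i * i * i * i)))
        + σ * ((+ 2 * i + 1ℤ) * (+ 2 * i + 1ℤ) * ((+ 2 * j + 1ℤ) * (+ 2 * j + 1ℤ))) - + 4 * m)
      (lin2 -1ℤ 1ℤ q sq (solve (σ ∷ x ∷ i ∷ j ∷ m ∷ []))))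
    go m sq (inj₁ q) (inj₁ (i , refl)) (inj₂ (j , refl)) = ⊥-elim (4∤2 (- (+ 6 * (j + + 3 * (j * j) + + 4 * (j * j * j) + + 2 * (j * j * j * j)) - + 4 * (i * i * i * i)
        + + 2 * σ * (i * i * ((+ 2 * j + 1ℤ) * (+ 2 * j + 1ℤ))) - + 2 * m))
      (lin2 1ℤ -1ℤ q sq (solve (σ ∷ x ∷ i ∷ j ∷ m ∷ []))))
    go m sq (inj₁ q) (inj₂ (i , refl)) (inj₁ (j , refl)) = ⊥-elim (4∤2 (+ 12 * (j * j * j * j) - + 2 * (i + + 3 * (i * i) + + 4 * (i * i * i) + + 2 * (i * i * i * i))
        + + 2 * σ * (j * j * ((+ 2 * i + 1ℤ) * (+ 2 * i + 1ℤ))) - + 2 * m)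
      (lin2 -1ℤ 1ℤ q sq (solve (σ ∷ x ∷ i ∷ j ∷ m ∷ []))))
    go m sq (inj₂ q) (inj₂ (i , refl)) (inj₁ (j , refl)) = ⊥-elim (8∤4 (+ 2 * (j * j * j * j) - + 3 * (i + + 3 * (i * i) + + 4 * (i * i * i) + + 2 * (i * i * i * i))
        + σ * (j * j * ((+ 2 * i + 1ℤ) * (+ 2 * i + 1ℤ))) - m)
      (lin2 -1ℤ 1ℤ q sq (solve (σ ∷ x ∷ i ∷ j ∷ m ∷ []))))

  ¬-square : ∀ s f c → Odd f → f * f + + 4 * s ≡ - (c * c) → ⊥
  ¬-square s f c (j , refl) e = go (parity c)
    where
    go : Even c ⊎ Odd c → ⊥
    go (inj₁ (l , refl)) = 2∤1 (- (+ 2 * (j * j) + + 2 * j + + 2 * s + + 2 * (l * l))) (lin1 -1ℤ e (solve (s ∷ j ∷ l ∷ [])))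
    go (inj₂ (l , refl)) = 4∤2 (- (j * j + j + s + (l * l + l))) (lin1 -1ℤ e (solve (s ∷ j ∷ l ∷ [])))

  square-odd : ∀ s f c → Odd f → f * f + + 4 * s ≡ c * c → Odd c
  square-odd s f c (j , refl) e = go (parity c)
    where
    go : Even c ⊎ Odd c → Odd c
    go (inj₂ o) = o
    go (inj₁ (l , refl)) = ⊥-elim (2∤1 (+ 2 * (l * l) - (+ 2 * (j * j) + + 2 * j + + 2 * s)) (lin1 -1ℤ e (solve (s ∷ j ∷ l ∷ []))))

  record SquarePair (e f : ℤ) : Set where
    constructor squarePair
    field
      k l : ℤ
      k-odd : Odd k
      l-odd : Odd l
      cop : Cop k l
      k² : f * f - σ * (e * e) ≡ k * k
      l² : f * f + + 3 * σ * (e * e) ≡ l * l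

  -- The factors f² - σe² and f² + 3σe² are odd and differ by 4σe², hence are coprime; both are 1
  -- modulo 4, so neither is the negative of a square.
  squares : ∀ x e f → Cop e f → Even e → Odd f → x * x ≡ f * f * (f * f) - + 3 * (e * e * (e * e)) + + 2 * σ * (e * e * (f * f)) → SquarePair e f
  squares x e f h (i , refl) of@(j , f≡) q = go (coprimeSquare {P₁} {P₂} {x} cop prod)
      (coprimeSquare {P₂} {P₁} {x} (copSym cop) (trans (*-comm P₂ P₁) prod))
    where
    P₁ P₂ : ℤ
    P₁ = f * f - σ * (+ 2 * i * (+ 2 * i))
    P₂ = f * f + + 3 * σ * (+ 2 * i * (+ 2 * i))
    prod : (f * f - σ * (+ 2 * i * (+ 2 * i))) * (f * f + + 3 * σ * (+ 2 * i * (+ 2 * i))) ≡ x * x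
    prod = lin2 -1ℤ (- (+ 48 * (i * i * i * i))) q σσ (solve (σ ∷ x ∷ i ∷ f ∷ []))
    P₁2 : Cop P₁ (+ 2)
    P₁2 = odd⇒cop2 {P₁} (+ 2 * (j * j) + + 2 * j - + 2 * σ * (i * i)) (lem f≡)
      where lem : f ≡ + 2 * j + 1ℤ → f * f - σ * (+ 2 * i * (+ 2 * i)) ≡ + 2 * (+ 2 * (j * j) + + 2 * j - + 2 * σ * (i * i)) + 1ℤ
            lem refl = solve (σ ∷ i ∷ j ∷ [])
    P₁e : Cop P₁ (+ 2 * i)
    P₁e = copMod {P₁} {+ 2 * i} {f * f} (σ * (+ 2 * i)) (lem f i σ) (copSym (copMul h h))
      where lem : ∀ f i σ → f * f - σ * (+ 2 * i * (+ 2 * i)) + σ * (+ 2 * i) * (+ 2 * i) ≡ f * f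
            lem f i σ = solve (f ∷ i ∷ σ ∷ [])
    cop : Cop P₁ P₂
    cop = copSym (copMod {P₂} {P₁} {+ 2 * (+ 2 * (σ * (+ 2 * i * (+ 2 * i))))} -1ℤ (lem f i σ)
      (copSym (copMul P₁2 (copMul P₁2 (copMul (cop-σ {P₁}) (copMul P₁e P₁e))))))
      where lem : ∀ f i σ → f * f + + 3 * σ * (+ 2 * i * (+ 2 * i)) + -1ℤ * (f * f - σ * (+ 2 * i * (+ 2 * i))) ≡ + 2 * (+ 2 * (σ * (+ 2 * i * (+ 2 * i))))
            lem f i σ = solve (f ∷ i ∷ σ ∷ [])
    as₁ : P₁ ≡ f * f + + 4 * (- (σ * (i * i)))
    as₁ = lem f i σ
      where lem : ∀ f i σ → f * f - σ * (+ 2 * i * (+ 2 * i)) ≡ f * f + + 4 * (- (σ * (i * i)))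
            lem f i σ = solve (f ∷ i ∷ σ ∷ [])
    as₂ : P₂ ≡ f * f + + 4 * (+ 3 * (σ * (i * i)))
    as₂ = lem f i σ
      where lem : ∀ f i σ → f * f + + 3 * σ * (+ 2 * i * (+ 2 * i)) ≡ f * f + + 4 * (+ 3 * (σ * (i * i)))
            lem f i σ = solve (f ∷ i ∷ σ ∷ [])
    go : ∃[ c ] (P₁ ≡ c * c ⊎ P₁ ≡ - (c * c)) → ∃[ g ] (P₂ ≡ g * g ⊎ P₂ ≡ - (g * g)) → SquarePair (+ 2 * i) f
    go (c , inj₂ p) _ = ⊥-elim (¬-square (- (σ * (i * i))) f c of (trans (sym as₁) p))
    go (c , inj₁ _) (g , inj₂ p) = ⊥-elim (¬-square (+ 3 * (σ * (i * i))) f g of (trans (sym as₂) p))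
    go (c , inj₁ p) (g , inj₁ q) = squarePair c g (square-odd (- (σ * (i * i))) f c of (trans (sym as₁) p))
      (square-odd (+ 3 * (σ * (i * i))) f g of (trans (sym as₂) q)) (copDivˡ c c (copDivʳ g g (subst₂ Cop p q cop))) p q

  record Smaller (e f : ℤ) : Set where
    constructor smaller
    field
      A B : ℤ
      cop : Cop A B
      AB≡ : A * A * (B * B) ≡ e * e
      f²≡ : f * f ≡ A * A * (A * A) - σ * (A * A * (B * B)) + B * B * (B * B)

  -- (g - c)/2 and (g + c)/2 are coprime with product σe².
  halves : ∀ e f → e ≢ 0ℤ → SquarePair e f → Smaller e f
  halves e f e≢0 (squarePair _ _ (c , refl) (g , refl) (s , u , one) c² g²) = go (coprimeSquare {P} {σ * R} {e} cop prod)
      (coprimeSquare {σ * R} {P} {e} (copSym cop) (trans (*-comm (σ * R) P) prod))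
    where
    P R : ℤ
    P = g - c
    R = g + c + 1ℤ
    prod : (g - c) * (σ * (g + c + 1ℤ)) ≡ e * e
    prod = cancelˡ (+ 4) (λ ()) (lin3 σ (- σ) (+ 4 * (e * e)) c² g² σσ (solve (σ ∷ e ∷ f ∷ c ∷ g ∷ [])))
    copPR : Cop P R
    copPR = u - s , s + u , lem one
      where lem : s * (+ 2 * c + 1ℤ) + u * (+ 2 * g + 1ℤ) ≡ 1ℤ → (u - s) * (g - c) + (s + u) * (g + c + 1ℤ) ≡ 1ℤ
            lem p = lin1 1ℤ p (solve (s ∷ u ∷ c ∷ g ∷ []))
    cop : Cop P (σ * R)
    cop = copMul (cop-σ {P}) copPR
    f²≡PR : f * f ≡ (g - c) * (g - c) - σ * (g - c) * (σ * (g + c + 1ℤ)) + σ * (g + c + 1ℤ) * (σ * (g + c + 1ℤ))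
    f²≡PR = lin3 1ℤ (- σ) (+ 2 * ((g - c) * (g + c + 1ℤ)) - (g + c + 1ℤ) * (g + c + 1ℤ)) c² prod σσ (solve (σ ∷ e ∷ f ∷ c ∷ g ∷ []))
    same : ∀ A B x y → P ≡ x → σ * R ≡ y → x * x ≡ A * A * (A * A) → y * y ≡ B * B * (B * B) → x * y ≡ A * A * (B * B) → Smaller e f
    same A B x y p q xx yy xy = smaller A B copAB (trans (sym xy) (trans (sym (cong₂ _*_ p q)) prod))
        (trans f²≡PR (trans (cong₂ (λ P R → P * P - σ * P * R + R * R) p q) (lem xx yy xy)))
      where
      copAB : Cop A B
      copAB = copDivˡ A A (copDivˡ (A * A) (A * A) (copDivʳ B B (copDivʳ (B * B) (B * B) (subst₂ Cop
        (trans (cong₂ _*_ p p) xx) (trans (cong₂ _*_ q q) yy) (copSq cop)))))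
      lem : x * x ≡ A * A * (A * A) → y * y ≡ B * B * (B * B) → x * y ≡ A * A * (B * B) →
        x * x - σ * x * y + y * y ≡ A * A * (A * A) - σ * (A * A * (B * B)) + B * B * (B * B)
      lem a b c = lin3 1ℤ 1ℤ (- σ) a b c (solve (σ ∷ x ∷ y ∷ A ∷ B ∷ []))
    mixed : ∀ A B x y → P ≡ x → σ * R ≡ y → x * y ≡ - (A * B * (A * B)) → Smaller e f
    mixed A B x y p q xy = ⊥-elim (e≢0 (sq≡0 e (trans e² (cong (λ z → - (z * z)) (0≤-sq⇒≡0 (A * B) (0≤sq e by e²))))))
      where e² : e * e ≡ - (A * B * (A * B))
            e² = trans (sym prod) (trans (cong₂ _*_ p q) xy)
    go : ∃[ A ] (P ≡ A * A ⊎ P ≡ - (A * A)) → ∃[ B ] (σ * R ≡ B * B ⊎ σ * R ≡ - (B * B)) → Smaller e f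
    go (A , inj₁ p) (B , inj₁ q) = same A B (A * A) (B * B) p q refl refl refl
    go (A , inj₂ p) (B , inj₂ q) = same A B (- (A * A)) (- (B * B)) p q (solve (A ∷ [])) (solve (B ∷ [])) (solve (A ∷ B ∷ []))
    go (A , inj₁ p) (B , inj₂ q) = mixed A B (A * A) (- (B * B)) p q (solve (A ∷ B ∷ []))
    go (A , inj₂ p) (B , inj₁ q) = mixed A B (- (A * A)) (B * B) p q (solve (A ∷ B ∷ []))

  -- One round produces a T with 4T²X²f² = t², and therefore T² < t² when t is nonzero.
  quartic : ∀ x t v → Odd x → Cop x t → v * v ≡ x * x * (x * x) - + 4 * σ * (x * x * (t * t)) + + 16 * (t * t * (t * t)) → t ≡ 0ℤ
  quartic x t v = descend (abs (t * t)) x t v (0≤n 0 by lem (0≤sq t))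
    where
    lem : ∀ {m} → 0ℤ ≤ m → 0ℤ ≡ + abs m - m
    lem {+ n} _ = sym (+-inverseʳ (+ n))
    descend : ∀ n x t v → 0ℤ ≤ + n - t * t → Odd x → Cop x t → v * v ≡ x * x * (x * x) - + 4 * σ * (x * x * (t * t)) + + 16 * (t * t * (t * t)) → t ≡ 0ℤ
    descend zero x t v p ox h q = 0≤-sq⇒≡0 t (p by +-identityˡ (- (t * t)))
    descend (suc n) x t v p ox h q = byCases (t ≟ 0ℤ)
      where
      reduced′ : t ≢ 0ℤ → (R : Reduction x t) → t ≡ 0ℤ
      reduced′ t≢0 (reduction e f cop ef≡ r) = next (parities x e f ox r)
        where
        e≢0 : e ≢ 0ℤ
        e≢0 refl = t≢0 (sq≡0 t (sym ef≡))
        ef²≡ : ∀ {A B} → A * A * (B * B) ≡ e * e → A * A * (B * B) * (f * f) ≡ t * t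
        ef²≡ q = trans (cong (_* (f * f)) q) ef≡
        next : Even e × Odd f × x * x ≡ f * f * (f * f) - + 3 * (e * e * (e * e)) + + 2 * σ * (e * e * (f * f)) → t ≡ 0ℤ
        next (ee@(i , e≡) , of , q) = fin (halves e f e≢0 (squares x e f cop ee of q))
          where
          -- The even one of A and B is 2T, and the new solution has T in place of t.
          recurse : ∀ X T → Odd X → Cop X (+ 2 * T) → X * X * (+ 2 * T * (+ 2 * T)) ≡ e * e →
            f * f ≡ X * X * (X * X) - + 4 * σ * (X * X * (T * T)) + + 16 * (T * T * (T * T)) → t ≡ 0ℤ
          recurse X T oX cop AB f² = ⊥-elim (e≢0 (sq≡0 e (trans (sym AB) (trans (cong (λ T → X * X * (+ 2 * T * (+ 2 * T))) T≡0) (*-zeroʳ (X * X))))))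
            where
            T≢0 : T ≢ 0ℤ
            T≢0 z = e≢0 (sq≡0 e (trans (sym AB) (trans (cong (λ T → X * X * (+ 2 * T * (+ 2 * T))) z) (*-zeroʳ (X * X)))))
            Xf≢0 : X * f ≢ 0ℤ
            Xf≢0 z = t≢0 (sq≡0 t (trans (sym (ef²≡ {X} {+ 2 * T} AB)) (trans (reorder X T f) (trans (cong (λ z → + 4 * (T * T) * (z * z)) z) (*-zeroʳ (+ 4 * (T * T)))))))
              where reorder : ∀ X T f → X * X * (+ 2 * T * (+ 2 * T)) * (f * f) ≡ + 4 * (T * T) * (X * f * (X * f))
                    reorder X T f = solve (X ∷ T ∷ f ∷ [])
            bound : 0ℤ ≤ + n - T * T
            bound = p ⊕ 0≤n 4 ⊗ (0≤sq T ⊗ 1≤sq (X * f) Xf≢0) ⊕ 0≤n 2 ⊗ 0≤sq T ⊕ 1≤sq T T≢0 by size (+ n) (ef²≡ {X} {+ 2 * T} AB)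
              where
              size : ∀ n → X * X * (+ 2 * T * (+ 2 * T)) * (f * f) ≡ t * t →
                1ℤ + n - t * t + + 4 * (T * T * (X * f * (X * f) - 1ℤ)) + + 2 * (T * T) + (T * T - 1ℤ) ≡ n - T * T
              size n q = lin1 1ℤ q (solve (n ∷ t ∷ T ∷ X ∷ f ∷ []))
            T≡0 : T ≡ 0ℤ
            T≡0 = descend n X T f bound oX (copDivʳ T (+ 2) (subst (Cop X) (*-comm (+ 2) T) cop)) f²
          fin : Smaller e f → t ≡ 0ℤ
          fin (smaller A B cop AB f²) = go (parity A) (parity B)
            where
            go : Even A ⊎ Odd A → Even B ⊎ Odd B → t ≡ 0ℤ
            go (inj₁ (a , A≡)) (inj₁ (b , B≡)) = ⊥-elim (even⇒¬cop2 {A} {B} a b A≡ B≡ cop)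
            go (inj₁ (T , refl)) (inj₂ oB) = recurse B T oB (copSym cop) (trans (*-comm (B * B) (+ 2 * T * (+ 2 * T))) AB) (trans f² (solve (σ ∷ B ∷ T ∷ [])))
            go (inj₂ oA) (inj₁ (T , refl)) = recurse A T oA cop AB (trans f² (solve (σ ∷ A ∷ T ∷ [])))
            go (inj₂ (a , refl)) (inj₂ (b , refl)) = ⊥-elim (2∤1 (+ 2 * (i * i) - (+ 8 * (a * a + a) * (b * b + b) + + 2 * (a * a + a) + + 2 * (b * b + b)))
              (parity-clash e≡ AB))
              where
              parity-clash : e ≡ + 2 * i → (+ 2 * a + 1ℤ) * (+ 2 * a + 1ℤ) * ((+ 2 * b + 1ℤ) * (+ 2 * b + 1ℤ)) ≡ e * e →
                + 2 * (+ 2 * (i * i) - (+ 8 * (a * a + a) * (b * b + b) + + 2 * (a * a + a) + + 2 * (b * b + b))) ≡ + 1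
              parity-clash refl q = lin1 -1ℤ q (solve (i ∷ a ∷ b ∷ []))
      byCases : Dec (t ≡ 0ℤ) → t ≡ 0ℤ
      byCases (yes p) = p
      byCases (no t≢0) = reduced′ t≢0 (reduceFactors x t F (factors-cop x t h F))
        where F : Factors x t
              F = factorise x t v ox q

-- This enters the descent at its middle equation: the second half of a round produces a solution of
-- the quartic, which is already known to be trivial.
module Concordant (σ : ℤ) (σσ : σ * σ ≡ 1ℤ) where
  open Quartic σ σσ

  concordant : ∀ x e f → Cop e f → Even e → Odd f →
    x * x ≡ (f * f - σ * (e * e)) * (f * f + + 3 * σ * (e * e)) → e ≡ 0ℤ
  concordant x e f h ee@(i , e≡) of q = byCases (e ≟ 0ℤ)
    where
    q′ : x * x ≡ f * f * (f * f) - + 3 * (e * e * (e * e)) + + 2 * σ * (e * e * (f * f))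
    q′ = lin2 1ℤ (- (+ 3 * (e * e * (e * e)))) q σσ (solve (σ ∷ x ∷ e ∷ f ∷ []))
    descend : Smaller e f → e ≡ 0ℤ
    descend (smaller A B cop AB f²) = go (parity A) (parity B)
      where
      vanish : ∀ X T → Odd X → Cop X (+ 2 * T) → X * X * (+ 2 * T * (+ 2 * T)) ≡ e * e →
        f * f ≡ X * X * (X * X) - + 4 * σ * (X * X * (T * T)) + + 16 * (T * T * (T * T)) → e ≡ 0ℤ
      vanish X T oX cop AB f² = sq≡0 e (trans (sym AB) (trans (cong (λ T → X * X * (+ 2 * T * (+ 2 * T))) T≡0) (*-zeroʳ (X * X))))
        where T≡0 : T ≡ 0ℤ
              T≡0 = quartic X T f oX (copDivʳ T (+ 2) (subst (Cop X) (*-comm (+ 2) T) cop)) f²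
      go : Even A ⊎ Odd A → Even B ⊎ Odd B → e ≡ 0ℤ
      go (inj₁ (a , A≡)) (inj₁ (b , B≡)) = ⊥-elim (even⇒¬cop2 {A} {B} a b A≡ B≡ cop)
      go (inj₁ (T , refl)) (inj₂ oB) = vanish B T oB (copSym cop) (trans (*-comm (B * B) (+ 2 * T * (+ 2 * T))) AB) (trans f² (solve (σ ∷ B ∷ T ∷ [])))
      go (inj₂ oA) (inj₁ (T , refl)) = vanish A T oA cop AB (trans f² (solve (σ ∷ A ∷ T ∷ [])))
      go (inj₂ (a , refl)) (inj₂ (b , refl)) = ⊥-elim (2∤1 (+ 2 * (i * i) - (+ 8 * (a * a + a) * (b * b + b) + + 2 * (a * a + a) + + 2 * (b * b + b))) (clash e≡ AB))
        where
        clash : e ≡ + 2 * i → (+ 2 * a + 1ℤ) * (+ 2 * a + 1ℤ) * ((+ 2 * b + 1ℤ) * (+ 2 * b + 1ℤ)) ≡ e * e →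
          + 2 * (+ 2 * (i * i) - (+ 8 * (a * a + a) * (b * b + b) + + 2 * (a * a + a) + + 2 * (b * b + b))) ≡ + 1
        clash refl q = lin1 -1ℤ q (solve (i ∷ a ∷ b ∷ []))
    byCases : Dec (e ≡ 0ℤ) → e ≡ 0ℤ
    byCases (yes p) = p
    byCases (no e≢0) = descend (halves e f e≢0 (squares x e f h ee of q′))

quartic₁ : ∀ u t v → Cop u t → v * v ≡ u * u * (u * u) - u * u * (t * t) + t * t * (t * t) →
  (Odd u × Even t) ⊎ (Even u × Odd t) → u ≡ 0ℤ ⊎ t ≡ 0ℤ
quartic₁ u t v h e (inj₁ (ou , k , refl)) = inj₂ (trans (cong (+ 2 *_) k≡0) refl)
  where k≡0 : k ≡ 0ℤ
        k≡0 = Quartic.quartic 1ℤ refl u k v ou (copDivʳ k (+ 2) (subst (Cop u) (*-comm (+ 2) k) h)) (trans e (solve (u ∷ k ∷ [])))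
quartic₁ u t v h e (inj₂ ((k , refl) , ot)) = inj₁ (trans (cong (+ 2 *_) k≡0) refl)
  where k≡0 : k ≡ 0ℤ
        k≡0 = Quartic.quartic 1ℤ refl t k v ot (copDivʳ k (+ 2) (subst (Cop t) (*-comm (+ 2) k) (copSym h))) (trans e (solve (t ∷ k ∷ [])))

-- For u and t odd, V ± ut are twice coprime squares 2h², 2g² up to sign, and
-- g⁴ - g²h² + h⁴ = ((u² + t²)/2)².
quarticOdd : ∀ u t v → Cop u t → Odd u → Odd t → v * v ≡ u * u * (u * u) - u * u * (t * t) + t * t * (t * t) → u * u ≡ t * t
quarticOdd u t v h (a , refl) (b , refl) e = go (parity v)
  where
  n : ℤ
  n = + 2 * (a * a + a) - + 2 * (b * b + b)
  s : ℤ
  s = + 2 * (a * a + a) + + 2 * (b * b + b) + 1ℤ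
  go : Even v ⊎ Odd v → u * u ≡ t * t
  go (inj₁ (w , refl)) = ⊥-elim (2∤1 (+ 2 * (w * w) - (+ 8 * ((a * a + a) * (a * a + a)) + + 8 * ((b * b + b) * (b * b + b)) - + 8 * ((a * a + a) * (b * b + b)) + + 2 * (a * a + a) + + 2 * (b * b + b)))
    (lin1 1ℤ e (solve (a ∷ b ∷ w ∷ []))))
  go (inj₂ (w , refl)) = roots (coprimeSquare {P} {R} {n} copPR prod) (coprimeSquare {R} {P} {n} (copSym copPR) (trans (*-comm R P) prod))
    where
    P R : ℤ
    P = w - (+ 2 * (a * b) + a + b)
    R = w + (+ 2 * (a * b) + a + b) + 1ℤ
    prod : (w - (+ 2 * (a * b) + a + b)) * (w + (+ 2 * (a * b) + a + b) + 1ℤ) ≡ (+ 2 * (a * a + a) - + 2 * (b * b + b)) * (+ 2 * (a * a + a) - + 2 * (b * b + b))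
    prod = cancelˡ (+ 4) (λ ()) (lin1 1ℤ e (solve (a ∷ b ∷ w ∷ [])))
    cop-v : Cop (+ 2 * w + 1ℤ) (u * t)
    cop-v = copDivˡ (+ 2 * w + 1ℤ) (+ 2 * w + 1ℤ) (copMul
      (copMod {(+ 2 * w + 1ℤ) * (+ 2 * w + 1ℤ)} {u} {t * t * (t * t)} (u * (t * t) - u * (u * u)) (mod-u u t (+ 2 * w + 1ℤ) e)
        (copSym (copMul (copMul h h) (copMul h h))))
      (copMod {(+ 2 * w + 1ℤ) * (+ 2 * w + 1ℤ)} {t} {u * u * (u * u)} (t * (u * u) - t * (t * t)) (mod-t u t (+ 2 * w + 1ℤ) e)
        (copSym (copMul (copMul (copSym h) (copSym h)) (copMul (copSym h) (copSym h))))))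
      where
      mod-u : ∀ u t v → v * v ≡ u * u * (u * u) - u * u * (t * t) + t * t * (t * t) → v * v + (u * (t * t) - u * (u * u)) * u ≡ t * t * (t * t)
      mod-u u t v e = lin1 1ℤ e (solve (u ∷ t ∷ v ∷ []))
      mod-t : ∀ u t v → v * v ≡ u * u * (u * u) - u * u * (t * t) + t * t * (t * t) → v * v + (t * (u * u) - t * (t * t)) * t ≡ u * u * (u * u)
      mod-t u t v e = lin1 1ℤ e (solve (u ∷ t ∷ v ∷ []))
    copPR : Cop P R
    copPR = bez cop-v
      where
      bez : Cop (+ 2 * w + 1ℤ) (u * t) → Cop P R
      bez (x , y , one) = x - y , x + y , lem one
        where lem : x * (+ 2 * w + 1ℤ) + y * ((+ 2 * a + 1ℤ) * (+ 2 * b + 1ℤ)) ≡ 1ℤ →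
                (x - y) * (w - (+ 2 * (a * b) + a + b)) + (x + y) * (w + (+ 2 * (a * b) + a + b) + 1ℤ) ≡ 1ℤ
              lem p = lin1 1ℤ p (solve (x ∷ y ∷ a ∷ b ∷ w ∷ []))
    conclude : P * R ≡ 0ℤ → u * u ≡ t * t
    conclude z = fin (sq≡0 n (trans (sym prod) z))
      where fin : + 2 * (a * a + a) - + 2 * (b * b + b) ≡ 0ℤ → (+ 2 * a + 1ℤ) * (+ 2 * a + 1ℤ) ≡ (+ 2 * b + 1ℤ) * (+ 2 * b + 1ℤ)
            fin p = lin1 (+ 2) p (solve (a ∷ b ∷ []))
    mixed : ∀ g k x y → P ≡ x → R ≡ y → x * y ≡ - (g * k * (g * k)) → u * u ≡ t * t
    mixed g k x y p q xy = conclude (trans PR (trans (cong (λ z → - (z * z)) gk≡0) refl))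
      where
      PR : P * R ≡ - (g * k * (g * k))
      PR = trans (cong₂ _*_ p q) xy
      gk≡0 : g * k ≡ 0ℤ
      gk≡0 = 0≤-sq⇒≡0 (g * k) (0≤sq n by trans (sym prod) PR)
    same : ∀ ε g k → ε * ε ≡ 1ℤ → P ≡ ε * (g * g) → R ≡ ε * (k * k) → u * u ≡ t * t
    same ε g k εε p q = parities (parity g) (parity k)
      where
      xx : ε * (g * g) * (ε * (g * g)) ≡ g * g * (g * g)
      xx = lin1 (g * g * (g * g)) εε (solve (ε ∷ g ∷ []))
      yy : ε * (k * k) * (ε * (k * k)) ≡ k * k * (k * k)
      yy = lin1 (k * k * (k * k)) εε (solve (ε ∷ k ∷ []))
      xy : ε * (g * g) * (ε * (k * k)) ≡ g * g * (k * k)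
      xy = lin1 (g * g * (k * k)) εε (solve (ε ∷ g ∷ k ∷ []))
      copGK : Cop g k
      copGK = copDivˡ g g (copDivˡ (g * g) (g * g) (copDivʳ k k (copDivʳ (k * k) (k * k) (subst₂ Cop
        (trans (cong₂ _*_ p p) xx) (trans (cong₂ _*_ q q) yy) (copSq copPR)))))
      s²≡ : s * s ≡ g * g * (g * g) - g * g * (k * k) + k * k * (k * k)
      s²≡ = trans (lem prod) (trans (cong₂ (λ P R → P * P - P * R + R * R) p q) (cong₂ _+_ (cong₂ _-_ xx xy) yy))
        where
        lem : (w - (+ 2 * (a * b) + a + b)) * (w + (+ 2 * (a * b) + a + b) + 1ℤ) ≡ (+ 2 * (a * a + a) - + 2 * (b * b + b)) * (+ 2 * (a * a + a) - + 2 * (b * b + b)) →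
          s * s ≡ P * P - P * R + R * R
        lem z = eq z
          where
          eq : (w - (+ 2 * (a * b) + a + b)) * (w + (+ 2 * (a * b) + a + b) + 1ℤ) ≡ (+ 2 * (a * a + a) - + 2 * (b * b + b)) * (+ 2 * (a * a + a) - + 2 * (b * b + b)) →
            (+ 2 * (a * a + a) + + 2 * (b * b + b) + 1ℤ) * (+ 2 * (a * a + a) + + 2 * (b * b + b) + 1ℤ) ≡
            (w - (+ 2 * (a * b) + a + b)) * (w - (+ 2 * (a * b) + a + b)) - (w - (+ 2 * (a * b) + a + b)) * (w + (+ 2 * (a * b) + a + b) + 1ℤ)
              + (w + (+ 2 * (a * b) + a + b) + 1ℤ) * (w + (+ 2 * (a * b) + a + b) + 1ℤ)
          eq z = lin1 -1ℤ z (solve (a ∷ b ∷ w ∷ []))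
      zero-product : g ≡ 0ℤ ⊎ k ≡ 0ℤ → P * R ≡ 0ℤ
      zero-product z = trans (cong₂ _*_ p q) (trans xy (either z (λ g≡0 → cong (λ g → g * g * (k * k)) g≡0)
        (λ k≡0 → trans (cong (λ k → g * g * (k * k)) k≡0) (*-zeroʳ (g * g)))))
      parities : Even g ⊎ Odd g → Even k ⊎ Odd k → u * u ≡ t * t
      parities (inj₁ (i , g≡)) (inj₁ (j , k≡)) = ⊥-elim (even⇒¬cop2 {g} {k} i j g≡ k≡ copGK)
      parities (inj₁ ev) (inj₂ od) = conclude (zero-product (quartic₁ g k s copGK s²≡ (inj₂ (ev , od))))
      parities (inj₂ od) (inj₁ ev) = conclude (zero-product (quartic₁ g k s copGK s²≡ (inj₁ (od , ev))))
      parities (inj₂ (i , refl)) (inj₂ (j , refl)) = ⊥-elim (2∤1 (+ 2 * (ε * (j * j + j) - ε * (i * i + i)) - (+ 2 * (a * b) + a + b)) (clash p q))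
        where
        clash : w - (+ 2 * (a * b) + a + b) ≡ ε * ((+ 2 * i + 1ℤ) * (+ 2 * i + 1ℤ)) → w + (+ 2 * (a * b) + a + b) + 1ℤ ≡ ε * ((+ 2 * j + 1ℤ) * (+ 2 * j + 1ℤ)) →
          + 2 * (+ 2 * (ε * (j * j + j) - ε * (i * i + i)) - (+ 2 * (a * b) + a + b)) ≡ + 1
        clash p q = lin2 1ℤ -1ℤ p q (solve (a ∷ b ∷ w ∷ i ∷ j ∷ ε ∷ []))
    neg1 : ∀ {x y} → x ≡ - y → x ≡ -1ℤ * y
    neg1 {x} {y} e = trans e (sym (-1*i≡-i y))
    pos1 : ∀ {x y} → x ≡ y → x ≡ 1ℤ * y
    pos1 {x} {y} e = trans e (sym (*-identityˡ y))
    roots : ∃[ g ] (P ≡ g * g ⊎ P ≡ - (g * g)) → ∃[ k ] (R ≡ k * k ⊎ R ≡ - (k * k)) → u * u ≡ t * t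
    roots (g , inj₁ p) (k , inj₁ q) = same 1ℤ g k refl (pos1 p) (pos1 q)
    roots (g , inj₂ p) (k , inj₂ q) = same -1ℤ g k refl (neg1 p) (neg1 q)
    roots (g , inj₁ p) (k , inj₂ q) = mixed g k (g * g) (- (k * k)) p q (solve (g ∷ k ∷ []))
    roots (g , inj₂ p) (k , inj₁ q) = mixed g k (- (g * g)) (k * k) p q (solve (g ∷ k ∷ []))

-- The first elliptic curve

-- Here r / D is the x-coordinate of a rational point of y² = x (x² - x + 1).
cubicSquare : ∀ r D W → Cop r D → 0ℤ ≤ D - 1ℤ → W * W ≡ r * D * (r * r - r * D + D * D) → r ≡ 0ℤ ⊎ r ≡ D
-- The factors r, D and Q are pairwise coprime with square product, so each is a square up to sign,
-- where D and Q are positive.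
cubicSquare r D W h D≥1 e = go (coprimeSquare {r} {D * Q} {W} (copMul h rQ) (trans (assoc₁ r D Q) (sym e)))
    (coprimeSquare⁺ {D} {r * Q} {W} 0≤D (copMul (copSym h) DQ) (trans (assoc₂ r D Q) (sym e)))
    (coprimeSquare⁺ {Q} {r * D} {W} 0≤Q (copMul (copSym rQ) (copSym DQ)) (trans (*-comm Q (r * D)) (sym e)))
  where
  Q : ℤ
  Q = r * r - r * D + D * D
  0≤D : 0ℤ ≤ D
  0≤D = D≥1 ⊕ 0≤n 1 by solve (D ∷ [])
  Q≥1 : 0ℤ ≤ Q - 1ℤ
  Q≥1 = 0≤4+3 (r * r - r * D + D * D - 1ℤ) (0≤sq (+ 2 * r - D) ⊕ 0≤n 3 ⊗ (D≥1 ⊗ (D≥1 ⊕ 0≤n 2)) ⊕ 0≤n 2 by solve (r ∷ D ∷ []))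
  0≤Q : 0ℤ ≤ Q
  0≤Q = Q≥1 ⊕ 0≤n 1 by lem Q
    where lem : ∀ q → q - 1ℤ + 1ℤ ≡ q
          lem q = solve (q ∷ [])
  rQ : Cop r Q
  rQ = copSym (copMod {Q} {r} {D * D} (D - r) (lem r D) (copSym (copMul h h)))
    where lem : ∀ r D → r * r - r * D + D * D + (D - r) * r ≡ D * D
          lem r D = solve (r ∷ D ∷ [])
  DQ : Cop D Q
  DQ = copSym (copMod {Q} {D} {r * r} (r - D) (lem r D) (copSym (copMul (copSym h) (copSym h))))
    where lem : ∀ r D → r * r - r * D + D * D + (r - D) * D ≡ r * r
          lem r D = solve (r ∷ D ∷ [])
  assoc₁ : ∀ r D Q → r * (D * Q) ≡ r * D * Q
  assoc₁ r D Q = solve (r ∷ D ∷ Q ∷ [])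
  assoc₂ : ∀ r D Q → D * (r * Q) ≡ r * D * Q
  assoc₂ r D Q = solve (r ∷ D ∷ Q ∷ [])
  go : ∃[ u ] (r ≡ u * u ⊎ r ≡ - (u * u)) → ∃[ t ] D ≡ t * t → ∃[ v ] Q ≡ v * v → r ≡ 0ℤ ⊎ r ≡ D
  go (u , inj₂ p) _ _ = inj₁ (trans p (cong (λ u → - (u * u)) (0≤-sq⇒≡0 u (0≤cancel (D * Q) (- (u * u)) DQ≥1 (0≤sq W by prod p e)))))
    where
    DQ≥1 : 0ℤ ≤ D * Q - 1ℤ
    DQ≥1 = D≥1 ⊗ 0≤Q ⊕ Q≥1 by lem D Q
      where lem : ∀ D Q → (D - 1ℤ) * Q + (Q - 1ℤ) ≡ D * Q - 1ℤ
            lem D Q = solve (D ∷ Q ∷ [])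
    prod : r ≡ - (u * u) → W * W ≡ r * D * Q → W * W ≡ D * Q * - (u * u)
    prod p e = trans e (trans (cong (λ r → r * D * Q) p) (lem u D Q))
      where lem : ∀ u D Q → - (u * u) * D * Q ≡ D * Q * - (u * u)
            lem u D Q = solve (u ∷ D ∷ Q ∷ [])
  go (u , inj₁ p) (t , q) (v , s) = byParity (parity u) (parity t)
    where
    cop-ut : Cop u t
    cop-ut = copDivˡ u u (copDivʳ t t (subst₂ Cop p q h))
    eq : v * v ≡ u * u * (u * u) - u * u * (t * t) + t * t * (t * t)
    eq = trans (sym s) (cong₂ (λ r D → r * r - r * D + D * D) p q)
    D≢0 : D ≢ 0ℤ
    D≢0 z = ¬0≤-1- (0≤n 0) (D≥1 by cong (_- 1ℤ) z)
    zero-or : u ≡ 0ℤ ⊎ t ≡ 0ℤ → r ≡ 0ℤ ⊎ r ≡ D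
    zero-or (inj₁ z) = inj₁ (trans p (cong (λ u → u * u) z))
    zero-or (inj₂ z) = ⊥-elim (D≢0 (trans q (cong (λ t → t * t) z)))
    byParity : Even u ⊎ Odd u → Even t ⊎ Odd t → r ≡ 0ℤ ⊎ r ≡ D
    byParity (inj₁ (i , u≡)) (inj₁ (j , t≡)) = ⊥-elim (even⇒¬cop2 {u} {t} i j u≡ t≡ cop-ut)
    byParity (inj₁ ev) (inj₂ od) = zero-or (quartic₁ u t v cop-ut eq (inj₂ (ev , od)))
    byParity (inj₂ od) (inj₁ ev) = zero-or (quartic₁ u t v cop-ut eq (inj₁ (od , ev)))
    byParity (inj₂ ou) (inj₂ ot) = inj₂ (trans p (trans (quarticOdd u t v cop-ut ou ot eq) (sym q)))

-- The curve of genus 3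

-- The resultants of x² - 3 and of x² + 1 with x³ - x² - x - 1 are powers of 2.
module _ {p q : ℤ} (h : Cop p q) where
  -- The cofactor k takes away the factor 2 that appears when p and q are both odd. Modulo p² - 3q²
  -- the cubic form times p + 2q is -2q⁴.
  cop-3 : ∀ α k → k * α ≡ p * p - + 3 * (q * q) → Cop α (+ 2) → Cop α (+ 2 * (q * (p * p * p - p * p * q - p * q * q - q * q * q)))
  cop-3 α k e α2 = copMul α2 (copMul αq αF)
    where
    αq : Cop α q
    αq = copDivˡ α k (copMod {α * k} {q} {p * p} (+ 3 * q) (lin1 1ℤ e (solve (α ∷ k ∷ p ∷ q ∷ []))) (copSym (copMul (copSym h) (copSym h))))
    αF : Cop α (p * p * p - p * p * q - p * q * q - q * q * q)
    αF = copDivʳ (p * p * p - p * p * q - p * q * q - q * q * q) (p + + 2 * q) (copSym (copMod {(p * p * p - p * p * q - p * q * q - q * q * q) * (p + + 2 * q)} {α} { - (+ 2 * (q * (q * (q * q))))}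
      (- (p * p + p * q) * k) (eq e) (copNeg (subst (λ x → Cop x α) (sym (neg-involutive _)) (copSym (copMul α2 (copMul αq (copMul αq (copMul αq αq)))))))))
      where eq : k * α ≡ p * p - + 3 * (q * q) → (p * p * p - p * p * q - p * q * q - q * q * q) * (p + + 2 * q) + (- (p * p + p * q) * k) * α ≡ - (+ 2 * (q * (q * (q * q))))
            eq e = lin1 (- (p * p + p * q)) e (solve (α ∷ k ∷ p ∷ q ∷ []))

  cop+1 : ∀ β k → k * β ≡ p * p + q * q → Cop β (+ 2) → Cop β (+ 2 * (q * (p * p * p - p * p * q - p * q * q - q * q * q)))
  cop+1 β k e β2 = copMul β2 (copMul βq βF)
    where
    βq : Cop β q
    βq = copDivˡ β k (copMod {β * k} {q} {p * p} (- q) (lin1 1ℤ e (solve (β ∷ k ∷ p ∷ q ∷ []))) (copSym (copMul (copSym h) (copSym h))))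
    βp : Cop β p
    βp = copDivˡ β k (copMod {β * k} {p} {q * q} (- p) (lin1 1ℤ e (solve (β ∷ k ∷ p ∷ q ∷ []))) (copSym (copMul h h)))
    βF : Cop β (p * p * p - p * p * q - p * q * q - q * q * q)
    βF = copSym (copMod {(p * p * p - p * p * q - p * q * q - q * q * q)} {β} { - (+ 2 * (p * (q * q)))} (- (p - q) * k) (eq e)
      (copNeg (subst (λ x → Cop x β) (sym (neg-involutive _)) (copSym (copMul β2 (copMul βp (copMul βq βq)))))))
      where eq : k * β ≡ p * p + q * q → (p * p * p - p * p * q - p * q * q - q * q * q) + (- (p - q) * k) * β ≡ - (+ 2 * (p * (q * q)))
            eq e = lin1 (- (p - q)) e (solve (β ∷ k ∷ p ∷ q ∷ []))

-- Let A = p² - 3q² and B = p² + q². If only q is odd, W² is twice an odd number. If only p is odd,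
-- AB is prime to the other factors and 1 modulo 4, so AB = c², which `Concordant` with σ = -1
-- excludes for q ≠ 0. If both are odd, AB = -4A′B′ where A′B′ is 1 modulo 4 and hence a square. The
-- conclusion leads back to the first equation of the curve, now with a rational root.
genus3 : ∀ p q W → q ≢ 0ℤ → Cop p q →
  W * W ≡ + 2 * q * ((p * p - + 3 * (q * q)) * (p * p + q * q)) * (p * p * p - p * p * q - p * q * q - q * q * q) →
  ∃[ c ] c * c ≡ - ((p * p - + 3 * (q * q)) * (p * p + q * q))
genus3 p q W q≢0 h e = byParity (parity p) (parity q) (parity W)
  where
  Goal : Set
  Goal = ∃[ c ] c * c ≡ - ((p * p - + 3 * (q * q)) * (p * p + q * q))
  W-even : ∀ w → W ≡ + 2 * w + 1ℤ → ⊥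
  W-even w refl = 2∤1 (q * ((p * p - + 3 * (q * q)) * (p * p + q * q)) * (p * p * p - p * p * q - p * q * q - q * q * q) - + 2 * (w * w) - + 2 * w)
    (lin1 -1ℤ e (solve (p ∷ q ∷ w ∷ [])))
  q-odd : ∀ i j w → p ≡ + 2 * i → q ≡ + 2 * j + 1ℤ → W ≡ + 2 * w → ⊥
  q-odd i j w p≡ q≡ W≡ = even⇒¬cop2 {q * ((p * p - + 3 * (q * q)) * (p * p + q * q)) * (p * p * p - p * p * q - p * q * q - q * q * q)} {+ 2} (w * w) 1ℤ
    (cancelˡ (+ 2) (λ ()) (twice W≡)) refl
    (copSym (copMul (copMul (copSym (odd⇒cop2 j q≡)) (copMul (copSym A2) (copSym B2))) (copSym F2)))
    where
    twice : W ≡ + 2 * w → + 2 * (q * ((p * p - + 3 * (q * q)) * (p * p + q * q)) * (p * p * p - p * p * q - p * q * q - q * q * q)) ≡ + 2 * (+ 2 * (w * w))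
    twice refl = lin1 -1ℤ e (solve (p ∷ q ∷ w ∷ []))
    A2 : Cop (p * p - + 3 * (q * q)) (+ 2)
    A2 = odd⇒cop2 (+ 2 * (i * i) - + 6 * (j * j) - + 6 * j - + 2) (lem p≡ q≡)
      where lem : p ≡ + 2 * i → q ≡ + 2 * j + 1ℤ → p * p - + 3 * (q * q) ≡ + 2 * (+ 2 * (i * i) - + 6 * (j * j) - + 6 * j - + 2) + 1ℤ
            lem refl refl = solve (i ∷ j ∷ [])
    B2 : Cop (p * p + q * q) (+ 2)
    B2 = odd⇒cop2 (+ 2 * (i * i) + + 2 * (j * j) + + 2 * j) (lem p≡ q≡)
      where lem : p ≡ + 2 * i → q ≡ + 2 * j + 1ℤ → p * p + q * q ≡ + 2 * (+ 2 * (i * i) + + 2 * (j * j) + + 2 * j) + 1ℤ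
            lem refl refl = solve (i ∷ j ∷ [])
    F2 : Cop (p * p * p - p * p * q - p * q * q - q * q * q) (+ 2)
    F2 = odd⇒cop2 (+ 4 * (i * i * i) - + 2 * (i * i) * q - i * q * q - (+ 4 * (j * j * j) + + 6 * (j * j) + + 3 * j + 1ℤ)) (lem p≡ q≡)
      where lem : p ≡ + 2 * i → q ≡ + 2 * j + 1ℤ → (p * p * p - p * p * q - p * q * q - q * q * q) ≡ + 2 * (+ 4 * (i * i * i) - + 2 * (i * i) * q - i * q * q - (+ 4 * (j * j * j) + + 6 * (j * j) + + 3 * j + 1ℤ)) + 1ℤ
            lem refl refl = solve (i ∷ j ∷ [])
  q-even : ∀ i j → p ≡ + 2 * i + 1ℤ → q ≡ + 2 * j → Goal
  q-even i j p≡ q≡ = go (coprimeSquare {A * B} {+ 2 * (q * (p * p * p - p * p * q - p * q * q - q * q * q))} {W}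
      (copSym (copMul (copSym (cop-3 h A 1ℤ (*-identityˡ A) A2)) (copSym (cop+1 h B 1ℤ (*-identityˡ B) B2)))) prod)
    where
    A B : ℤ
    A = p * p - + 3 * (q * q)
    B = p * p + q * q
    prod : (p * p - + 3 * (q * q)) * (p * p + q * q) * (+ 2 * (q * (p * p * p - p * p * q - p * q * q - q * q * q))) ≡ W * W
    prod = lin1 -1ℤ e (solve (p ∷ q ∷ W ∷ []))
    A2 : Cop A (+ 2)
    A2 = odd⇒cop2 (+ 2 * (i * i) + + 2 * i - + 6 * (j * j)) (lem p≡ q≡)
      where lem : p ≡ + 2 * i + 1ℤ → q ≡ + 2 * j → p * p - + 3 * (q * q) ≡ + 2 * (+ 2 * (i * i) + + 2 * i - + 6 * (j * j)) + 1ℤ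
            lem refl refl = solve (i ∷ j ∷ [])
    B2 : Cop B (+ 2)
    B2 = odd⇒cop2 (+ 2 * (i * i) + + 2 * i + + 2 * (j * j)) (lem p≡ q≡)
      where lem : p ≡ + 2 * i + 1ℤ → q ≡ + 2 * j → p * p + q * q ≡ + 2 * (+ 2 * (i * i) + + 2 * i + + 2 * (j * j)) + 1ℤ
            lem refl refl = solve (i ∷ j ∷ [])
    go : ∃[ c ] (A * B ≡ c * c ⊎ A * B ≡ - (c * c)) → Goal
    go (c , inj₁ s) = ⊥-elim (q≢0 (Concordant.concordant -1ℤ refl c q p (copSym h) (j , q≡) (i , p≡) (swap s)))
      where swap : (p * p - + 3 * (q * q)) * (p * p + q * q) ≡ c * c → c * c ≡ (p * p - -1ℤ * (q * q)) * (p * p + + 3 * -1ℤ * (q * q))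
            swap s = lin1 -1ℤ s (solve (p ∷ q ∷ c ∷ []))
    go (c , inj₂ s) = ⊥-elim (Quartic.¬-square 1ℤ refl (- (+ 2 * (p * p * (j * j)) + + 12 * (j * j * j * j))) (p * p) c (odd² p≡) (as q≡ s))
      where
      odd² : p ≡ + 2 * i + 1ℤ → Odd (p * p)
      odd² refl = + 2 * (i * i) + + 2 * i , solve (i ∷ [])
      as : q ≡ + 2 * j → (p * p - + 3 * (q * q)) * (p * p + q * q) ≡ - (c * c) → p * p * (p * p) + + 4 * (- (+ 2 * (p * p * (j * j)) + + 12 * (j * j * j * j))) ≡ - (c * c)
      as refl s = lin1 1ℤ s (solve (p ∷ j ∷ c ∷ []))
  both-odd : ∀ m n w → p * p ≡ + 8 * m + 1ℤ → q * q ≡ + 8 * n + 1ℤ → W ≡ + 2 * w → Goal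
  both-odd m n w p² q² W≡ = go (coprimeSquare {A′ * B′} { - (+ 2 * (q * (p * p * p - p * p * q - p * q * q - q * q * q)))} {w}
      (copSym (copMul (copSym (cop- (cop-3 h A′ (- + 2) A≡ A2))) (copSym (cop- (cop+1 h B′ (+ 2) B≡ B2))))) (prod W≡))
    where
    A′ B′ : ℤ
    A′ = + 12 * n - + 4 * m + 1ℤ
    B′ = + 4 * m + + 4 * n + 1ℤ
    cop- : ∀ {x y} → Cop x y → Cop x (- y)
    cop- {x} {y} c = copSym (copNeg (subst (λ y → Cop y x) (sym (neg-involutive y)) (copSym c)))
    A2 : Cop A′ (+ 2)
    A2 = odd⇒cop2 (+ 6 * n - + 2 * m) (lem m n)
      where lem : ∀ m n → + 12 * n - + 4 * m + 1ℤ ≡ + 2 * (+ 6 * n - + 2 * m) + 1ℤ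
            lem m n = solve (m ∷ n ∷ [])
    B2 : Cop B′ (+ 2)
    B2 = odd⇒cop2 (+ 2 * m + + 2 * n) (lem m n)
      where lem : ∀ m n → + 4 * m + + 4 * n + 1ℤ ≡ + 2 * (+ 2 * m + + 2 * n) + 1ℤ
            lem m n = solve (m ∷ n ∷ [])
    A≡ : - + 2 * (+ 12 * n - + 4 * m + 1ℤ) ≡ p * p - + 3 * (q * q)
    A≡ = lin2 -1ℤ (+ 3) p² q² (solve (p ∷ q ∷ m ∷ n ∷ []))
    B≡ : + 2 * (+ 4 * m + + 4 * n + 1ℤ) ≡ p * p + q * q
    B≡ = lin2 -1ℤ -1ℤ p² q² (solve (p ∷ q ∷ m ∷ n ∷ []))
    product : (p * p - + 3 * (q * q)) * (p * p + q * q) ≡ - + 4 * (A′ * B′)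
    product = trans (cong₂ _*_ (sym A≡) (sym B≡)) (lem A′ B′)
      where lem : ∀ a b → - + 2 * a * (+ 2 * b) ≡ - + 4 * (a * b)
            lem a b = solve (a ∷ b ∷ [])
    prod : W ≡ + 2 * w → A′ * B′ * - (+ 2 * (q * (p * p * p - p * p * q - p * q * q - q * q * q))) ≡ w * w
    prod W≡ = lem (A′ * B′) (p * p * p - p * p * q - p * q * q - q * q * q) (trans e (cong (λ x → + 2 * q * x * (p * p * p - p * p * q - p * q * q - q * q * q)) product)) W≡
      where
      lem : ∀ x F → W * W ≡ + 2 * q * (- + 4 * x) * F → W ≡ + 2 * w → x * - (+ 2 * (q * F)) ≡ w * w
      lem x F e refl = cancelˡ (+ 4) (λ ()) (lin1 -1ℤ e (solve (x ∷ F ∷ q ∷ w ∷ [])))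
    go : ∃[ c ] (A′ * B′ ≡ c * c ⊎ A′ * B′ ≡ - (c * c)) → Goal
    go (c , inj₁ s) = + 2 * c , sym (trans (cong -_ (trans product (cong (- + 4 *_) s))) (lem c))
      where lem : ∀ c → - (- + 4 * (c * c)) ≡ + 2 * c * (+ 2 * c)
            lem c = solve (c ∷ [])
    go (c , inj₂ s) = ⊥-elim (Quartic.¬-square 1ℤ refl ((+ 3 * n - m) * (+ 4 * m + + 4 * n + 1ℤ) + m + n) 1ℤ c (0ℤ , refl) (trans (lem m n) s))
      where lem : ∀ m n → 1ℤ * 1ℤ + + 4 * ((+ 3 * n - m) * (+ 4 * m + + 4 * n + 1ℤ) + m + n) ≡ (+ 12 * n - + 4 * m + 1ℤ) * (+ 4 * m + + 4 * n + 1ℤ)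
            lem m n = solve (m ∷ n ∷ [])
  byParity : Even p ⊎ Odd p → Even q ⊎ Odd q → Even W ⊎ Odd W → Goal
  byParity _ _ (inj₂ (w , W≡)) = ⊥-elim (W-even w W≡)
  byParity (inj₁ (i , p≡)) (inj₁ (j , q≡)) _ = ⊥-elim (even⇒¬cop2 {p} {q} i j p≡ q≡ h)
  byParity (inj₁ (i , p≡)) (inj₂ (j , q≡)) (inj₁ (w , W≡)) = ⊥-elim (q-odd i j w p≡ q≡ W≡)
  byParity (inj₂ (i , p≡)) (inj₁ (j , q≡)) _ = q-even i j p≡ q≡
  byParity (inj₂ op) (inj₂ oq) (inj₁ (w , W≡)) = squared (Quartic.odd-sq 1ℤ refl p op) (Quartic.odd-sq 1ℤ refl q oq)
    where
    squared : ∃[ m ] p * p ≡ + 8 * m + 1ℤ → ∃[ n ] q * q ≡ + 8 * n + 1ℤ → Goal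
    squared (m , p²) (n , q²) = both-odd m n w p² q² W≡

-- Transfer from ℤ to ℚ

ℚring : AlmostCommutativeRing 0ℓ 0ℓ
ℚring = fromCommutativeRing ℚ.+-*-commutativeRing λ x → dec⇒maybe (0ℚ ℚ.≟ x)

open LinearCombination _+ᵠ_ _*ᵠ_ (∙-cancelʳ (AbelianGroup.group ℚ.+-0-abelianGroup))
  renaming (lin1 to linℚ1; lin2 to linℚ2; lin3 to linℚ3)

ι : ℤ → ℚ
ι n = n / 1

-- `n / 1` is normalised by a gcd and does not reduce for a variable n. This form has denominator 1
-- by definition, so sums and products of such numbers compute.
ι′ : ℤ → ℚ
ι′ n = mkℚ n 0 (ℕC.sym (ℕC.1-coprimeTo (abs n)))

ι≡ι′ : ∀ n → ι n ≡ ι′ n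
ι≡ι′ n = ℚ.↥p/↧p≡p (ι′ n)

ι-+ : ∀ m n → ι (m + n) ≡ ι m +ᵠ ι n
ι-+ m n = trans (cong₂ (λ x y → ι (x + y)) (sym (*-identityʳ m)) (sym (*-identityʳ n)))
  (sym (cong₂ _+ᵠ_ (ι≡ι′ m) (ι≡ι′ n)))

ι-* : ∀ m n → ι (m * n) ≡ ι m *ᵠ ι n
ι-* m n = sym (cong₂ _*ᵠ_ (ι≡ι′ m) (ι≡ι′ n))

ι-injective : ∀ {m n} → ι m ≡ ι n → m ≡ n
ι-injective {m} {n} e = cong ↥_ (trans (sym (ι≡ι′ m)) (trans e (ι≡ι′ n)))

ι-neg : ∀ m → ι (- m) ≡ -ᵠ ι m
ι-neg m = fin (trans (sym (ι-+ m (- m))) (cong ι (+-inverseʳ m)))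
  where fin : ι m +ᵠ ι (- m) ≡ 0ℚ → ι (- m) ≡ -ᵠ ι m
        fin = lem (ι m) (ι (- m))
          where lem : ∀ x y → x +ᵠ y ≡ 0ℚ → y ≡ -ᵠ x
                lem x y e = linℚ1 1ℚ e (Solver.solve (x ∷ y ∷ []) ℚring)

-- Cast m x says that x is the image of the integer m; m is not inferable from ι m.
record Cast (m : ℤ) (x : ℚ) : Set where
  constructor cast
  field ι≡ : ι m ≡ x
open Cast

infixl 6 _⟨+⟩_ _⟨-⟩_
infixl 7 _⟨*⟩_
_⟨+⟩_ : ∀ {m n x y} → Cast m x → Cast n y → Cast (m + n) (x +ᵠ y)
_⟨+⟩_ {m} {n} (cast refl) (cast refl) = cast (ι-+ m n)

_⟨*⟩_ : ∀ {m n x y} → Cast m x → Cast n y → Cast (m * n) (x *ᵠ y)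
_⟨*⟩_ {m} {n} (cast refl) (cast refl) = cast (ι-* m n)

⟨-⟩_ : ∀ {m x} → Cast m x → Cast (- m) (-ᵠ x)
⟨-⟩_ {m} (cast refl) = cast (ι-neg m)

_⟨-⟩_ : ∀ {m n x y} → Cast m x → Cast n y → Cast (m - n) (x -ᵠ y)
p ⟨-⟩ q = p ⟨+⟩ (⟨-⟩ q)

con : ∀ n → Cast n (ι n)
con n = cast refl

cast-injective : ∀ {m n x y} → Cast m x → Cast n y → x ≡ y → m ≡ n
cast-injective (cast p) (cast q) e = ι-injective (trans p (trans e (sym q)))

ι≢0 : ∀ {n} → n ≢ 0ℤ → ι n ≢ 0ℚ
ι≢0 h e = h (ι-injective e)

noZeroDivℚ : ∀ x y → x *ᵠ y ≡ 0ℚ → x ≡ 0ℚ ⊎ y ≡ 0ℚ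
noZeroDivℚ x y e = go (x ℚ.≟ 0ℚ)
  where
  go : Dec (x ≡ 0ℚ) → x ≡ 0ℚ ⊎ y ≡ 0ℚ
  go (yes p) = inj₁ p
  go (no p) = inj₂ (trans (sym (ℚ.*-identityˡ y)) (trans (cong (_*ᵠ y) (sym (ℚ.*-inverseˡ x {{nz}}))) (trans (ℚ.*-assoc (Data.Rational.1/_ x {{nz}}) x y)
      (trans (cong (Data.Rational.1/_ x {{nz}} *ᵠ_) e) (ℚ.*-zeroʳ (Data.Rational.1/_ x {{nz}}))))))
    where nz = Data.Rational.≢-nonZero p

cancelℚ : ∀ x {y z} → x ≢ 0ℚ → x *ᵠ y ≡ x *ᵠ z → y ≡ z
cancelℚ x {y} {z} h e = either (noZeroDivℚ x (y -ᵠ z) (lem e)) (λ p → ⊥-elim (h p)) fin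
  where
  lem : x *ᵠ y ≡ x *ᵠ z → x *ᵠ (y -ᵠ z) ≡ 0ℚ
  lem e = linℚ1 1ℚ e (Solver.solve (x ∷ y ∷ z ∷ []) ℚring)
  fin : y -ᵠ z ≡ 0ℚ → y ≡ z
  fin p = linℚ1 1ℚ p (Solver.solve (y ∷ z ∷ []) ℚring)

ratio-↥↧ : ∀ x → x *ᵠ ι (+ ↧ₙ x) ≡ ι (↥ x)
ratio-↥↧ x@(mkℚ p d _) = trans (cong (x *ᵠ_) (ι≡ι′ (+ suc d))) (trans (ℚ.toℚᵘ-injective (ℚᵘ.≃-trans (ℚ.toℚᵘ-homo-* x (ι′ (+ suc d)))
  (ℚᵘ.*≡* (lem p (+ suc d) (+ (suc d ℕ.* 1)) (cong +_ (ℕ.*-identityʳ (suc d))))))) (sym (ι≡ι′ p)))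
  where lem : ∀ p q r → r ≡ q → p * q * + 1 ≡ p * r
        lem p q r refl = *-identityʳ (p * q)

record Ratio (x : ℚ) : Set where
  constructor ratio
  field
    p q : ℤ
    q≥1 : 0ℤ ≤ q - 1ℤ
    cop : Cop p q
    xq≡p : x *ᵠ ι q ≡ ι p

  q≢0 : q ≢ 0ℤ
  q≢0 e = ¬0≤-1- (0≤n 0) (q≥1 by cong (_- 1ℤ) e)

ratio-of : ∀ x → Ratio x
ratio-of x@(mkℚ n d _) = go (reduce n (+ suc d))
  where
  go : Reduced n (+ suc d) → Ratio x
  go (reduced {g} {p} {q} 0≤g n≡ d≡ cop) = ratio p q q≥1 cop
      (cancelℚ (ι g) (ι≢0 g≢0) (lem x (ι g) (ι q) (ι p) (trans (cong (x *ᵠ_) (trans (sym (ι-* g q)) (cong ι (sym d≡)))) (trans (ratio-↥↧ x) (trans (cong ι n≡) (ι-* g p))))))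
    where
    g≢0 : g ≢ 0ℤ
    g≢0 refl = absurd d≡
      where absurd : + suc d ≡ 0ℤ → ⊥
            absurd ()
    lem : ∀ x g q p → x *ᵠ (g *ᵠ q) ≡ g *ᵠ p → g *ᵠ (x *ᵠ q) ≡ g *ᵠ p
    lem x g q p e = linℚ1 1ℚ e (Solver.solve (x ∷ g ∷ q ∷ p ∷ []) ℚring)
    q≥1 : 0ℤ ≤ q - 1ℤ
    q≥1 = either (0≤⊎0< (q - 1ℤ)) (λ h → h) λ h → ⊥-elim (¬0≤-1- (0≤n d) (0≤g ⊗ neg h by lem′ (+ d) d≡))
      where
      neg : 0ℤ ≤ - (q - 1ℤ) - 1ℤ → 0ℤ ≤ - q
      neg h = h by solve (q ∷ [])
      lem′ : ∀ d → 1ℤ + d ≡ g * q → g * - q ≡ - d - 1ℤ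
      lem′ d e = lin1 1ℤ e (solve (d ∷ g ∷ q ∷ []))

sqrt-int : ∀ w n → w *ᵠ w ≡ ι n → ∃[ m ] m * m ≡ n
sqrt-int w n e = go (ratio-of w)
  where
  go : Ratio w → ∃[ m ] m * m ≡ n
  go (ratio p q q≥1 cop wq) = fin (unit-q (euclid {q} {p} {1ℤ} (copSym cop) (euclid {q} {p} {p * 1ℤ} (copSym cop) (divides (n * q) (lem eq)))))
    where
    eq : p * p ≡ n * (q * q)
    eq = cast-injective (cast {p} (sym wq) ⟨*⟩ cast {p} (sym wq)) (con n ⟨*⟩ (con q ⟨*⟩ con q)) (alg w (ι q) (ι n) e)
      where alg : ∀ w q n → w *ᵠ w ≡ n → w *ᵠ q *ᵠ (w *ᵠ q) ≡ n *ᵠ (q *ᵠ q)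
            alg w q n e = linℚ1 (q *ᵠ q) e (Solver.solve (w ∷ q ∷ n ∷ []) ℚring)
    lem : p * p ≡ n * (q * q) → p * (p * 1ℤ) ≡ n * q * q
    lem e = lin1 1ℤ e (solve (p ∷ q ∷ n ∷ []))
    unit-q : q ∣ 1ℤ → q * q ≡ 1ℤ
    unit-q (divides k e) = ±1-sq q (unit {k} q (trans (*-comm q k) (sym e)))
    fin : q * q ≡ 1ℤ → ∃[ m ] m * m ≡ n
    fin qq = p , trans eq (trans (cong (n *_) qq) (*-identityʳ n))

-- For x = p / q the number yq² has an integral square and so is an integer by `sqrt-int`; the
-- denominator of y need not be studied.
cubicSquareℚ : ∀ x y → y *ᵠ y ≡ x *ᵠ (x *ᵠ x -ᵠ x +ᵠ 1ℚ) → x ≡ 0ℚ ⊎ x ≡ 1ℚ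
cubicSquareℚ x y e = go (ratio-of x)
  where
  go : Ratio x → x ≡ 0ℚ ⊎ x ≡ 1ℚ
  go R@(ratio p q q≥1 cop xq) = conclude (sqrt-int (y *ᵠ ι q *ᵠ ι q) (p * q * (p * p - p * q + q * q)) eq)
    where
    P : Cast p (x *ᵠ ι q)
    P = cast (sym xq)
    alg : ∀ x y q → y *ᵠ y ≡ x *ᵠ (x *ᵠ x -ᵠ x +ᵠ 1ℚ) → y *ᵠ q *ᵠ q *ᵠ (y *ᵠ q *ᵠ q) ≡
      x *ᵠ q *ᵠ q *ᵠ (x *ᵠ q *ᵠ (x *ᵠ q) -ᵠ x *ᵠ q *ᵠ q +ᵠ q *ᵠ q)
    alg x y q e = linℚ1 (q *ᵠ q *ᵠ q *ᵠ q) e (Solver.solve (x ∷ y ∷ q ∷ []) ℚring)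
    eq : y *ᵠ ι q *ᵠ ι q *ᵠ (y *ᵠ ι q *ᵠ ι q) ≡ ι (p * q * (p * p - p * q + q * q))
    eq = trans (alg x y (ι q) e) (sym (ι≡ (P ⟨*⟩ con q ⟨*⟩ (P ⟨*⟩ P ⟨-⟩ P ⟨*⟩ con q ⟨+⟩ con q ⟨*⟩ con q))))
    q≢0 : ι q ≢ 0ℚ
    q≢0 = ι≢0 (Ratio.q≢0 R)
    conclude : ∃[ W ] W * W ≡ p * q * (p * p - p * q + q * q) → x ≡ 0ℚ ⊎ x ≡ 1ℚ
    conclude (W , W²) = either (cubicSquare p q W cop q≥1 W²)
      (λ p≡0 → either (noZeroDivℚ x (ι q) (trans xq (cong ι p≡0))) inj₁ λ q≡0 → ⊥-elim (q≢0 q≡0))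
      λ p≡q → inj₂ (cancelℚ (ι q) q≢0 (trans (ℚ.*-comm (ι q) x) (trans xq (trans (cong ι p≡q) (sym (ℚ.*-identityʳ (ι q)))))))

modularCurve : ∀ x y → y *ᵠ (y +ᵠ 1ℚ) ≡ x *ᵠ x *ᵠ (x -ᵠ 1ℚ) → x ≡ 0ℚ ⊎ x ≡ 1ℚ
modularCurve x y e = go (ratio-of x) (ratio-of y)
  where
  go : Ratio x → Ratio y → x ≡ 0ℚ ⊎ x ≡ 1ℚ
  go R@(ratio p q _ _ xq) R′@(ratio a b _ _ yb) = conclude (lowestTerms p q a b (Ratio.q≢0 R) (Ratio.q≢0 R′) eq)
    where
    P : Cast p (x *ᵠ ι q)
    P = cast (sym xq)
    A : Cast a (y *ᵠ ι b)
    A = cast (sym yb)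
    alg : ∀ x y q b → y *ᵠ (y +ᵠ 1ℚ) ≡ x *ᵠ x *ᵠ (x -ᵠ 1ℚ) →
      y *ᵠ b *ᵠ (y *ᵠ b +ᵠ b) *ᵠ (q *ᵠ q *ᵠ q) ≡ b *ᵠ b *ᵠ (x *ᵠ q *ᵠ (x *ᵠ q) *ᵠ (x *ᵠ q -ᵠ q))
    alg x y q b e = linℚ1 (q *ᵠ q *ᵠ q *ᵠ b *ᵠ b) e (Solver.solve (x ∷ y ∷ q ∷ b ∷ []) ℚring)
    eq : a * (a + b) * (q * q * q) ≡ b * b * (p * p * (p - q))
    eq = cast-injective (A ⟨*⟩ (A ⟨+⟩ con b) ⟨*⟩ (con q ⟨*⟩ con q ⟨*⟩ con q)) (con b ⟨*⟩ con b ⟨*⟩ (P ⟨*⟩ P ⟨*⟩ (P ⟨-⟩ con q)))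
      (alg x y (ι q) (ι b) e)
    q≢0 : ι q ≢ 0ℚ
    q≢0 = ι≢0 (Ratio.q≢0 R)
    zero-one : p ≡ 0ℤ ⊎ p ≡ q → x ≡ 0ℚ ⊎ x ≡ 1ℚ
    zero-one (inj₁ p≡0) = either (noZeroDivℚ x (ι q) (trans xq (cong ι p≡0))) inj₁ λ q≡0 → ⊥-elim (q≢0 q≡0)
    zero-one (inj₂ p≡q) = inj₂ (cancelℚ (ι q) q≢0 (trans (ℚ.*-comm (ι q) x) (trans xq (trans (cong ι p≡q) (sym (ℚ.*-identityʳ (ι q)))))))
    conclude : Lowest p q → x ≡ 0ℚ ⊎ x ≡ 1ℚ
    conclude (lowest g r t w p≡ q≡ h c) = byTorsion (torsion r t w h c)
      where
      byTorsion : Torsion r t → x ≡ 0ℚ ⊎ x ≡ 1ℚ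
      byTorsion (at-∞ refl) = ⊥-elim (Ratio.q≢0 R (trans q≡ (*-zeroʳ g)))
      byTorsion (at-0 refl) = zero-one (inj₁ (trans p≡ (*-zeroʳ g)))
      byTorsion (at-1 refl) = zero-one (inj₂ (trans p≡ (sym q≡)))

genus3ℚ : ∀ x w → w *ᵠ w ≡ ι (+ 2) *ᵠ (x *ᵠ x -ᵠ ι (+ 3)) *ᵠ (x *ᵠ x +ᵠ 1ℚ) *ᵠ (x *ᵠ x *ᵠ x -ᵠ x *ᵠ x -ᵠ x -ᵠ 1ℚ) →
  ∃[ v ] v *ᵠ v ≡ -ᵠ ((x *ᵠ x -ᵠ ι (+ 3)) *ᵠ (x *ᵠ x +ᵠ 1ℚ))
genus3ℚ x w e = go (ratio-of x)
  where
  Goal : Set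
  Goal = ∃[ v ] v *ᵠ v ≡ -ᵠ ((x *ᵠ x -ᵠ ι (+ 3)) *ᵠ (x *ᵠ x +ᵠ 1ℚ))
  go : Ratio x → Goal
  go R@(ratio p q _ cop xq) = conclude (sqrt-int (w *ᵠ ι q *ᵠ ι q *ᵠ ι q *ᵠ ι q) (+ 2 * q * ((p * p - + 3 * (q * q)) * (p * p + q * q)) * (p * p * p - p * p * q - p * q * q - q * q * q)) eq)
    where
    P : Cast p (x *ᵠ ι q)
    P = cast (sym xq)
    alg : ∀ x w q → w *ᵠ w ≡ ι (+ 2) *ᵠ (x *ᵠ x -ᵠ ι (+ 3)) *ᵠ (x *ᵠ x +ᵠ 1ℚ) *ᵠ (x *ᵠ x *ᵠ x -ᵠ x *ᵠ x -ᵠ x -ᵠ 1ℚ) →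
      w *ᵠ q *ᵠ q *ᵠ q *ᵠ q *ᵠ (w *ᵠ q *ᵠ q *ᵠ q *ᵠ q) ≡
      ι (+ 2) *ᵠ q *ᵠ ((x *ᵠ q *ᵠ (x *ᵠ q) -ᵠ ι (+ 3) *ᵠ (q *ᵠ q)) *ᵠ (x *ᵠ q *ᵠ (x *ᵠ q) +ᵠ q *ᵠ q))
        *ᵠ (x *ᵠ q *ᵠ (x *ᵠ q) *ᵠ (x *ᵠ q) -ᵠ x *ᵠ q *ᵠ (x *ᵠ q) *ᵠ q -ᵠ x *ᵠ q *ᵠ q *ᵠ q -ᵠ q *ᵠ q *ᵠ q)
    alg x w q e = linℚ1 (q *ᵠ q *ᵠ q *ᵠ q *ᵠ q *ᵠ q *ᵠ q *ᵠ q) e (Solver.solve (x ∷ w ∷ q ∷ []) ℚring)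
    eq : w *ᵠ ι q *ᵠ ι q *ᵠ ι q *ᵠ ι q *ᵠ (w *ᵠ ι q *ᵠ ι q *ᵠ ι q *ᵠ ι q) ≡ ι (+ 2 * q * ((p * p - + 3 * (q * q)) * (p * p + q * q)) * (p * p * p - p * p * q - p * q * q - q * q * q))
    eq = trans (alg x w (ι q) e) (sym (ι≡ (con (+ 2) ⟨*⟩ con q ⟨*⟩ ((P ⟨*⟩ P ⟨-⟩ con (+ 3) ⟨*⟩ (con q ⟨*⟩ con q)) ⟨*⟩ (P ⟨*⟩ P ⟨+⟩ con q ⟨*⟩ con q))
      ⟨*⟩ (P ⟨*⟩ P ⟨*⟩ P ⟨-⟩ P ⟨*⟩ P ⟨*⟩ con q ⟨-⟩ P ⟨*⟩ con q ⟨*⟩ con q ⟨-⟩ con q ⟨*⟩ con q ⟨*⟩ con q))))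
    q≢0 : ι q ≢ 0ℚ
    q≢0 = ι≢0 (Ratio.q≢0 R)
    instance
      nz = Data.Rational.≢-nonZero q≢0
    j : ℚ
    j = Data.Rational.1/ ι q
    conclude : ∃[ W ] W * W ≡ + 2 * q * ((p * p - + 3 * (q * q)) * (p * p + q * q)) * (p * p * p - p * p * q - p * q * q - q * q * q) → Goal
    conclude (W , W²) = fin (genus3 p q W (Ratio.q≢0 R) cop W²)
      where
      fin : ∃[ c ] c * c ≡ - ((p * p - + 3 * (q * q)) * (p * p + q * q)) → Goal
      fin (c , c²) = ι c *ᵠ j *ᵠ j , lem x (ι c) (ι q) j (ℚ.*-inverseʳ (ι q))
          (trans (sym (ι≡ (con c ⟨*⟩ con c))) (trans (cong ι c²) (ι≡ (⟨-⟩ ((P ⟨*⟩ P ⟨-⟩ con (+ 3) ⟨*⟩ (con q ⟨*⟩ con q)) ⟨*⟩ (P ⟨*⟩ P ⟨+⟩ con q ⟨*⟩ con q))))))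
        where
        lem : ∀ x c q j → q *ᵠ j ≡ 1ℚ → c *ᵠ c ≡ -ᵠ ((x *ᵠ q *ᵠ (x *ᵠ q) -ᵠ ι (+ 3) *ᵠ (q *ᵠ q)) *ᵠ (x *ᵠ q *ᵠ (x *ᵠ q) +ᵠ q *ᵠ q)) →
          c *ᵠ j *ᵠ j *ᵠ (c *ᵠ j *ᵠ j) ≡ -ᵠ ((x *ᵠ x -ᵠ ι (+ 3)) *ᵠ (x *ᵠ x +ᵠ 1ℚ))
        lem x c q j qj e = trans (step₁ x c q j e) (trans (cong (λ y → -ᵠ ((x *ᵠ x -ᵠ ι (+ 3)) *ᵠ (x *ᵠ x +ᵠ 1ℚ)) *ᵠ (y *ᵠ y *ᵠ y *ᵠ y)) qj)
            (step₂ (-ᵠ ((x *ᵠ x -ᵠ ι (+ 3)) *ᵠ (x *ᵠ x +ᵠ 1ℚ)))))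
          where
          step₁ : ∀ x c q j → c *ᵠ c ≡ -ᵠ ((x *ᵠ q *ᵠ (x *ᵠ q) -ᵠ ι (+ 3) *ᵠ (q *ᵠ q)) *ᵠ (x *ᵠ q *ᵠ (x *ᵠ q) +ᵠ q *ᵠ q)) →
            c *ᵠ j *ᵠ j *ᵠ (c *ᵠ j *ᵠ j) ≡ -ᵠ ((x *ᵠ x -ᵠ ι (+ 3)) *ᵠ (x *ᵠ x +ᵠ 1ℚ)) *ᵠ (q *ᵠ j *ᵠ (q *ᵠ j) *ᵠ (q *ᵠ j) *ᵠ (q *ᵠ j))
          step₁ x c q j e = linℚ1 (j *ᵠ j *ᵠ j *ᵠ j) e (Solver.solve (x ∷ c ∷ q ∷ j ∷ []) ℚring)
          step₂ : ∀ z → z *ᵠ (1ℚ *ᵠ 1ℚ *ᵠ 1ℚ *ᵠ 1ℚ) ≡ z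
          step₂ z = ℚ.*-identityʳ z

module _ {D : ℚ} (nonsquare : ∀ r → r *ᵠ r ≢ D) where
  NonSquare⇒≡0 : ∀ x t → D *ᵠ (x *ᵠ x) ≡ t *ᵠ t → x ≡ 0ℚ
  NonSquare⇒≡0 x t e = go (x ℚ.≟ 0ℚ)
    where
    go : Dec (x ≡ 0ℚ) → x ≡ 0ℚ
    go (yes p) = p
    go (no p) = ⊥-elim (nonsquare (t *ᵠ j) (trans (lem D x t j e) (trans (cong (λ y → D *ᵠ (y *ᵠ y)) (ℚ.*-inverseʳ x {{nz}})) (ℚ.*-identityʳ D))))
      where
      nz = Data.Rational.≢-nonZero p
      j : ℚ
      j = Data.Rational.1/_ x {{nz}}
      lem : ∀ D x t j → D *ᵠ (x *ᵠ x) ≡ t *ᵠ t → t *ᵠ j *ᵠ (t *ᵠ j) ≡ D *ᵠ (x *ᵠ j *ᵠ (x *ᵠ j))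
      lem D x t j e = linℚ1 (-ᵠ (j *ᵠ j)) e (Solver.solve (D ∷ x ∷ t ∷ j ∷ []) ℚring)

no-sqrt : ∀ n {x} → (∀ m → m * m ≢ n) → x *ᵠ x ≢ ι n
no-sqrt n {x} h e = go (sqrt-int x n e)
  where go : ∃[ m ] m * m ≡ n → ⊥
        go (m , p) = h m p

negative≢sq : ∀ n m → m * m ≢ -[1+ n ]
negative≢sq n m e = ¬0≤-1- (0≤n n) (0≤sq m by trans e (lem (+ n)))
  where lem : ∀ n → - (1ℤ + n) ≡ - n - 1ℤ
        lem n = solve (n ∷ [])

3≢sq : ∀ m → m * m ≢ + 3
3≢sq m e = go (parity m)
  where
  go : Even m ⊎ Odd m → ⊥
  go (inj₁ (k , refl)) = ¬mult 3 2 (k * k) (ℕ.s≤s (ℕ.s≤s (ℕ.s≤s ℕ.z≤n))) (lin1 1ℤ e (solve (k ∷ [])))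
  go (inj₂ (k , refl)) = ¬mult 3 1 (k * k + k) (ℕ.s≤s (ℕ.s≤s ℕ.z≤n)) (lin1 1ℤ e (solve (k ∷ [])))

sq≡0ℚ : ∀ x → x *ᵠ x ≡ 0ℚ → x ≡ 0ℚ
sq≡0ℚ x e = either (noZeroDivℚ x x e) (λ p → p) (λ p → p)

sumSq≡0 : ∀ x y → x *ᵠ x +ᵠ y *ᵠ y ≡ 0ℚ → x ≡ 0ℚ × y ≡ 0ℚ
sumSq≡0 x y e = x≡0 , y≡0 (x≡0)
  where
  x≡0 : x ≡ 0ℚ
  x≡0 = NonSquare⇒≡0 {ι -1ℤ} (λ r → no-sqrt -1ℤ {r} (negative≢sq 0)) x y (linℚ1 (-ᵠ 1ℚ) e (Solver.solve (x ∷ y ∷ []) ℚring))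
  y≡0 : x ≡ 0ℚ → y ≡ 0ℚ
  y≡0 p = sq≡0ℚ y (linℚ2 1ℚ (-ᵠ x) e p (Solver.solve (x ∷ y ∷ []) ℚring))

-- Quadratic points on the two curves of genus 1

½ ¼ ⅛ : ℚ
½ = + 1 / 2
¼ = + 1 / 4
⅛ = + 1 / 8

-- x = x₁ + √e is quadratic with trace s = 2x₁ and norm n = x₁² - e, and a + b x is a square
-- root of 3 + 2x² - x⁴. The rational point (p, 2as + b(2n - p)) of Y² = (p + 2)(p² + 12), where
-- p = s² - 2 + b², has p = ±2.
data Parametrised₁ (x₁ e a : ℚ) : Set where
  trace0 : x₁ ≡ 0ℚ → a *ᵠ a ≡ ι (+ 4) -ᵠ (1ℚ -ᵠ e) *ᵠ (1ℚ -ᵠ e) → Parametrised₁ x₁ e a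
  conic : ι (+ 4) *ᵠ (x₁ *ᵠ x₁) +ᵠ (x₁ *ᵠ x₁ -ᵠ e -ᵠ 1ℚ) *ᵠ (x₁ *ᵠ x₁ -ᵠ e -ᵠ 1ℚ) ≡ ι (+ 4) → Parametrised₁ x₁ e a

-- Write T⁴ - 2T² - 3 + (a + bT)² = (T² - sT + n)(T² + sT + n′). Then p = n + n′, and comparison of
-- coefficients gives s² + b² = p + 2, s(n - n′) = 2ab and nn′ = a² - 3. The two hypotheses express
-- the divisibility in terms of x and e.
parametrise₁ : ∀ x e a b →
  (a +ᵠ b *ᵠ x) *ᵠ (a +ᵠ b *ᵠ x) +ᵠ b *ᵠ b *ᵠ e ≡ -ᵠ ((x *ᵠ x +ᵠ e -ᵠ ι (+ 3)) *ᵠ (x *ᵠ x +ᵠ e +ᵠ 1ℚ) +ᵠ ι (+ 4) *ᵠ (x *ᵠ x *ᵠ e)) →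
  (a +ᵠ b *ᵠ x) *ᵠ b ≡ -ᵠ (x *ᵠ (ι (+ 2) *ᵠ (x *ᵠ x +ᵠ e) -ᵠ ι (+ 2))) → Parametrised₁ x e a
parametrise₁ x e a b E₁ E₂ = either (cubicSquareℚ (¼ *ᵠ (p +ᵠ ι (+ 2))) (⅛ *ᵠ y) (scaled p y point)) (λ z → p≡-2 (double z)) λ z → p≡2 (four z)
  where
  p s n δ y : ℚ
  p = ι (+ 4) *ᵠ (x *ᵠ x) -ᵠ ι (+ 2) +ᵠ b *ᵠ b
  s = ι (+ 2) *ᵠ x
  n = x *ᵠ x -ᵠ e
  δ = ι (+ 2) *ᵠ n -ᵠ p
  y = ι (+ 2) *ᵠ (a *ᵠ s) +ᵠ b *ᵠ δ
  sδ : ι (+ 2) *ᵠ x *ᵠ (ι (+ 2) *ᵠ (x *ᵠ x -ᵠ e) -ᵠ (ι (+ 4) *ᵠ (x *ᵠ x) -ᵠ ι (+ 2) +ᵠ b *ᵠ b)) ≡ ι (+ 2) *ᵠ (a *ᵠ b)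
  sδ = linℚ1 (-ᵠ ι (+ 2)) E₂ (Solver.solve (x ∷ e ∷ a ∷ b ∷ []) ℚring)
  nn′ : (x *ᵠ x -ᵠ e) *ᵠ ((ι (+ 4) *ᵠ (x *ᵠ x) -ᵠ ι (+ 2) +ᵠ b *ᵠ b) -ᵠ (x *ᵠ x -ᵠ e)) ≡ a *ᵠ a -ᵠ ι (+ 3)
  nn′ = linℚ2 (-ᵠ 1ℚ) (ι (+ 2) *ᵠ x) E₁ E₂ (Solver.solve (x ∷ e ∷ a ∷ b ∷ []) ℚring)
  -- With δ = n - n′, the two-square identity (2as + bδ)² + (sδ - 2ab)² = (s² + b²)(4a² + δ²)
  -- applies: the second square vanishes and 4a² + δ² = p² + 12.
  point : y *ᵠ y ≡ (p +ᵠ ι (+ 2)) *ᵠ (p *ᵠ p +ᵠ ι (+ 12))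
  point = lem s n p a b (lem₀ x b) sδ nn′
    where
    lem₀ : ∀ x b → ι (+ 4) *ᵠ (x *ᵠ x) -ᵠ ι (+ 2) +ᵠ b *ᵠ b ≡ ι (+ 2) *ᵠ x *ᵠ (ι (+ 2) *ᵠ x) -ᵠ ι (+ 2) +ᵠ b *ᵠ b
    lem₀ x b = Solver.solve (x ∷ b ∷ []) ℚring
    lem : ∀ s n p a b → p ≡ s *ᵠ s -ᵠ ι (+ 2) +ᵠ b *ᵠ b → s *ᵠ (ι (+ 2) *ᵠ n -ᵠ p) ≡ ι (+ 2) *ᵠ (a *ᵠ b) → n *ᵠ (p -ᵠ n) ≡ a *ᵠ a -ᵠ ι (+ 3) →
      (ι (+ 2) *ᵠ (a *ᵠ s) +ᵠ b *ᵠ (ι (+ 2) *ᵠ n -ᵠ p)) *ᵠ (ι (+ 2) *ᵠ (a *ᵠ s) +ᵠ b *ᵠ (ι (+ 2) *ᵠ n -ᵠ p)) ≡ (p +ᵠ ι (+ 2)) *ᵠ (p *ᵠ p +ᵠ ι (+ 12))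
    lem s n p a b P S Q = linℚ3 (-ᵠ (p *ᵠ p +ᵠ ι (+ 12))) (-ᵠ (s *ᵠ (ι (+ 2) *ᵠ n -ᵠ p) -ᵠ ι (+ 2) *ᵠ (a *ᵠ b))) (-ᵠ (ι (+ 4) *ᵠ (s *ᵠ s +ᵠ b *ᵠ b))) P S Q
      (Solver.solve (s ∷ n ∷ p ∷ a ∷ b ∷ []) ℚring)
  scaled : ∀ p y → y *ᵠ y ≡ (p +ᵠ ι (+ 2)) *ᵠ (p *ᵠ p +ᵠ ι (+ 12)) →
    ⅛ *ᵠ y *ᵠ (⅛ *ᵠ y) ≡ ¼ *ᵠ (p +ᵠ ι (+ 2)) *ᵠ (¼ *ᵠ (p +ᵠ ι (+ 2)) *ᵠ (¼ *ᵠ (p +ᵠ ι (+ 2))) -ᵠ ¼ *ᵠ (p +ᵠ ι (+ 2)) +ᵠ 1ℚ)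
  scaled p y e = linℚ1 (⅛ *ᵠ ⅛) e (Solver.solve (p ∷ y ∷ []) ℚring)
  double : ¼ *ᵠ (p +ᵠ ι (+ 2)) ≡ 0ℚ → ι (+ 2) *ᵠ x *ᵠ (ι (+ 2) *ᵠ x) +ᵠ b *ᵠ b ≡ 0ℚ
  double z = lem z
    where lem : ¼ *ᵠ (ι (+ 4) *ᵠ (x *ᵠ x) -ᵠ ι (+ 2) +ᵠ b *ᵠ b +ᵠ ι (+ 2)) ≡ 0ℚ → ι (+ 2) *ᵠ x *ᵠ (ι (+ 2) *ᵠ x) +ᵠ b *ᵠ b ≡ 0ℚ
          lem z = linℚ1 (ι (+ 4)) z (Solver.solve (x ∷ b ∷ []) ℚring)
  four : ¼ *ᵠ (p +ᵠ ι (+ 2)) ≡ 1ℚ → ι (+ 4) *ᵠ (x *ᵠ x) +ᵠ b *ᵠ b ≡ ι (+ 4)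
  four z = lem z
    where lem : ¼ *ᵠ (ι (+ 4) *ᵠ (x *ᵠ x) -ᵠ ι (+ 2) +ᵠ b *ᵠ b +ᵠ ι (+ 2)) ≡ 1ℚ → ι (+ 4) *ᵠ (x *ᵠ x) +ᵠ b *ᵠ b ≡ ι (+ 4)
          lem z = linℚ1 (ι (+ 4)) z (Solver.solve (x ∷ b ∷ []) ℚring)
  p≡-2 : ι (+ 2) *ᵠ x *ᵠ (ι (+ 2) *ᵠ x) +ᵠ b *ᵠ b ≡ 0ℚ → Parametrised₁ x e a
  p≡-2 z = fin (sumSq≡0 (ι (+ 2) *ᵠ x) b z)
    where
    fin : ι (+ 2) *ᵠ x ≡ 0ℚ × b ≡ 0ℚ → Parametrised₁ x e a
    fin (2x≡0 , b≡0) = trace0 x≡0 (lem x≡0 b≡0)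
      where
      x≡0 : x ≡ 0ℚ
      x≡0 = linℚ1 ½ 2x≡0 (Solver.solve (x ∷ []) ℚring)
      lem : x ≡ 0ℚ → b ≡ 0ℚ → a *ᵠ a ≡ ι (+ 4) -ᵠ (1ℚ -ᵠ e) *ᵠ (1ℚ -ᵠ e)
      lem p q = zeroes E₁ p q
        where
        zeroes : ∀ {x b} → (a +ᵠ b *ᵠ x) *ᵠ (a +ᵠ b *ᵠ x) +ᵠ b *ᵠ b *ᵠ e ≡ -ᵠ ((x *ᵠ x +ᵠ e -ᵠ ι (+ 3)) *ᵠ (x *ᵠ x +ᵠ e +ᵠ 1ℚ) +ᵠ ι (+ 4) *ᵠ (x *ᵠ x *ᵠ e)) →
          x ≡ 0ℚ → b ≡ 0ℚ → a *ᵠ a ≡ ι (+ 4) -ᵠ (1ℚ -ᵠ e) *ᵠ (1ℚ -ᵠ e)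
        zeroes E refl refl = linℚ1 1ℚ E (Solver.solve (a ∷ e ∷ []) ℚring)
  p≡2 : ι (+ 4) *ᵠ (x *ᵠ x) +ᵠ b *ᵠ b ≡ ι (+ 4) → Parametrised₁ x e a
  p≡2 z = conic (lem x e a b sδ nn′ z)
    where
    lem : ∀ x e a b → ι (+ 2) *ᵠ x *ᵠ (ι (+ 2) *ᵠ (x *ᵠ x -ᵠ e) -ᵠ (ι (+ 4) *ᵠ (x *ᵠ x) -ᵠ ι (+ 2) +ᵠ b *ᵠ b)) ≡ ι (+ 2) *ᵠ (a *ᵠ b) →
      (x *ᵠ x -ᵠ e) *ᵠ ((ι (+ 4) *ᵠ (x *ᵠ x) -ᵠ ι (+ 2) +ᵠ b *ᵠ b) -ᵠ (x *ᵠ x -ᵠ e)) ≡ a *ᵠ a -ᵠ ι (+ 3) →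
      ι (+ 4) *ᵠ (x *ᵠ x) +ᵠ b *ᵠ b ≡ ι (+ 4) →
      ι (+ 4) *ᵠ (x *ᵠ x) +ᵠ (x *ᵠ x -ᵠ e -ᵠ 1ℚ) *ᵠ (x *ᵠ x -ᵠ e -ᵠ 1ℚ) ≡ ι (+ 4)
    lem x e a b S Q Z = lem₃ (x *ᵠ x -ᵠ e) (lem₁ (x *ᵠ x -ᵠ e) S Z) (lem₂ (x *ᵠ x -ᵠ e) Q Z)
      where
      -- With b² = 4 - s² the two relations become s (n - 1) = ab and n (2 - n) = a² - 3.
      lem₁ : ∀ n → ι (+ 2) *ᵠ x *ᵠ (ι (+ 2) *ᵠ n -ᵠ (ι (+ 4) *ᵠ (x *ᵠ x) -ᵠ ι (+ 2) +ᵠ b *ᵠ b)) ≡ ι (+ 2) *ᵠ (a *ᵠ b) →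
        ι (+ 4) *ᵠ (x *ᵠ x) +ᵠ b *ᵠ b ≡ ι (+ 4) → ι (+ 2) *ᵠ x *ᵠ (n -ᵠ 1ℚ) ≡ a *ᵠ b
      lem₁ n S Z = linℚ2 ½ x S Z (Solver.solve (x ∷ n ∷ a ∷ b ∷ []) ℚring)
      lem₂ : ∀ n → n *ᵠ ((ι (+ 4) *ᵠ (x *ᵠ x) -ᵠ ι (+ 2) +ᵠ b *ᵠ b) -ᵠ n) ≡ a *ᵠ a -ᵠ ι (+ 3) →
        ι (+ 4) *ᵠ (x *ᵠ x) +ᵠ b *ᵠ b ≡ ι (+ 4) → (n -ᵠ 1ℚ) *ᵠ (n -ᵠ 1ℚ) ≡ ι (+ 4) -ᵠ a *ᵠ a
      lem₂ n Q Z = linℚ2 (-ᵠ 1ℚ) n Q Z (Solver.solve (x ∷ n ∷ a ∷ b ∷ []) ℚring)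
      lem₃ : ∀ n → ι (+ 2) *ᵠ x *ᵠ (n -ᵠ 1ℚ) ≡ a *ᵠ b → (n -ᵠ 1ℚ) *ᵠ (n -ᵠ 1ℚ) ≡ ι (+ 4) -ᵠ a *ᵠ a →
        ι (+ 4) *ᵠ (x *ᵠ x) +ᵠ (n -ᵠ 1ℚ) *ᵠ (n -ᵠ 1ℚ) ≡ ι (+ 4)
      lem₃ n S′ Q′ = linℚ1 (¼) (lem₄ S′ Q′ Z) (Solver.solve (x ∷ n ∷ []) ℚring)
        where
        -- Squaring s(n - 1) = ab gives s²(4 - a²) = (4 - s²)a², hence s² = a².
        lem₄ : ι (+ 2) *ᵠ x *ᵠ (n -ᵠ 1ℚ) ≡ a *ᵠ b → (n -ᵠ 1ℚ) *ᵠ (n -ᵠ 1ℚ) ≡ ι (+ 4) -ᵠ a *ᵠ a → ι (+ 4) *ᵠ (x *ᵠ x) +ᵠ b *ᵠ b ≡ ι (+ 4) →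
          ι (+ 4) *ᵠ (ι (+ 4) *ᵠ (x *ᵠ x) +ᵠ (n -ᵠ 1ℚ) *ᵠ (n -ᵠ 1ℚ)) ≡ ι (+ 16)
        lem₄ S′ Q′ Z = linℚ3 (ι (+ 2) *ᵠ x *ᵠ (n -ᵠ 1ℚ) +ᵠ a *ᵠ b) (ι (+ 4) -ᵠ ι (+ 4) *ᵠ (x *ᵠ x)) (a *ᵠ a) S′ Q′ Z (Solver.solve (x ∷ n ∷ a ∷ b ∷ []) ℚring)

-- The substitution is x = (1 - X) / 2, y = (Z - 2) / 4, so that y(y + 1) = (Z² - 4) / 16.
ellipticℚ : ∀ X Z → Z *ᵠ Z ≡ ι (-[1+ 1 ]) *ᵠ (X *ᵠ X *ᵠ X -ᵠ X *ᵠ X -ᵠ X -ᵠ 1ℚ) → X ≡ 1ℚ ⊎ X ≡ -ᵠ 1ℚ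
ellipticℚ X Z e = either (modularCurve (½ *ᵠ (1ℚ -ᵠ X)) (½ *ᵠ (½ *ᵠ Z -ᵠ 1ℚ)) (linℚ1 (¼ *ᵠ ¼) e (Solver.solve (X ∷ Z ∷ []) ℚring)))
  (λ p → inj₁ (plus p)) λ p → inj₂ (minus p)
  where
  plus : ½ *ᵠ (1ℚ -ᵠ X) ≡ 0ℚ → X ≡ 1ℚ
  plus p = linℚ1 (ι (-[1+ 1 ])) p (Solver.solve (X ∷ []) ℚring)
  minus : ½ *ᵠ (1ℚ -ᵠ X) ≡ 1ℚ → X ≡ -ᵠ 1ℚ
  minus p = linℚ1 (ι (-[1+ 1 ])) p (Solver.solve (X ∷ []) ℚring)

diffSq : ∀ x y → x *ᵠ x ≡ y *ᵠ y → x ≡ y ⊎ x ≡ -ᵠ y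
diffSq x y e = either (noZeroDivℚ (x -ᵠ y) (x +ᵠ y) (linℚ1 1ℚ e (Solver.solve (x ∷ y ∷ []) ℚring)))
  (λ p → inj₁ (minus p)) (λ p → inj₂ (plus p))
  where
  minus : x -ᵠ y ≡ 0ℚ → x ≡ y
  minus p = linℚ1 1ℚ p (Solver.solve (x ∷ y ∷ []) ℚring)
  plus : x +ᵠ y ≡ 0ℚ → x ≡ -ᵠ y
  plus p = linℚ1 1ℚ p (Solver.solve (x ∷ y ∷ []) ℚring)

-- The line z = c + m x through a quadratic point and its conjugate meets the elliptic curve
-- again in one of the rational points with x = 1 or x = -1.
data Parametrised₂ (x e : ℚ) : Set where
  through⁺ : ∀ k → ι (+ 2) *ᵠ x ≡ -ᵠ (½ *ᵠ (k *ᵠ k)) → x *ᵠ x -ᵠ e ≡ ι (+ 2) *ᵠ k -ᵠ 1ℚ -ᵠ ½ *ᵠ (k *ᵠ k) → Parametrised₂ x e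
  through⁻ : ∀ k → ι (+ 2) *ᵠ x ≡ ι (+ 2) -ᵠ ½ *ᵠ (k *ᵠ k) → x *ᵠ x -ᵠ e ≡ ι (+ 2) *ᵠ k +ᵠ 1ℚ +ᵠ ½ *ᵠ (k *ᵠ k) → Parametrised₂ x e

parametrise₂ : ∀ x e c m →
  (c +ᵠ m *ᵠ x) *ᵠ (c +ᵠ m *ᵠ x) +ᵠ m *ᵠ m *ᵠ e ≡ ι (-[1+ 1 ]) *ᵠ (x *ᵠ x *ᵠ x +ᵠ ι (+ 3) *ᵠ (x *ᵠ e) -ᵠ (x *ᵠ x +ᵠ e) -ᵠ x -ᵠ 1ℚ) →
  (c +ᵠ m *ᵠ x) *ᵠ m ≡ -ᵠ (ι (+ 3) *ᵠ (x *ᵠ x) +ᵠ e -ᵠ ι (+ 2) *ᵠ x -ᵠ 1ℚ) → Parametrised₂ x e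
parametrise₂ x e c m F₁ F₂ = go (ellipticℚ X₀ (c +ᵠ m *ᵠ X₀) third)
  where
  X₀ : ℚ
  -- The abscissae of the three points on the line have sum 1 - m² / 2, and the two conjugate ones
  -- contribute 2x.
  X₀ = 1ℚ -ᵠ ι (+ 2) *ᵠ x -ᵠ ½ *ᵠ (m *ᵠ m)
  OnCurve : ℚ → Set
  OnCurve X = (c +ᵠ m *ᵠ X) *ᵠ (c +ᵠ m *ᵠ X) ≡ ι (-[1+ 1 ]) *ᵠ (X *ᵠ X *ᵠ X -ᵠ X *ᵠ X -ᵠ X -ᵠ 1ℚ)
  third : OnCurve X₀
  third = lem
    where
    lem : (c +ᵠ m *ᵠ (1ℚ -ᵠ ι (+ 2) *ᵠ x -ᵠ ½ *ᵠ (m *ᵠ m))) *ᵠ (c +ᵠ m *ᵠ (1ℚ -ᵠ ι (+ 2) *ᵠ x -ᵠ ½ *ᵠ (m *ᵠ m))) ≡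
      ι (-[1+ 1 ]) *ᵠ ((1ℚ -ᵠ ι (+ 2) *ᵠ x -ᵠ ½ *ᵠ (m *ᵠ m)) *ᵠ (1ℚ -ᵠ ι (+ 2) *ᵠ x -ᵠ ½ *ᵠ (m *ᵠ m)) *ᵠ (1ℚ -ᵠ ι (+ 2) *ᵠ x -ᵠ ½ *ᵠ (m *ᵠ m))
        -ᵠ (1ℚ -ᵠ ι (+ 2) *ᵠ x -ᵠ ½ *ᵠ (m *ᵠ m)) *ᵠ (1ℚ -ᵠ ι (+ 2) *ᵠ x -ᵠ ½ *ᵠ (m *ᵠ m)) -ᵠ (1ℚ -ᵠ ι (+ 2) *ᵠ x -ᵠ ½ *ᵠ (m *ᵠ m)) -ᵠ 1ℚ)
    lem = linℚ2 1ℚ (ι (+ 2) *ᵠ (1ℚ -ᵠ ι (+ 2) *ᵠ x -ᵠ ½ *ᵠ (m *ᵠ m)) -ᵠ ι (+ 2) *ᵠ x) F₁ F₂ (Solver.solve (x ∷ e ∷ c ∷ m ∷ []) ℚring)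
  at⁺ : 1ℚ -ᵠ ι (+ 2) *ᵠ x -ᵠ ½ *ᵠ (m *ᵠ m) ≡ 1ℚ → c +ᵠ m *ᵠ 1ℚ ≡ ι (+ 2) ⊎ c +ᵠ m *ᵠ 1ℚ ≡ -ᵠ ι (+ 2) → Parametrised₂ x e
  -- The third point has z = 2 or z = -2; reflection in the x-axis changes m to -m, so one formula
  -- in k serves for both.
  at⁺ X₀≡1 sgn = either sgn (λ p → through⁺ m s≡ (norm⁺ s≡ p)) λ p → through⁺ (-ᵠ m) (trans s≡ (Solver.solve (m ∷ []) ℚring)) (norm⁻ s≡ p)
    where
    s≡ : ι (+ 2) *ᵠ x ≡ -ᵠ (½ *ᵠ (m *ᵠ m))
    s≡ = linℚ1 (-ᵠ 1ℚ) X₀≡1 (Solver.solve (x ∷ m ∷ []) ℚring)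
    norm⁺ : ι (+ 2) *ᵠ x ≡ -ᵠ (½ *ᵠ (m *ᵠ m)) → c +ᵠ m *ᵠ 1ℚ ≡ ι (+ 2) → x *ᵠ x -ᵠ e ≡ ι (+ 2) *ᵠ m -ᵠ 1ℚ -ᵠ ½ *ᵠ (m *ᵠ m)
    norm⁺ s q = linℚ3 (-ᵠ 1ℚ) m (ι (+ 2) *ᵠ x -ᵠ 1ℚ) F₂ q s (Solver.solve (x ∷ e ∷ c ∷ m ∷ []) ℚring)
    norm⁻ : ι (+ 2) *ᵠ x ≡ -ᵠ (½ *ᵠ (m *ᵠ m)) → c +ᵠ m *ᵠ 1ℚ ≡ -ᵠ ι (+ 2) → x *ᵠ x -ᵠ e ≡ ι (+ 2) *ᵠ (-ᵠ m) -ᵠ 1ℚ -ᵠ ½ *ᵠ ((-ᵠ m) *ᵠ (-ᵠ m))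
    norm⁻ s q = linℚ3 (-ᵠ 1ℚ) m (ι (+ 2) *ᵠ x -ᵠ 1ℚ) F₂ q s (Solver.solve (x ∷ e ∷ c ∷ m ∷ []) ℚring)
  at⁻ : 1ℚ -ᵠ ι (+ 2) *ᵠ x -ᵠ ½ *ᵠ (m *ᵠ m) ≡ -ᵠ 1ℚ → c +ᵠ m *ᵠ (-ᵠ 1ℚ) ≡ ι (+ 2) ⊎ c +ᵠ m *ᵠ (-ᵠ 1ℚ) ≡ -ᵠ ι (+ 2) → Parametrised₂ x e
  at⁻ X₀≡-1 sgn = either sgn (λ p → through⁻ m s≡ (norm⁺ s≡ p)) λ p → through⁻ (-ᵠ m) (trans s≡ (Solver.solve (m ∷ []) ℚring)) (norm⁻ s≡ p)
    where
    s≡ : ι (+ 2) *ᵠ x ≡ ι (+ 2) -ᵠ ½ *ᵠ (m *ᵠ m)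
    s≡ = linℚ1 (-ᵠ 1ℚ) X₀≡-1 (Solver.solve (x ∷ m ∷ []) ℚring)
    norm⁺ : ι (+ 2) *ᵠ x ≡ ι (+ 2) -ᵠ ½ *ᵠ (m *ᵠ m) → c +ᵠ m *ᵠ (-ᵠ 1ℚ) ≡ ι (+ 2) → x *ᵠ x -ᵠ e ≡ ι (+ 2) *ᵠ m +ᵠ 1ℚ +ᵠ ½ *ᵠ (m *ᵠ m)
    norm⁺ s q = linℚ3 (-ᵠ 1ℚ) m (ι (+ 2) *ᵠ x +ᵠ 1ℚ) F₂ q s (Solver.solve (x ∷ e ∷ c ∷ m ∷ []) ℚring)
    norm⁻ : ι (+ 2) *ᵠ x ≡ ι (+ 2) -ᵠ ½ *ᵠ (m *ᵠ m) → c +ᵠ m *ᵠ (-ᵠ 1ℚ) ≡ -ᵠ ι (+ 2) → x *ᵠ x -ᵠ e ≡ ι (+ 2) *ᵠ (-ᵠ m) +ᵠ 1ℚ +ᵠ ½ *ᵠ ((-ᵠ m) *ᵠ (-ᵠ m))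
    norm⁻ s q = linℚ3 (-ᵠ 1ℚ) m (ι (+ 2) *ᵠ x +ᵠ 1ℚ) F₂ q s (Solver.solve (x ∷ e ∷ c ∷ m ∷ []) ℚring)
  go : X₀ ≡ 1ℚ ⊎ X₀ ≡ -ᵠ 1ℚ → Parametrised₂ x e
  go (inj₁ p) = at⁺ p (diffSq (c +ᵠ m *ᵠ 1ℚ) (ι (+ 2)) (subst OnCurve p third))
  go (inj₂ p) = at⁻ p (diffSq (c +ᵠ m *ᵠ (-ᵠ 1ℚ)) (ι (+ 2)) (subst OnCurve p third))

-- 4e is the discriminant of the quadratic equation satisfied by x.
discriminant-square : ∀ x e a → Parametrised₁ x e a → Parametrised₂ x e → ∃[ t ] e ≡ t *ᵠ t
-- In every case that survives, the polynomial T² - sT + n is T² - 1, with e = 1, or (T ± 1)², with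
-- e = 0.
discriminant-square x e a (trace0 x≡0 a²) (through⁺ k s n) = 1ℚ , fin k≡0 n x≡0
  where
  k≡0 : k ≡ 0ℚ
  k≡0 = sq≡0ℚ k (linℚ2 (ι (+ 2)) (-ᵠ ι (+ 4)) s x≡0 (Solver.solve (x ∷ k ∷ []) ℚring))
  fin : k ≡ 0ℚ → x *ᵠ x -ᵠ e ≡ ι (+ 2) *ᵠ k -ᵠ 1ℚ -ᵠ ½ *ᵠ (k *ᵠ k) → x ≡ 0ℚ → e ≡ 1ℚ *ᵠ 1ℚ
  fin refl n refl = linℚ1 (-ᵠ 1ℚ) n (Solver.solve (e ∷ []) ℚring)
discriminant-square x e a (trace0 x≡0 a²) (through⁻ k s n) = either (diffSq k (ι (+ 2)) (k² s x≡0)) (λ p → ⊥-elim (seven p n x≡0 a²)) λ p → 1ℚ , fin p n x≡0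
  where
  k² : ι (+ 2) *ᵠ x ≡ ι (+ 2) -ᵠ ½ *ᵠ (k *ᵠ k) → x ≡ 0ℚ → k *ᵠ k ≡ ι (+ 2) *ᵠ ι (+ 2)
  k² s z = linℚ2 (ι (+ 2)) (-ᵠ ι (+ 4)) s z (Solver.solve (x ∷ k ∷ []) ℚring)
  seven : ∀ {e x k} → k ≡ ι (+ 2) → x *ᵠ x -ᵠ e ≡ ι (+ 2) *ᵠ k +ᵠ 1ℚ +ᵠ ½ *ᵠ (k *ᵠ k) → x ≡ 0ℚ → a *ᵠ a ≡ ι (+ 4) -ᵠ (1ℚ -ᵠ e) *ᵠ (1ℚ -ᵠ e) → ⊥
  -- The norm is 7, so e = -7 and a² = 4 - 8² = -60.
  seven {e} refl n refl a² = no-sqrt (-[1+ 59 ]) {a} (negative≢sq 59) (linℚ2 1ℚ (1ℚ -ᵠ e +ᵠ ι (+ 8)) a² (-e n) (Solver.solve (a ∷ e ∷ []) ℚring))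
    where -e : 0ℚ *ᵠ 0ℚ -ᵠ e ≡ ι (+ 2) *ᵠ ι (+ 2) +ᵠ 1ℚ +ᵠ ½ *ᵠ (ι (+ 2) *ᵠ ι (+ 2)) → e ≡ -ᵠ ι (+ 7)
          -e n = linℚ1 (-ᵠ 1ℚ) n (Solver.solve (e ∷ []) ℚring)
  fin : k ≡ -ᵠ ι (+ 2) → x *ᵠ x -ᵠ e ≡ ι (+ 2) *ᵠ k +ᵠ 1ℚ +ᵠ ½ *ᵠ (k *ᵠ k) → x ≡ 0ℚ → e ≡ 1ℚ *ᵠ 1ℚ
  fin refl n refl = linℚ1 (-ᵠ 1ℚ) n (Solver.solve (e ∷ []) ℚring)
discriminant-square x e a (conic q) (through⁺ k s n) = either (noZeroDivℚ k ((k -ᵠ ι (+ 2)) *ᵠ (k *ᵠ k -ᵠ ι (+ 2) *ᵠ k +ᵠ ι (+ 8))) quartic-in-k)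
    (λ p → 1ℚ , at0 p s n) λ p → either (noZeroDivℚ (k -ᵠ ι (+ 2)) (k *ᵠ k -ᵠ ι (+ 2) *ᵠ k +ᵠ ι (+ 8)) p) (λ p → 0ℚ , at2 (k≡2 p) s n) λ p → ⊥-elim (neither p)
  where
  -- This is s² + (n - 1)² = 4 written in terms of k. The last factor is (k - 1)² + 7 and has no
  -- rational root.
  quartic-in-k : k *ᵠ ((k -ᵠ ι (+ 2)) *ᵠ (k *ᵠ k -ᵠ ι (+ 2) *ᵠ k +ᵠ ι (+ 8))) ≡ 0ℚ
  quartic-in-k = linℚ3 (ι (+ 2)) (-ᵠ (ι (+ 2) *ᵠ (ι (+ 2) *ᵠ x -ᵠ ½ *ᵠ (k *ᵠ k))))
    (-ᵠ (ι (+ 2) *ᵠ (x *ᵠ x -ᵠ e -ᵠ 1ℚ +ᵠ (ι (+ 2) *ᵠ k -ᵠ ι (+ 2) -ᵠ ½ *ᵠ (k *ᵠ k))))) q s n (Solver.solve (x ∷ e ∷ k ∷ []) ℚring)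
  k≡2 : k -ᵠ ι (+ 2) ≡ 0ℚ → k ≡ ι (+ 2)
  k≡2 p = linℚ1 1ℚ p (Solver.solve (k ∷ []) ℚring)
  neither : k *ᵠ k -ᵠ ι (+ 2) *ᵠ k +ᵠ ι (+ 8) ≡ 0ℚ → ⊥
  neither p = no-sqrt (-[1+ 6 ]) {k -ᵠ 1ℚ} (negative≢sq 6) (linℚ1 1ℚ p (Solver.solve (k ∷ []) ℚring))
  at0 : ∀ {k} → k ≡ 0ℚ → ι (+ 2) *ᵠ x ≡ -ᵠ (½ *ᵠ (k *ᵠ k)) → x *ᵠ x -ᵠ e ≡ ι (+ 2) *ᵠ k -ᵠ 1ℚ -ᵠ ½ *ᵠ (k *ᵠ k) → e ≡ 1ℚ *ᵠ 1ℚ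
  at0 refl s n = linℚ2 (½ *ᵠ x) (-ᵠ 1ℚ) s n (Solver.solve (x ∷ e ∷ []) ℚring)
  at2 : ∀ {k} → k ≡ ι (+ 2) → ι (+ 2) *ᵠ x ≡ -ᵠ (½ *ᵠ (k *ᵠ k)) → x *ᵠ x -ᵠ e ≡ ι (+ 2) *ᵠ k -ᵠ 1ℚ -ᵠ ½ *ᵠ (k *ᵠ k) → e ≡ 0ℚ *ᵠ 0ℚ
  at2 refl s n = linℚ2 (½ *ᵠ (x -ᵠ 1ℚ)) (-ᵠ 1ℚ) s n (Solver.solve (x ∷ e ∷ []) ℚring)
discriminant-square x e a (conic q) (through⁻ k s n) = either (noZeroDivℚ k (k +ᵠ ι (+ 2)) (sq≡0ℚ (k *ᵠ (k +ᵠ ι (+ 2))) quartic-in-k))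
    (λ p → 0ℚ , at0 p s n) λ p → 1ℚ , at-2 (k≡-2 p) s n
  where
  quartic-in-k : k *ᵠ (k +ᵠ ι (+ 2)) *ᵠ (k *ᵠ (k +ᵠ ι (+ 2))) ≡ 0ℚ
  quartic-in-k = linℚ3 (ι (+ 2)) (-ᵠ (ι (+ 2) *ᵠ (ι (+ 2) *ᵠ x +ᵠ (ι (+ 2) -ᵠ ½ *ᵠ (k *ᵠ k)))))
    (-ᵠ (ι (+ 2) *ᵠ (x *ᵠ x -ᵠ e -ᵠ 1ℚ +ᵠ (ι (+ 2) *ᵠ k +ᵠ ½ *ᵠ (k *ᵠ k))))) q s n (Solver.solve (x ∷ e ∷ k ∷ []) ℚring)
  k≡-2 : k +ᵠ ι (+ 2) ≡ 0ℚ → k ≡ -ᵠ ι (+ 2)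
  k≡-2 p = linℚ1 1ℚ p (Solver.solve (k ∷ []) ℚring)
  at0 : ∀ {k} → k ≡ 0ℚ → ι (+ 2) *ᵠ x ≡ ι (+ 2) -ᵠ ½ *ᵠ (k *ᵠ k) → x *ᵠ x -ᵠ e ≡ ι (+ 2) *ᵠ k +ᵠ 1ℚ +ᵠ ½ *ᵠ (k *ᵠ k) → e ≡ 0ℚ *ᵠ 0ℚ
  at0 refl s n = linℚ2 (½ *ᵠ (x +ᵠ 1ℚ)) (-ᵠ 1ℚ) s n (Solver.solve (x ∷ e ∷ []) ℚring)
  at-2 : ∀ {k} → k ≡ -ᵠ ι (+ 2) → ι (+ 2) *ᵠ x ≡ ι (+ 2) -ᵠ ½ *ᵠ (k *ᵠ k) → x *ᵠ x -ᵠ e ≡ ι (+ 2) *ᵠ k +ᵠ 1ℚ +ᵠ ½ *ᵠ (k *ᵠ k) → e ≡ 1ℚ *ᵠ 1ℚ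
  at-2 refl s n = linℚ2 (½ *ᵠ x) (-ᵠ 1ℚ) s n (Solver.solve (x ∷ e ∷ []) ℚring)

-- Points over ℚ(√d)

-- The two equations of OnY in coordinates with respect to 1 and √D.
Y₀ Y₁ Z₀ Z₁ : (D x₁ x₂ : ℚ) → ℚ → ℚ → Set
Y₀ D x₁ x₂ y₁ y₂ =
  let A = x₁ *ᵠ x₁ +ᵠ D *ᵠ (x₂ *ᵠ x₂)
      B = x₁ *ᵠ x₂ +ᵠ x₂ *ᵠ x₁
  in y₁ *ᵠ y₁ +ᵠ D *ᵠ (y₂ *ᵠ y₂) ≡ -ᵠ ((A +ᵠ -ᵠ ι (+ 3)) *ᵠ (A +ᵠ 1ℚ) +ᵠ D *ᵠ ((B +ᵠ -ᵠ 0ℚ) *ᵠ (B +ᵠ 0ℚ)))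
Y₁ D x₁ x₂ y₁ y₂ =
  let A = x₁ *ᵠ x₁ +ᵠ D *ᵠ (x₂ *ᵠ x₂)
      B = x₁ *ᵠ x₂ +ᵠ x₂ *ᵠ x₁
  in y₁ *ᵠ y₂ +ᵠ y₂ *ᵠ y₁ ≡ -ᵠ ((A +ᵠ -ᵠ ι (+ 3)) *ᵠ (B +ᵠ 0ℚ) +ᵠ (B +ᵠ -ᵠ 0ℚ) *ᵠ (A +ᵠ 1ℚ))
Z₀ D x₁ x₂ z₁ z₂ =
  let A = x₁ *ᵠ x₁ +ᵠ D *ᵠ (x₂ *ᵠ x₂)
      B = x₁ *ᵠ x₂ +ᵠ x₂ *ᵠ x₁
      C = A *ᵠ x₁ +ᵠ D *ᵠ (B *ᵠ x₂) +ᵠ -ᵠ A +ᵠ -ᵠ x₁ +ᵠ -ᵠ 1ℚ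
      E = A *ᵠ x₂ +ᵠ B *ᵠ x₁ +ᵠ -ᵠ B +ᵠ -ᵠ x₂ +ᵠ -ᵠ 0ℚ
  in z₁ *ᵠ z₁ +ᵠ D *ᵠ (z₂ *ᵠ z₂) ≡ ι (-[1+ 1 ]) *ᵠ C +ᵠ D *ᵠ (0ℚ *ᵠ E)
Z₁ D x₁ x₂ z₁ z₂ =
  let A = x₁ *ᵠ x₁ +ᵠ D *ᵠ (x₂ *ᵠ x₂)
      B = x₁ *ᵠ x₂ +ᵠ x₂ *ᵠ x₁
      C = A *ᵠ x₁ +ᵠ D *ᵠ (B *ᵠ x₂) +ᵠ -ᵠ A +ᵠ -ᵠ x₁ +ᵠ -ᵠ 1ℚ
      E = A *ᵠ x₂ +ᵠ B *ᵠ x₁ +ᵠ -ᵠ B +ᵠ -ᵠ x₂ +ᵠ -ᵠ 0ℚ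
  in z₁ *ᵠ z₂ +ᵠ z₂ *ᵠ z₁ ≡ ι (-[1+ 1 ]) *ᵠ E +ᵠ 0ℚ *ᵠ C

-- With b = y₂ / x₂ one has y = (y₁ - bx₁) + bx. The √D-component of the equation is then divisible
-- by x₂, which is cancelled.
quadratic-Y : ∀ D x₁ x₂ y₁ b → x₂ ≢ 0ℚ → Y₀ D x₁ x₂ y₁ (b *ᵠ x₂) → Y₁ D x₁ x₂ y₁ (b *ᵠ x₂) →
  Parametrised₁ x₁ (D *ᵠ (x₂ *ᵠ x₂)) (y₁ -ᵠ b *ᵠ x₁)
quadratic-Y D x₁ x₂ y₁ b x₂≢0 e₀ e₁ = parametrise₁ x₁ (D *ᵠ (x₂ *ᵠ x₂)) (y₁ -ᵠ b *ᵠ x₁) b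
  (linℚ1 1ℚ e₀ (Solver.solve (D ∷ x₁ ∷ x₂ ∷ y₁ ∷ b ∷ []) ℚring))
  (cancelℚ x₂ x₂≢0 (linℚ1 ½ e₁ (Solver.solve (D ∷ x₁ ∷ x₂ ∷ y₁ ∷ b ∷ []) ℚring)))

quadratic-Z : ∀ D x₁ x₂ z₁ m → x₂ ≢ 0ℚ → Z₀ D x₁ x₂ z₁ (m *ᵠ x₂) → Z₁ D x₁ x₂ z₁ (m *ᵠ x₂) →
  Parametrised₂ x₁ (D *ᵠ (x₂ *ᵠ x₂))
quadratic-Z D x₁ x₂ z₁ m x₂≢0 e₀ e₁ = parametrise₂ x₁ (D *ᵠ (x₂ *ᵠ x₂)) (z₁ -ᵠ m *ᵠ x₁) m
  (linℚ1 1ℚ e₀ (Solver.solve (D ∷ x₁ ∷ x₂ ∷ z₁ ∷ m ∷ []) ℚring))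
  (cancelℚ x₂ x₂≢0 (linℚ1 ½ e₁ (Solver.solve (D ∷ x₁ ∷ x₂ ∷ z₁ ∷ m ∷ []) ℚring)))

±1 : ℚ → Set
±1 x = x ≡ 1ℚ ⊎ x ≡ -ᵠ 1ℚ

-- The tangent line at a rational point gives a degenerate case of the parametrisation.
rational-Y : ∀ x y → y *ᵠ y ≡ -ᵠ ((x *ᵠ x -ᵠ ι (+ 3)) *ᵠ (x *ᵠ x +ᵠ 1ℚ)) → ±1 x
rational-Y x y e = go (y ℚ.≟ 0ℚ)
  where
  y≢0 : y ≢ 0ℚ
  y≢0 refl = either (noZeroDivℚ (x *ᵠ x -ᵠ ι (+ 3)) (x *ᵠ x +ᵠ 1ℚ) (linℚ1 1ℚ e (Solver.solve (x ∷ []) ℚring)))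
    (λ p → no-sqrt (+ 3) {x} 3≢sq (three p)) λ p → no-sqrt -1ℤ {x} (negative≢sq 0) (minus-one p)
    where
    three : x *ᵠ x -ᵠ ι (+ 3) ≡ 0ℚ → x *ᵠ x ≡ ι (+ 3)
    three p = linℚ1 1ℚ p (Solver.solve (x ∷ []) ℚring)
    minus-one : x *ᵠ x +ᵠ 1ℚ ≡ 0ℚ → x *ᵠ x ≡ ι -1ℤ
    minus-one p = linℚ1 1ℚ p (Solver.solve (x ∷ []) ℚring)
  tangent : ∀ b → b *ᵠ y ≡ ι (+ 2) *ᵠ x -ᵠ ι (+ 2) *ᵠ (x *ᵠ x *ᵠ x) → ±1 x
  tangent b by′ = fin (parametrise₁ x 0ℚ (y -ᵠ b *ᵠ x) b (linℚ1 1ℚ e (Solver.solve (x ∷ y ∷ b ∷ []) ℚring)) (linℚ1 1ℚ by′ (Solver.solve (x ∷ y ∷ b ∷ []) ℚring)))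
    where
    fin : Parametrised₁ x 0ℚ (y -ᵠ b *ᵠ x) → ±1 x
    fin (trace0 p _) = ⊥-elim (no-sqrt (+ 3) {y} 3≢sq (y²≡3 p e))
      where y²≡3 : ∀ {x} → x ≡ 0ℚ → y *ᵠ y ≡ -ᵠ ((x *ᵠ x -ᵠ ι (+ 3)) *ᵠ (x *ᵠ x +ᵠ 1ℚ)) → y *ᵠ y ≡ ι (+ 3)
            y²≡3 refl e = e
    fin (conic q) = either (noZeroDivℚ (x *ᵠ x -ᵠ 1ℚ *ᵠ 1ℚ) (x *ᵠ x +ᵠ ι (+ 3)) (linℚ1 1ℚ q (Solver.solve (x ∷ []) ℚring)))
      (λ p → diffSq x 1ℚ (one p)) λ p → ⊥-elim (no-sqrt (-[1+ 2 ]) {x} (negative≢sq 2) (minus-three p))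
      where
      one : x *ᵠ x -ᵠ 1ℚ *ᵠ 1ℚ ≡ 0ℚ → x *ᵠ x ≡ 1ℚ *ᵠ 1ℚ
      one p = linℚ1 1ℚ p (Solver.solve (x ∷ []) ℚring)
      minus-three : x *ᵠ x +ᵠ ι (+ 3) ≡ 0ℚ → x *ᵠ x ≡ ι (-[1+ 2 ])
      minus-three p = linℚ1 1ℚ p (Solver.solve (x ∷ []) ℚring)
  go : Dec (y ≡ 0ℚ) → ±1 x
  go (yes p) = ⊥-elim (y≢0 p)
  go (no p) = tangent (t *ᵠ j) (trans (ℚ.*-assoc t j y) (trans (cong (t *ᵠ_) (ℚ.*-inverseˡ y {{nz}})) (ℚ.*-identityʳ t)))
    where
    nz = Data.Rational.≢-nonZero p
    t j : ℚ
    t = ι (+ 2) *ᵠ x -ᵠ ι (+ 2) *ᵠ (x *ᵠ x *ᵠ x)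
    j = Data.Rational.1/_ y {{nz}}

multipleOf : ∀ x → x ≢ 0ℚ → ∀ y → ∃[ b ] y ≡ b *ᵠ x
multipleOf x x≢0 y = y *ᵠ j , sym (trans (ℚ.*-assoc y j x) (trans (cong (y *ᵠ_) (ℚ.*-inverseˡ x {{nz}})) (ℚ.*-identityʳ y)))
  where
  nz = Data.Rational.≢-nonZero x≢0
  j : ℚ
  j = Data.Rational.1/_ x {{nz}}

module _ {D : ℚ} (nonsquare : ∀ r → r *ᵠ r ≢ D) where
  product≡0 : ∀ y₁ y₂ → y₁ *ᵠ y₂ +ᵠ y₂ *ᵠ y₁ ≡ 0ℚ → y₁ ≡ 0ℚ ⊎ y₂ ≡ 0ℚ
  product≡0 y₁ y₂ e = noZeroDivℚ y₁ y₂ (linℚ1 ½ e (Solver.solve (y₁ ∷ y₂ ∷ []) ℚring))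

  -- The squares of y and z are rational, so each of y, z is rational or a rational multiple of √D.
  -- If both are multiples of √D, the twists cancel in the product yz = D y₂ z₂, which gives a
  -- rational point on the curve of genus 3.
  rational-x : ∀ x₁ y₁ y₂ z₁ z₂ → Y₀ D x₁ 0ℚ y₁ y₂ → Y₁ D x₁ 0ℚ y₁ y₂ → Z₀ D x₁ 0ℚ z₁ z₂ → Z₁ D x₁ 0ℚ z₁ z₂ → ±1 x₁
  rational-x x₁ y₁ y₂ z₁ z₂ e₀ e₁ f₀ f₁ = go
      (product≡0 y₁ y₂ (linℚ1 1ℚ e₁ (Solver.solve (D ∷ x₁ ∷ y₁ ∷ y₂ ∷ []) ℚring)))
      (product≡0 z₁ z₂ (linℚ1 1ℚ f₁ (Solver.solve (D ∷ x₁ ∷ z₁ ∷ z₂ ∷ []) ℚring)))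
    where
    go : y₁ ≡ 0ℚ ⊎ y₂ ≡ 0ℚ → z₁ ≡ 0ℚ ⊎ z₂ ≡ 0ℚ → ±1 x₁
    go (inj₂ p) _ = rational-Y x₁ y₁ (eq e₀ p)
      where eq : Y₀ D x₁ 0ℚ y₁ y₂ → y₂ ≡ 0ℚ → y₁ *ᵠ y₁ ≡ -ᵠ ((x₁ *ᵠ x₁ -ᵠ ι (+ 3)) *ᵠ (x₁ *ᵠ x₁ +ᵠ 1ℚ))
            eq e p = linℚ2 1ℚ (-ᵠ (D *ᵠ y₂)) e p (Solver.solve (D ∷ x₁ ∷ y₁ ∷ y₂ ∷ []) ℚring)
    go (inj₁ _) (inj₂ p) = ellipticℚ x₁ z₁ (eq f₀ p)
      where eq : Z₀ D x₁ 0ℚ z₁ z₂ → z₂ ≡ 0ℚ → z₁ *ᵠ z₁ ≡ ι (-[1+ 1 ]) *ᵠ (x₁ *ᵠ x₁ *ᵠ x₁ -ᵠ x₁ *ᵠ x₁ -ᵠ x₁ -ᵠ 1ℚ)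
            eq e p = linℚ2 1ℚ (-ᵠ (D *ᵠ z₂)) e p (Solver.solve (D ∷ x₁ ∷ z₁ ∷ z₂ ∷ []) ℚring)
    go (inj₁ p) (inj₁ q) = fin (genus3ℚ x₁ (D *ᵠ (y₂ *ᵠ z₂)) (product (twist-Y e₀ p) (twist-Z f₀ q)))
      where
      twist-Y : Y₀ D x₁ 0ℚ y₁ y₂ → y₁ ≡ 0ℚ → D *ᵠ (y₂ *ᵠ y₂) ≡ -ᵠ ((x₁ *ᵠ x₁ -ᵠ ι (+ 3)) *ᵠ (x₁ *ᵠ x₁ +ᵠ 1ℚ))
      twist-Y e p = linℚ2 1ℚ (-ᵠ y₁) e p (Solver.solve (D ∷ x₁ ∷ y₁ ∷ y₂ ∷ []) ℚring)
      twist-Z : Z₀ D x₁ 0ℚ z₁ z₂ → z₁ ≡ 0ℚ → D *ᵠ (z₂ *ᵠ z₂) ≡ ι (-[1+ 1 ]) *ᵠ (x₁ *ᵠ x₁ *ᵠ x₁ -ᵠ x₁ *ᵠ x₁ -ᵠ x₁ -ᵠ 1ℚ)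
      twist-Z e p = linℚ2 1ℚ (-ᵠ z₁) e p (Solver.solve (D ∷ x₁ ∷ z₁ ∷ z₂ ∷ []) ℚring)
      product : D *ᵠ (y₂ *ᵠ y₂) ≡ -ᵠ ((x₁ *ᵠ x₁ -ᵠ ι (+ 3)) *ᵠ (x₁ *ᵠ x₁ +ᵠ 1ℚ)) →
        D *ᵠ (z₂ *ᵠ z₂) ≡ ι (-[1+ 1 ]) *ᵠ (x₁ *ᵠ x₁ *ᵠ x₁ -ᵠ x₁ *ᵠ x₁ -ᵠ x₁ -ᵠ 1ℚ) →
        D *ᵠ (y₂ *ᵠ z₂) *ᵠ (D *ᵠ (y₂ *ᵠ z₂)) ≡ ι (+ 2) *ᵠ (x₁ *ᵠ x₁ -ᵠ ι (+ 3)) *ᵠ (x₁ *ᵠ x₁ +ᵠ 1ℚ) *ᵠ (x₁ *ᵠ x₁ *ᵠ x₁ -ᵠ x₁ *ᵠ x₁ -ᵠ x₁ -ᵠ 1ℚ)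
      product s t = linℚ2 (D *ᵠ (z₂ *ᵠ z₂)) (-ᵠ ((x₁ *ᵠ x₁ -ᵠ ι (+ 3)) *ᵠ (x₁ *ᵠ x₁ +ᵠ 1ℚ))) s t (Solver.solve (D ∷ x₁ ∷ y₂ ∷ z₂ ∷ []) ℚring)
      fin : ∃[ v ] v *ᵠ v ≡ -ᵠ ((x₁ *ᵠ x₁ -ᵠ ι (+ 3)) *ᵠ (x₁ *ᵠ x₁ +ᵠ 1ℚ)) → ±1 x₁
      fin (v , v²) = rational-Y x₁ v v²

  x≡±1 : ∀ x₁ x₂ y₁ y₂ z₁ z₂ → Y₀ D x₁ x₂ y₁ y₂ → Y₁ D x₁ x₂ y₁ y₂ → Z₀ D x₁ x₂ z₁ z₂ → Z₁ D x₁ x₂ z₁ z₂ → x₂ ≡ 0ℚ × ±1 x₁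
  x≡±1 x₁ x₂ y₁ y₂ z₁ z₂ e₀ e₁ f₀ f₁ = go (x₂ ℚ.≟ 0ℚ)
    where
    go : Dec (x₂ ≡ 0ℚ) → x₂ ≡ 0ℚ × ±1 x₁
    go (yes refl) = refl , rational-x x₁ y₁ y₂ z₁ z₂ e₀ e₁ f₀ f₁
    go (no x₂≢0) = ⊥-elim (fin (multipleOf x₂ x₂≢0 y₂) (multipleOf x₂ x₂≢0 z₂))
      where
      fin : ∃[ b ] y₂ ≡ b *ᵠ x₂ → ∃[ m ] z₂ ≡ m *ᵠ x₂ → ⊥
      fin (b , refl) (m , refl) = square (discriminant-square x₁ (D *ᵠ (x₂ *ᵠ x₂)) (y₁ -ᵠ b *ᵠ x₁)
          (quadratic-Y D x₁ x₂ y₁ b x₂≢0 e₀ e₁) (quadratic-Z D x₁ x₂ z₁ m x₂≢0 f₀ f₁))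
        where
        square : ∃[ t ] D *ᵠ (x₂ *ᵠ x₂) ≡ t *ᵠ t → ⊥
        square (t , p) = x₂≢0 (NonSquare⇒≡0 nonsquare x₂ t p)

  sqrt4 : ∀ y₁ y₂ → y₁ *ᵠ y₁ +ᵠ D *ᵠ (y₂ *ᵠ y₂) ≡ ι (+ 4) → y₁ *ᵠ y₂ +ᵠ y₂ *ᵠ y₁ ≡ 0ℚ → y₂ ≡ 0ℚ × (y₁ ≡ ι (+ 2) ⊎ y₁ ≡ -ᵠ ι (+ 2))
  sqrt4 y₁ y₂ e f = go (product≡0 y₁ y₂ f)
    where
    rational : y₁ *ᵠ y₁ +ᵠ D *ᵠ (y₂ *ᵠ y₂) ≡ ι (+ 4) → y₂ ≡ 0ℚ → y₁ *ᵠ y₁ ≡ ι (+ 2) *ᵠ ι (+ 2)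
    rational e p = linℚ2 1ℚ (-ᵠ (D *ᵠ y₂)) e p (Solver.solve (D ∷ y₁ ∷ y₂ ∷ []) ℚring)
    irrational : y₁ *ᵠ y₁ +ᵠ D *ᵠ (y₂ *ᵠ y₂) ≡ ι (+ 4) → y₁ ≡ 0ℚ → D *ᵠ (y₂ *ᵠ y₂) ≡ ι (+ 2) *ᵠ ι (+ 2)
    irrational e p = linℚ2 1ℚ (-ᵠ y₁) e p (Solver.solve (D ∷ y₁ ∷ y₂ ∷ []) ℚring)
    contradiction : y₁ *ᵠ y₁ +ᵠ D *ᵠ (y₂ *ᵠ y₂) ≡ ι (+ 4) → y₁ ≡ 0ℚ → y₂ ≡ 0ℚ → ⊥
    contradiction e refl refl = absurd (trans (sym (lem D)) e)
      where
      lem : ∀ D → 0ℚ *ᵠ 0ℚ +ᵠ D *ᵠ (0ℚ *ᵠ 0ℚ) ≡ 0ℚ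
      lem D = Solver.solve (D ∷ []) ℚring
      absurd : 0ℚ ≡ ι (+ 4) → ⊥
      absurd ()
    go : y₁ ≡ 0ℚ ⊎ y₂ ≡ 0ℚ → y₂ ≡ 0ℚ × (y₁ ≡ ι (+ 2) ⊎ y₁ ≡ -ᵠ ι (+ 2))
    go (inj₂ p) = p , diffSq y₁ (ι (+ 2)) (rational e p)
    go (inj₁ p) = ⊥-elim (contradiction e p (NonSquare⇒≡0 nonsquare y₂ (ι (+ 2)) (irrational e p)))

  y≡±2 : ∀ x₁ y₁ y₂ → ±1 x₁ → Y₀ D x₁ 0ℚ y₁ y₂ → Y₁ D x₁ 0ℚ y₁ y₂ → y₂ ≡ 0ℚ × (y₁ ≡ ι (+ 2) ⊎ y₁ ≡ -ᵠ ι (+ 2))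
  y≡±2 _ y₁ y₂ (inj₁ refl) e f = sqrt4 y₁ y₂ (linℚ1 1ℚ e (Solver.solve (D ∷ y₁ ∷ y₂ ∷ []) ℚring)) (linℚ1 1ℚ f (Solver.solve (D ∷ y₁ ∷ y₂ ∷ []) ℚring))
  y≡±2 _ y₁ y₂ (inj₂ refl) e f = sqrt4 y₁ y₂ (linℚ1 1ℚ e (Solver.solve (D ∷ y₁ ∷ y₂ ∷ []) ℚring)) (linℚ1 1ℚ f (Solver.solve (D ∷ y₁ ∷ y₂ ∷ []) ℚring))

  z≡±2 : ∀ x₁ z₁ z₂ → ±1 x₁ → Z₀ D x₁ 0ℚ z₁ z₂ → Z₁ D x₁ 0ℚ z₁ z₂ → z₂ ≡ 0ℚ × (z₁ ≡ ι (+ 2) ⊎ z₁ ≡ -ᵠ ι (+ 2))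
  z≡±2 _ z₁ z₂ (inj₁ refl) e f = sqrt4 z₁ z₂ (linℚ1 1ℚ e (Solver.solve (D ∷ z₁ ∷ z₂ ∷ []) ℚring)) (linℚ1 1ℚ f (Solver.solve (D ∷ z₁ ∷ z₂ ∷ []) ℚring))
  z≡±2 _ z₁ z₂ (inj₂ refl) e f = sqrt4 z₁ z₂ (linℚ1 1ℚ e (Solver.solve (D ∷ z₁ ∷ z₂ ∷ []) ℚring)) (linℚ1 1ℚ f (Solver.solve (D ∷ z₁ ∷ z₂ ∷ []) ℚring))

listed⇒OnY : ∀ d x y z → IsListedPoint d x y z → OnY d x y z
listed⇒OnY d x y z (px , py , pz) = on-Y px py , on-Z px pz
  where
  open Arith d renaming (_⊕_ to _⊕ᵠ_; _⊗_ to _⊗ᵠ_)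
  on-Y : x ≡ lit (+ 1) ⊎ x ≡ lit -1ℤ → y ≡ lit (+ 2) ⊎ y ≡ lit (-[1+ 1 ]) → y ⊗ᵠ y ≡ ⊖ ((x ⊗ᵠ x ⊝ lit (+ 3)) ⊗ᵠ (x ⊗ᵠ x ⊕ᵠ lit (+ 1)))
  -- All coordinates are closed rationals; only the product of `d / 1` with zero fails to evaluate.
  on-Y (inj₁ refl) (inj₁ refl) rewrite ℚ.*-zeroʳ (d / 1) = refl
  on-Y (inj₁ refl) (inj₂ refl) rewrite ℚ.*-zeroʳ (d / 1) = refl
  on-Y (inj₂ refl) (inj₁ refl) rewrite ℚ.*-zeroʳ (d / 1) = refl
  on-Y (inj₂ refl) (inj₂ refl) rewrite ℚ.*-zeroʳ (d / 1) = refl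
  on-Z : x ≡ lit (+ 1) ⊎ x ≡ lit -1ℤ → z ≡ lit (+ 2) ⊎ z ≡ lit (-[1+ 1 ]) → z ⊗ᵠ z ≡ lit (-[1+ 1 ]) ⊗ᵠ (x ⊗ᵠ x ⊗ᵠ x ⊝ x ⊗ᵠ x ⊝ x ⊝ lit (+ 1))
  on-Z (inj₁ refl) (inj₁ refl) rewrite ℚ.*-zeroʳ (d / 1) | ℚ.*-zeroʳ (d / 1) = refl
  on-Z (inj₁ refl) (inj₂ refl) rewrite ℚ.*-zeroʳ (d / 1) | ℚ.*-zeroʳ (d / 1) = refl
  on-Z (inj₂ refl) (inj₁ refl) rewrite ℚ.*-zeroʳ (d / 1) | ℚ.*-zeroʳ (d / 1) = refl
  on-Z (inj₂ refl) (inj₂ refl) rewrite ℚ.*-zeroʳ (d / 1) | ℚ.*-zeroʳ (d / 1) = refl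

OnY⇒listed : ∀ d → NonSquare d → ∀ x y z → OnY d x y z → IsListedPoint d x y z
OnY⇒listed d ns (x₁ , x₂) (y₁ , y₂) (z₁ , z₂) (e , f) = go (x≡±1 nonsquare x₁ x₂ y₁ y₂ z₁ z₂ e₀ e₁ f₀ f₁)
  where
  nonsquare : ∀ r → r *ᵠ r ≢ ι d
  nonsquare r = no-sqrt d {r} λ m p → ns (m , p)
  e₀ : Y₀ (ι d) x₁ x₂ y₁ y₂
  e₀ = cong proj₁ e
  e₁ : Y₁ (ι d) x₁ x₂ y₁ y₂
  e₁ = cong proj₂ e
  f₀ : Z₀ (ι d) x₁ x₂ z₁ z₂
  f₀ = cong proj₁ f
  f₁ : Z₁ (ι d) x₁ x₂ z₁ z₂
  f₁ = cong proj₂ f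
  embedded : ∀ {x₁ x₂ u v} → x₂ ≡ 0ℚ → x₁ ≡ u ⊎ x₁ ≡ v → (x₁ , x₂) ≡ (u , 0ℚ) ⊎ (x₁ , x₂) ≡ (v , 0ℚ)
  embedded refl (inj₁ refl) = inj₁ refl
  embedded refl (inj₂ refl) = inj₂ refl
  go : x₂ ≡ 0ℚ × ±1 x₁ → IsListedPoint d (x₁ , x₂) (y₁ , y₂) (z₁ , z₂)
  go (x₂≡0 , p) = embedded x₂≡0 p ,
      fin (y≡±2 nonsquare x₁ y₁ y₂ p (subst (λ x₂ → Y₀ (ι d) x₁ x₂ y₁ y₂) x₂≡0 e₀) (subst (λ x₂ → Y₁ (ι d) x₁ x₂ y₁ y₂) x₂≡0 e₁)) ,
      fin (z≡±2 nonsquare x₁ z₁ z₂ p (subst (λ x₂ → Z₀ (ι d) x₁ x₂ z₁ z₂) x₂≡0 f₀) (subst (λ x₂ → Z₁ (ι d) x₁ x₂ z₁ z₂) x₂≡0 f₁))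
    where
    fin : ∀ {y₁ y₂} → y₂ ≡ 0ℚ × (y₁ ≡ ι (+ 2) ⊎ y₁ ≡ -ᵠ ι (+ 2)) → (y₁ , y₂) ≡ (ι (+ 2) , 0ℚ) ⊎ (y₁ , y₂) ≡ (ι (-[1+ 1 ]) , 0ℚ)
    fin (q , r) = embedded q r

theorem5p4 : (d : ℤ) → NonSquare d → (x y z : Q√ d) →
    OnY d x y z ⇔ IsListedPoint d x y z
theorem5p4 d ns x y z = mk⇔ (OnY⇒listed d ns x y z) (listed⇒OnY d x y z)
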